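{- Let $G$ be a bridgeless cubic graph with $m_G^* \geq 6$. If $\mu_2(G) \leq 2$, then $G$ has a nowhere-zero 5-flow.
   Context: A cubic graph is a graph all of whose vertices have degree 3 (graphs are finite). A 1-factor of $G$ is a perfect matching, regarded as a set of edges; a 2-factor is a spanning 2-regular subgraph, i.e. a disjoint union of circuits covering all vertices. For a bridgeless cubic graph $G$ (which has 1-factors and 2-factors by Petersen's theorem): - $\mu_2(G) = \min\{|M_1 \cap M_2| : M_1 \text{ and } M_2 \text{ are 1-factors of } G\}$. - The oddness $\omega(G)$ is the minimum number of odd circuits in a 2-factor of $G$. A minimum 2-factor of $G$ is a 2-factor with precisely $\omega(G)$ odd circuits. - If $\omega(G) \geq 2$ and $\mathcal{F}$ is a minimum 2-factor of $G$, then $m_G(\mathcal{F})$ is the maximum number $k$ such that $G$ has no edge cut $E$ with fewer than $k$ edges such that two components of $G-E$ contain odd circuits of $\mathcal{F}$. (The oddness of a cubic graph is even, so $\omega(G)>0$ means $\omega(G)\ge 2$.) - $m_G^* = \infty$ if $\omega(G)=0$, and $m_G^* = \max\{m_G(\mathcal{F}) : \mathcal{F} \text{ is a minimum 2-factor of } G\}$ if $\omega(G)>0$. A nowhere-zero $k$-flow on $G$ is an assignment of a direction and a value from $\{1,\dots,k-1\}$ to each edge of $G$ such that Kirchhoff's law holds at every vertex (the sum of the values on incoming edges equals the sum of the values on outgoing edges). -}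

module Defs where

open import Data.Bool.Base using (Bool; if_then_else_; _xor_)
open import Data.Fin.Base using (Fin)
open import Data.Fin.Properties using (_≟_)
open import Data.Fin.Subset
  using (Subset; _∈_; _∉_; _⊆_; _∩_; _─_; _-_; ∣_∣; Nonempty) renaming (⊤ to full)
open import Data.List.Base using (List; length)
import Data.List.Membership.Propositional as List
open import Data.List.Relation.Unary.Unique.Propositional using (Unique)
open import Data.Nat.Base using (ℕ; _+_; _≤_; _<_; _%_)
open import Data.Nat.Properties using (+-0-monoid)
open import Data.Product.Base using (_×_; ∃; ∃-syntax)
open import Data.Sum.Base using (_⊎_)
open import Data.Vec.Base using (lookup; tabulate)
open import Function.Bundles using (_⇔_)
open import Relation.Binary.Construct.Add.Supremum.NonStrict _≤_ public using (_≤⁺_)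
open import Relation.Binary.Construct.Closure.Equivalence using (EqClosure)
open import Relation.Binary.PropositionalEquality.Core using (_≡_; _≢_)
open import Relation.Nullary.Construct.Add.Supremum public using (_⁺; [_]; ⊤⁺)
open import Relation.Nullary.Decidable.Core using (does)
open import Relation.Nullary.Negation.Core using (¬_)
open import Algebra.Properties.Monoid.Sum +-0-monoid using (sum)

IsMinimum : (ℕ → Set) → ℕ → Set
IsMinimum P k = P k × (∀ j → P j → k ≤ j)

IsMaximum : (ℕ → Set) → ℕ → Set
IsMaximum P k = P k × (∀ j → P j → j ≤ k)

HasSize : {A : Set} → (A → Set) → ℕ → Set
HasSize {A} P k =
  ∃[ xs ] Unique xs × length xs ≡ k × (∀ (x : A) → x List.∈ xs ⇔ P x)

-- Finite graphs, with parallel edges and loops allowed.  The order of the two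
-- ends of an edge carries no meaning.
record Graph : Set where
  field
    #V #E     : ℕ
    end₁ end₂ : Fin #E → Fin #V

module _ (G : Graph) where
  open Graph G

  Vertices Edges : Set
  Vertices = Subset #V
  Edges    = Subset #E

  -- Degree of v in the spanning subgraph with edge set S; a loop counts twice.
  degree : Edges → Fin #V → ℕ
  degree S v = ∣ S ∩ tabulate (λ e → does (end₁ e ≟ v)) ∣
             + ∣ S ∩ tabulate (λ e → does (end₂ e ≟ v)) ∣

  Cubic : Set
  Cubic = ∀ v → degree full v ≡ 3

  Connected : Edges → Fin #V → Fin #V → Set
  Connected S = EqClosure (λ u v → ∃[ e ] e ∈ S × end₁ e ≡ u × end₂ e ≡ v)

  IsBridge : Fin #E → Set
  IsBridge e = ¬ Connected (full - e) (end₁ e) (end₂ e)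

  Bridgeless : Set
  Bridgeless = ∀ e → ¬ IsBridge e

  -- K is the vertex set of a component of the spanning subgraph (V , S).
  IsComponent : Edges → Vertices → Set
  IsComponent S K = Nonempty K × (∀ {u} → u ∈ K → ∀ v → v ∈ K ⇔ Connected S u v)

  IsOneFactor : Edges → Set
  IsOneFactor M = ∀ v → degree M v ≡ 1

  IsTwoFactor : Edges → Set
  IsTwoFactor F = ∀ v → degree F v ≡ 2

  -- A circuit is a connected 2-regular subgraph, given by its edge set; its
  -- vertices are the ends of its edges, so all other vertices have degree 0.
  IsCircuit : Edges → Set
  IsCircuit C = Nonempty C
              × (∀ v → degree C v ≡ 0 ⊎ degree C v ≡ 2)
              × (∀ {e f} → e ∈ C → f ∈ C → Connected C (end₁ e) (end₁ f))

  IsOddCircuitOf : Edges → Edges → Set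
  IsOddCircuitOf F C = C ⊆ F × IsCircuit C × ∣ C ∣ % 2 ≡ 1

  Isμ₂ : ℕ → Set
  Isμ₂ = IsMinimum λ k →
    ∃[ M₁ ] ∃[ M₂ ] IsOneFactor M₁ × IsOneFactor M₂ × ∣ M₁ ∩ M₂ ∣ ≡ k

  IsOddness : ℕ → Set
  IsOddness = IsMinimum λ k → ∃[ F ] IsTwoFactor F × HasSize (IsOddCircuitOf F) k

  IsMinimumTwoFactor : Edges → Set
  IsMinimumTwoFactor F =
    IsTwoFactor F × ∃[ ω ] IsOddness ω × HasSize (IsOddCircuitOf F) ω

  ∂ : Vertices → Edges
  ∂ X = tabulate λ e → lookup X (end₁ e) xor lookup X (end₂ e)

  IsEdgeCut : Edges → Set
  IsEdgeCut D = ∃[ X ] Nonempty X × (∃[ v ] v ∉ X) × D ≡ ∂ X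

  -- The component of (V , S) on K contains an odd circuit of F.
  ContainsOddCircuit : Edges → Edges → Vertices → Set
  ContainsOddCircuit F S K =
    ∃[ C ] IsOddCircuitOf F C × C ⊆ S × (∀ {e} → e ∈ C → end₁ e ∈ K × end₂ e ∈ K)

  SeparatesOddCircuits : Edges → Edges → Set
  SeparatesOddCircuits F D =
    ∃[ K ] ∃[ L ] K ≢ L
      × IsComponent (full ─ D) K × ContainsOddCircuit F (full ─ D) K
      × IsComponent (full ─ D) L × ContainsOddCircuit F (full ─ D) L

  -- k = m_G(F)
  Ism : Edges → ℕ → Set
  Ism F = IsMaximum λ k →
    ¬ (∃[ D ] IsEdgeCut D × ∣ D ∣ < k × SeparatesOddCircuits F D)

  -- x = m*_G, an element of ℕ ∪ {∞}
  data Ism* : ℕ ⁺ → Set where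
    oddness-zero     : IsOddness 0 → Ism* ⊤⁺
    oddness-positive : ∀ {ω k} → IsOddness ω → 0 < ω →
                       IsMaximum (λ j → ∃[ F ] IsMinimumTwoFactor F × Ism F j) k →
                       Ism* [ k ]

  total : (Fin #E → Fin #V) → (Fin #E → ℕ) → Fin #V → ℕ
  total end value v = sum λ e → if does (end e ≟ v) then value e else 0

  record NowhereZeroFlow (k : ℕ) : Set where
    field
      forward : Fin #E → Bool  -- true: directed from end₁ to end₂
      value   : Fin #E → ℕ

    tail : Fin #E → Fin #V
    tail e = if forward e then end₁ e else end₂ e

    head : Fin #E → Fin #V
    head e = if forward e then end₂ e else end₁ e

    field
      value-pos : ∀ e → 0 < value e
      value-<   : ∀ e → value e < k
      kirchhoff : ∀ v → total head value v ≡ total tail value v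

{-# OPTIONS --safe #-}

-- Let F be a minimum 2-factor attaining m*, with complementary 1-factor M.  Since
-- |M₁ ∩ M₂| ≤ 2, the complement of M₁ has at most four odd circuits, so ω(G) ≤ 4.
-- Pick a vertex z i on each odd circuit and let N ⊆ F be the matching missing exactly
-- these vertices.  A 2-colouring s of the vertices alternating along M and N is a balanced
-- valuation for a nowhere-zero 5-flow unless some X violates 5 |s(X)| ≤ 3 |∂X|, and counting
-- M- and N-edges shows that then ω(G) = 4, ∂X consists of four M-edges and two N-edges of
-- one circuit, and X contains two of the z i.  Uncrossing two such cuts X, Y that split the
-- z i differently, every quadrant has an odd boundary, and m*(G) ≥ 6 forces X and Y to cross
-- two odd circuits p, q and one quadrant (a hub) to be left by a single M-edge.  A hub
-- contains a path of M- and N-edges from p to q; placing z p and z q at its ends makes every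
-- colouring separate them, and this yields violated cuts for all three splits of the four
-- circuits that cross three different circuits.  Their three hubs form a ring
-- whose union has at most three boundary edges but separates odd circuits of F.
module Submission where

open import Defs
open import Data.Bool.Base using (Bool; true; false; not; _∧_; _∨_; _xor_; if_then_else_; T)
open import Data.Bool.Properties
  using (∧-comm; ∧-identityʳ; ∧-zeroʳ; ∨-zeroʳ; xor-comm; xor-same; xor-identityʳ; xor-inverseˡ; xor-annihilates-not;
         not-involutive; not-injective; not-¬; ¬-not)
  renaming (_≟_ to _≟ᵇ_)
open import Data.Empty using (⊥; ⊥-elim)
open import Data.Fin.Base using (Fin; zero; suc; toℕ)
open import Data.Fin.Properties using (_≟_; any?; toℕ-injective)
import Data.Fin.Subset as Sub
open import Data.Fin.Subset using (Subset; ∣_∣; _∩_; _─_) renaming (⊤ to full)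
open import Data.Fin.Subset.Properties using (anySubset?)
import Data.List.Base as List
open import Data.List.Base using (List; []; _∷_; allFin; length)
import Data.List.Membership.DecPropositional
open import Data.List.Membership.Propositional using (_∈_)
open import Data.List.Membership.Propositional.Properties
  using (∈-allFin; ∈-lookup; ∈-filter⁺; ∈-filter⁻; ∈-map⁺; ∈-map⁻)
open import Data.List.Properties using (length-map)
import Data.List.Relation.Unary.All as All
open import Data.List.Relation.Unary.All using (All; []; _∷_)
import Data.List.Relation.Unary.Any as Any
open import Data.List.Relation.Unary.Any using (here; there)
open import Data.List.Relation.Unary.Any.Properties using (lookup-index)
open import Data.List.Relation.Unary.Unique.Propositional using ([]; _∷_) renaming (Unique to Uniq)
import Data.List.Relation.Unary.Unique.Propositional.Properties as Unique
open import Data.Nat.Base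
  using (ℕ; zero; suc; _+_; _*_; _∸_; _≤_; _<_; z≤n; s≤s; _≤ᵇ_; _<ᵇ_; _%_)
open import Data.Nat.Properties as ℕₚ
  using (≤-refl; ≤-trans; ≤-reflexive; +-mono-≤; *-monoʳ-≤; +-cancelʳ-≤; ≤ᵇ⇒≤)
open import Data.Product.Base using (_×_; _,_; Σ-syntax; ∃-syntax; proj₁; proj₂)
open import Data.Sum.Base using (_⊎_; inj₁; inj₂)
open import Data.Unit.Base using (tt)
open import Data.Vec.Base using (Vec; []; _∷_; lookup; tabulate; replicate; zipWith)
open import Data.Vec.Properties
  using (lookup∘tabulate; lookup-zipWith; lookup-replicate; lookup⇒[]=; []=⇒lookup)
open import Function.Base using (_∘_; case_of_)
open import Function.Bundles using (mk⇔; Equivalence)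
import Relation.Binary.Construct.Add.Supremum.NonStrict as NonStrict
import Relation.Binary.Construct.Closure.Equivalence as Eq
import Relation.Binary.Construct.Closure.ReflexiveTransitive as Star
import Relation.Binary.Construct.Closure.Symmetric as SC
open import Relation.Binary.PropositionalEquality
  using (_≡_; _≢_; _≗_; refl; sym; trans; cong; cong₂; subst; subst₂; module ≡-Reasoning)
open import Relation.Binary.PropositionalEquality.Properties
  using (isEquivalence; subst-injective; subst-sym-subst)
open import Relation.Nullary.Decidable
  using (Dec; yes; no; does; dec-true; dec-false; decidable-stable; ¬?)
open import Relation.Nullary.Negation.Core using (¬_)
import Algebra.Properties.CommutativeMonoid.Sum
open import Algebra.Properties.CommutativeSemigroup ℕₚ.+-commutativeSemigroup using (interchange)

-- The constants 5 and 3 come from Hoffman's condition. If positive vertices get out-degree 2 and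
-- negative ones out-degree 1, then s(X) is the number of edges leaving X minus the number entering
-- it, and 5 |s(X)| ≤ 3 |∂X| says that neither number exceeds four times the other, which is what
-- values 1 to 4 require. The obstacle is that signs cannot be prescribed on the `z i`: joining them
-- in pairs only excludes one of the three splits, so one fixed choice of the `z i` guarantees cuts
-- for two splits only. Once `z p` and `z q` are ends of an alternating path, one split is excluded
-- for good, and a suitable pairing then leaves exactly one. Cuts found for different choices of the
-- `z i` can still be compared, because what is kept of a cut (its six edges, the circuit it
-- crosses, the parities in which it meets the circuits) no longer mentions the `z i`. In the
-- uncrossing, odd boundaries matter because more than 5 edges then means at least 7, and 7 + 7
-- exceeds 6 + 6.

module Σ = Algebra.Properties.CommutativeMonoid.Sum ℕₚ.+-0-commutativeMonoid
open ≡-Reasoning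

-- Linear arithmetic over ℕ by Farkas certificates

infixl 6 _⊕_
infixl 7 _⊗_
infix 4 _≼_

data Lin (n : ℕ) : Set where
  ♯_  : Fin n → Lin n
  ‵_  : ℕ → Lin n
  _⊕_ : Lin n → Lin n → Lin n
  _⊗_ : ℕ → Lin n → Lin n

data Ineq (n : ℕ) : Set where
  _≼_ : Lin n → Lin n → Ineq n

pattern x₀ = ♯ zero
pattern x₁ = ♯ suc zero
pattern x₂ = ♯ suc (suc zero)
pattern x₃ = ♯ suc (suc (suc zero))
pattern x₄ = ♯ suc (suc (suc (suc zero)))
pattern x₅ = ♯ suc (suc (suc (suc (suc zero))))
pattern x₆ = ♯ suc (suc (suc (suc (suc (suc zero)))))
pattern x₇ = ♯ suc (suc (suc (suc (suc (suc (suc zero))))))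
pattern x₈ = ♯ suc (suc (suc (suc (suc (suc (suc (suc zero)))))))
pattern x₉ = ♯ suc (suc (suc (suc (suc (suc (suc (suc (suc zero))))))))

module _ {n : ℕ} where

  Coeffs : Set
  Coeffs = Vec ℕ n × ℕ

  unit : ∀ {m} → Fin m → Vec ℕ m
  unit zero    = 1 ∷ replicate _ 0
  unit (suc i) = 0 ∷ unit i

  _⊞_ : Coeffs → Coeffs → Coeffs
  (a , k) ⊞ (b , l) = zipWith _+_ a b , k + l

  _⊠_ : ℕ → Coeffs → Coeffs
  c ⊠ (a , k) = Data.Vec.Base.map (c *_) a , c * k

  coeffs : Lin n → Coeffs
  coeffs (♯ i)   = unit i , 0
  coeffs (‵ k)   = replicate n 0 , k
  coeffs (a ⊕ b) = coeffs a ⊞ coeffs b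
  coeffs (c ⊗ a) = c ⊠ coeffs a

module _ where

  dot : ∀ {m} → Vec ℕ m → Vec ℕ m → ℕ
  dot []       []       = 0
  dot (a ∷ as) (x ∷ xs) = a * x + dot as xs

  dot-zero : ∀ {m} (xs : Vec ℕ m) → dot (replicate m 0) xs ≡ 0
  dot-zero []       = refl
  dot-zero (x ∷ xs) = dot-zero xs

  dot-unit : ∀ {m} (i : Fin m) xs → dot (unit {m} i) xs ≡ lookup xs i
  dot-unit zero    (x ∷ xs) =
    trans (cong₂ _+_ (ℕₚ.+-identityʳ x) (dot-zero xs)) (ℕₚ.+-identityʳ x)
  dot-unit (suc i) (x ∷ xs) = dot-unit i xs

  dot-+ : ∀ {m} (as bs xs : Vec ℕ m) → dot (zipWith _+_ as bs) xs ≡ dot as xs + dot bs xs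
  dot-+ []       []       []       = refl
  dot-+ (a ∷ as) (b ∷ bs) (x ∷ xs) =
    trans (cong₂ _+_ (ℕₚ.*-distribʳ-+ x a b) (dot-+ as bs xs))
          (interchange (a * x) (b * x) (dot as xs) (dot bs xs))

  dot-* : ∀ {m} c (as xs : Vec ℕ m) → dot (Data.Vec.Base.map (c *_) as) xs ≡ c * dot as xs
  dot-* c []       []       = sym (ℕₚ.*-zeroʳ c)
  dot-* c (a ∷ as) (x ∷ xs) =
    trans (cong₂ _+_ (ℕₚ.*-assoc c a x) (dot-* c as xs)) (sym (ℕₚ.*-distribˡ-+ c (a * x) _))

  dominated : ∀ {m} → Vec ℕ m → Vec ℕ m → Bool
  dominated []       []       = true
  dominated (a ∷ as) (b ∷ bs) = (a ≤ᵇ b) ∧ dominated as bs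

  T-∧ : ∀ {a b} → T (a ∧ b) → T a × T b
  T-∧ {true} {true} _ = tt , tt

  dot-mono : ∀ {m} (as bs xs : Vec ℕ m) → T (dominated as bs) → dot as xs ≤ dot bs xs
  dot-mono []       []       []       _ = z≤n
  dot-mono (a ∷ as) (b ∷ bs) (x ∷ xs) p with T-∧ {a ≤ᵇ b} p
  ... | q , r = +-mono-≤ (ℕₚ.*-monoˡ-≤ x (≤ᵇ⇒≤ a b q)) (dot-mono as bs xs r)

  ⟦_⟧ : ∀ {n} → Lin n → Vec ℕ n → ℕ
  ⟦ ♯ i ⟧   ρ = lookup ρ i
  ⟦ ‵ k ⟧   ρ = k
  ⟦ a ⊕ b ⟧ ρ = ⟦ a ⟧ ρ + ⟦ b ⟧ ρ
  ⟦ c ⊗ a ⟧ ρ = c * ⟦ a ⟧ ρ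

  Holds : ∀ {n} → Vec ℕ n → Ineq n → Set
  Holds ρ (a ≼ b) = ⟦ a ⟧ ρ ≤ ⟦ b ⟧ ρ

  ⟦_⟧ᶜ : ∀ {n} → Coeffs {n} → Vec ℕ n → ℕ
  ⟦ a , k ⟧ᶜ ρ = dot a ρ + k

  coeffs-correct : ∀ {n} (e : Lin n) ρ → ⟦ coeffs e ⟧ᶜ ρ ≡ ⟦ e ⟧ ρ
  coeffs-correct (♯ i)   ρ = trans (ℕₚ.+-identityʳ _) (dot-unit i ρ)
  coeffs-correct (‵ k)   ρ = cong (_+ k) (dot-zero ρ)
  coeffs-correct (a ⊕ b) ρ =
    trans (cong (_+ _) (dot-+ (proj₁ (coeffs a)) (proj₁ (coeffs b)) ρ))
    (trans (interchange (dot (proj₁ (coeffs a)) ρ) _ _ _)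
           (cong₂ _+_ (coeffs-correct a ρ) (coeffs-correct b ρ)))
  coeffs-correct (c ⊗ a) ρ =
    trans (cong (_+ _) (dot-* c (proj₁ (coeffs a)) ρ))
    (trans (sym (ℕₚ.*-distribˡ-+ c (dot (proj₁ (coeffs a)) ρ) _))
           (cong (c *_) (coeffs-correct a ρ)))

  combine : ∀ {n} → List (Ineq n) → List ℕ → Lin n × Lin n
  combine ((a ≼ b) ∷ hs) (c ∷ cs) = c ⊗ a ⊕ proj₁ (combine hs cs) , c ⊗ b ⊕ proj₂ (combine hs cs)
  combine _              _        = ‵ 0 , ‵ 0

  combine-holds : ∀ {n} {ρ : Vec ℕ n} {hs} → All (Holds ρ) hs → ∀ cs →
                  ⟦ proj₁ (combine hs cs) ⟧ ρ ≤ ⟦ proj₂ (combine hs cs) ⟧ ρ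
  combine-holds []                   cs       = z≤n
  combine-holds (_∷_ {x = a ≼ b} h hs) []       = z≤n
  combine-holds (_∷_ {x = a ≼ b} h hs) (c ∷ cs) = +-mono-≤ (*-monoʳ-≤ c h) (combine-holds hs cs)

  -- Without subtraction, a combination of hypotheses is moved across the goal by adding its larger
  -- side to the left and its smaller side to the right; domination of coefficients is then checked
  -- by evaluation. The factor `suc c` clears denominators and is positive, so it can be cancelled.
  Certified : ∀ {n} → List (Ineq n) → List ℕ → ℕ → Ineq n → Bool
  Certified hs cs c (a ≼ b) =
    let l = coeffs (suc c ⊗ a ⊕ proj₂ (combine hs cs))
        r = coeffs (suc c ⊗ b ⊕ proj₁ (combine hs cs))
    in dominated (proj₁ l) (proj₁ r) ∧ (proj₂ l ≤ᵇ proj₂ r)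

  certificate-sound : ∀ {n} (ρ : Vec ℕ n) (hs : List (Ineq n)) (g : Ineq n) (c : ℕ) (cs : List ℕ) →
           {T (Certified hs cs c g)} → All (Holds ρ) hs → Holds ρ g
  certificate-sound ρ hs (a ≼ b) c cs {ok} H =
    ℕₚ.*-cancelˡ-≤ (suc c) (+-cancelʳ-≤ (⟦ R ⟧ ρ) _ _
      (≤-trans dom (ℕₚ.+-monoʳ-≤ (suc c * ⟦ b ⟧ ρ) (combine-holds H cs))))
    where
    L = proj₁ (combine hs cs)
    R = proj₂ (combine hs cs)
    l = coeffs (suc c ⊗ a ⊕ R)
    r = coeffs (suc c ⊗ b ⊕ L)
    dom : ⟦ suc c ⊗ a ⊕ R ⟧ ρ ≤ ⟦ suc c ⊗ b ⊕ L ⟧ ρ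
    dom = subst₂ _≤_ (coeffs-correct (suc c ⊗ a ⊕ R) ρ) (coeffs-correct (suc c ⊗ b ⊕ L) ρ)
      (let p , q = T-∧ {dominated (proj₁ l) (proj₁ r)} ok in
       +-mono-≤ (dot-mono (proj₁ l) (proj₁ r) ρ p) (≤ᵇ⇒≤ (proj₂ l) (proj₂ r) q))

  abstract
    -- The certificate cs multiplies the hypotheses and 1 + c the conclusion.
    linear : ∀ {n} (ρ : Vec ℕ n) (hs : List (Ineq n)) (g : Ineq n) (c : ℕ) (cs : List ℕ) →
             {T (Certified hs cs c g)} → All (Holds ρ) hs → Holds ρ g
    linear ρ hs g c cs {ok} = certificate-sound ρ hs g c cs {ok}

-- Booleans

-- Currying with a numeral for the arity lets `bools≤` and `bools≡` check a whole truth table by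
-- evaluation in an implicit argument.
Fun : Set → ℕ → Set
Fun A zero    = A
Fun A (suc n) = Bool → Fun A n

Forall : ∀ {A} n → (A → A → Set) → Fun A n → Fun A n → Set
Forall zero    _∼_ x y = x ∼ y
Forall (suc n) _∼_ f g = ∀ b → Forall n _∼_ (f b) (g b)

test : ∀ {A} n → (A → A → Bool) → Fun A n → Fun A n → Bool
test zero    _≈_ x y = x ≈ y
test (suc n) _≈_ f g = test n _≈_ (f true) (g true) ∧ test n _≈_ (f false) (g false)

test-sound : ∀ {A} n {_∼_ : A → A → Set} {_≈_ : A → A → Bool} → (∀ {x y} → T (x ≈ y) → x ∼ y) →
             ∀ f g → T (test n _≈_ f g) → Forall n _∼_ f g
test-sound zero    sound x y p = sound p
test-sound (suc n) {_≈_ = _≈_} sound f g p b with T-∧ {test n _≈_ (f true) (g true)} p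
test-sound (suc n) sound f g p true  | q , r = test-sound n sound (f true) (g true) q
test-sound (suc n) sound f g p false | q , r = test-sound n sound (f false) (g false) r

abstract
  bools≤ : ∀ n (f g : Fun ℕ n) → {T (test n _≤ᵇ_ f g)} → Forall n _≤_ f g
  bools≤ n f g {p} = test-sound n (λ {x} {y} → ≤ᵇ⇒≤ x y) f g p

ind : Bool → ℕ
ind true  = 1
ind false = 0

odd : ℕ → Bool
odd zero    = false
odd (suc n) = not (odd n)

same : Bool → Bool → Bool
same a b = not (a xor b)

abstract
  bools≡ : ∀ n (f g : Fun Bool n) → {T (test n same f g)} → Forall n _≡_ f g
  bools≡ n f g {p} = test-sound n sound f g p
    where
    sound : ∀ {x y} → T (same x y) → x ≡ y
    sound {true}  {true}  _ = refl
    sound {false} {false} _ = refl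

not-≢ : ∀ {a b} → a ≢ b → b ≡ not a
not-≢ p = ¬-not (p ∘ sym)

∧-false : ∀ a b → a ∧ false ≡ b ∧ false
∧-false a b = trans (∧-zeroʳ a) (sym (∧-zeroʳ b))

odd-+ : ∀ m n → odd (m + n) ≡ odd m xor odd n
odd-+ zero    n = refl
odd-+ (suc m) n rewrite odd-+ m n with odd m | odd n
... | true  | true  = refl
... | true  | false = refl
... | false | true  = refl
... | false | false = refl

odd-double : ∀ m → odd (m + m) ≡ false
odd-double m rewrite odd-+ m m with odd m
... | true  = refl
... | false = refl

odd-ind : ∀ b → odd (ind b) ≡ b
odd-ind true  = refl
odd-ind false = refl

∧-true : ∀ {a b} → a ∧ b ≡ true → a ≡ true × b ≡ true
∧-true {true} {true} refl = refl , refl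

ind≤1 : ∀ b → ind b ≤ 1
ind≤1 true  = s≤s z≤n
ind≤1 false = z≤n

does-true : {A : Set} (d : Dec A) → does d ≡ true → A
does-true (yes a) _ = a

-- Finite sums

_==_ : ∀ {n} → Fin n → Fin n → Bool
i == j = does (i ≟ j)

==-refl : ∀ {n} (i : Fin n) → (i == i) ≡ true
==-refl i = dec-true (i ≟ i) refl

==-sym : ∀ {n} (i j : Fin n) → (i == j) ≡ (j == i)
==-sym i j with i ≟ j
... | yes refl = sym (==-refl i)
... | no p     = sym (dec-false (j ≟ i) (p ∘ sym))

==-true : ∀ {n} {i j : Fin n} → (i == j) ≡ true → i ≡ j
==-true {i = i} {j} = does-true (i ≟ j)

==-≢ : ∀ {n} {i j : Fin n} → i ≢ j → (i == j) ≡ false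
==-≢ {i = i} {j} = dec-false (i ≟ j)

abstract

  sum : ∀ {n} → (Fin n → ℕ) → ℕ
  sum = Σ.sum

  sum-is-sum : ∀ {n} (f : Fin n → ℕ) → sum f ≡ Σ.sum f
  sum-is-sum f = refl

  sum-cong-≗ : ∀ {n} {f g : Fin n → ℕ} → (∀ i → f i ≡ g i) → sum f ≡ sum g
  sum-cong-≗ = Σ.sum-cong-≗

  ∑-comm : ∀ {m n} (f : Fin m → Fin n → ℕ) → sum (λ i → sum (f i)) ≡ sum (λ j → sum (λ i → f i j))
  ∑-comm = Σ.∑-comm

  sum-mono : ∀ {n} {f g : Fin n → ℕ} → (∀ i → f i ≤ g i) → sum f ≤ sum g
  sum-mono {zero}  h = z≤n
  sum-mono {suc n} h = +-mono-≤ (h zero) (sum-mono (h ∘ suc))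

  sum-zero : ∀ {n} {f : Fin n → ℕ} → (∀ i → f i ≡ 0) → sum f ≡ 0
  sum-zero {n} h = trans (sum-cong-≗ h) (Σ.sum-replicate-zero n)

  sum-+ : ∀ {n} (f g : Fin n → ℕ) → sum (λ i → f i + g i) ≡ sum f + sum g
  sum-+ = Σ.∑-distrib-+

  sum-*ˡ : ∀ {n} c (f : Fin n → ℕ) → sum (λ i → c * f i) ≡ c * sum f
  sum-*ˡ {zero}  c f = sym (ℕₚ.*-zeroʳ c)
  sum-*ˡ {suc n} c f = trans (cong (c * f zero +_) (sum-*ˡ c (f ∘ suc))) (sym (ℕₚ.*-distribˡ-+ c _ _))

  term≤sum : ∀ {n} (f : Fin n → ℕ) i → f i ≤ sum f
  term≤sum f zero    = ℕₚ.m≤m+n _ _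
  term≤sum f (suc i) = ≤-trans (term≤sum (f ∘ suc) i) (ℕₚ.m≤n+m _ _)

  two-terms≤sum : ∀ {n} (f : Fin n → ℕ) {i j} → i ≢ j → f i + f j ≤ sum f
  two-terms≤sum f {zero}  {zero}  p = ⊥-elim (p refl)
  two-terms≤sum f {zero}  {suc j} p = ℕₚ.+-monoʳ-≤ (f zero) (term≤sum (f ∘ suc) j)
  two-terms≤sum f {suc i} {zero}  p =
    subst (_≤ sum f) (ℕₚ.+-comm (f zero) _) (ℕₚ.+-monoʳ-≤ (f zero) (term≤sum (f ∘ suc) i))
  two-terms≤sum f {suc i} {suc j} p =
    ≤-trans (two-terms≤sum (f ∘ suc) (p ∘ cong suc)) (ℕₚ.m≤n+m _ _)

  sum≡0 : ∀ {n} (f : Fin n → ℕ) → sum f ≡ 0 → ∀ i → f i ≡ 0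
  sum≡0 f p i = ℕₚ.n≤0⇒n≡0 (subst (f i ≤_) p (term≤sum f i))

  sum-positive : ∀ {n} (f : Fin n → ℕ) → 0 < sum f → ∃[ i ] 0 < f i
  sum-positive {suc n} f p with f zero in eq
  ... | suc k = zero , subst (0 <_) (sym eq) (s≤s z≤n)
  ... | zero  = let i , q = sum-positive (f ∘ suc) p in suc i , q

  -- Converts equality in a global count into equality at each single edge or vertex; the structure
  -- of a violated cut is extracted in this way.
  sum-tight : ∀ {n} {f g : Fin n → ℕ} → (∀ i → f i ≤ g i) → sum g ≤ sum f → ∀ i → f i ≡ g i
  sum-tight {suc n} {f} {g} h p zero =
    ℕₚ.≤-antisym (h zero) (linear (f zero ∷ g zero ∷ sum (f ∘ suc) ∷ sum (g ∘ suc) ∷ [])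
      ((x₁ ⊕ x₃ ≼ x₀ ⊕ x₂) ∷ (x₂ ≼ x₃) ∷ []) (x₁ ≼ x₀) 0 (1 ∷ 1 ∷ []) (p ∷ sum-mono (h ∘ suc) ∷ []))
  sum-tight {suc n} {f} {g} h p (suc i) = sum-tight {f = f ∘ suc} {g ∘ suc} (h ∘ suc)
    (linear (f zero ∷ g zero ∷ sum (f ∘ suc) ∷ sum (g ∘ suc) ∷ [])
      ((x₁ ⊕ x₃ ≼ x₀ ⊕ x₂) ∷ (x₀ ≼ x₁) ∷ []) (x₃ ≼ x₂) 0 (1 ∷ 1 ∷ []) (p ∷ h zero ∷ [])) i

  sum-δ : ∀ {n} (g : Fin n → ℕ) a → sum (λ v → ind (a == v) * g v) ≡ g a
  sum-δ {suc n} g zero =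
    trans (cong₂ _+_ (ℕₚ.+-identityʳ (g zero)) (sum-zero {n} (λ i → refl))) (ℕₚ.+-identityʳ _)
  sum-δ {suc n} g (suc a) =
    trans (sum-cong-≗ {n} (λ v → cong (λ b → ind b * g (suc v)) (suc-== a v))) (sum-δ (g ∘ suc) a)
    where
    suc-== : ∀ {n} (i j : Fin n) → (suc i == suc j) ≡ (i == j)
    suc-== i j with i ≟ j
    ... | yes refl = refl
    ... | no _     = refl

  odd-sum : ∀ {n} {f g : Fin n → ℕ} → (∀ i → odd (f i) ≡ odd (g i)) → odd (sum f) ≡ odd (sum g)
  odd-sum {zero}  h = refl
  odd-sum {suc n} {f} {g} h = trans (odd-+ (f zero) _)
    (trans (cong₂ _xor_ (h zero) (odd-sum (h ∘ suc))) (sym (odd-+ (g zero) _)))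

-- Subsets can be enumerated but functions cannot, so the property is tested on subsets and carried
-- to all functions by its invariance under pointwise equality.
search : ∀ {n} {P : (Fin n → Bool) → Set} → (∀ X → Dec (P X)) →
         (∀ {X Y} → X ≗ Y → P X → P Y) → (∀ X → P X) ⊎ (∃[ X ] ¬ P X)
search {P = P} P? resp with anySubset? (λ S → ¬? (P? (lookup S)))
... | yes (S , p) = inj₂ (lookup S , p)
... | no ¬p = inj₁ λ X → resp (lookup∘tabulate X)
                (decidable-stable (P? _) (λ ¬q → ¬p (tabulate X , ¬q)))

-- Feasible flows

module _ {n m : ℕ} (tl hd : Fin m → Fin n) where

  leaves : (Fin n → Bool) → Fin m → Bool
  leaves X e = X (tl e) ∧ not (X (hd e))

  weight : (Fin n → Bool) → (Fin n → ℕ) → ℕ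
  weight X b = sum λ v → ind (X v) * b v

  capacity : (Fin m → ℕ) → (Fin n → Bool) → ℕ
  capacity w X = sum λ e → w e * ind (leaves X e)

  -- Gale's condition: the net supply of X fits through the arcs leaving X. The signed supply is
  -- written as a pair of natural-valued functions `b⁺` and `b⁻`.
  CutCondition : (Fin n → ℕ) → (Fin n → ℕ) → (Fin m → ℕ) → (Fin n → Bool) → Set
  CutCondition b⁺ b⁻ w X = weight X b⁺ ≤ weight X b⁻ + capacity w X

  CutCondition? : ∀ b⁺ b⁻ w X → Dec (CutCondition b⁺ b⁻ w X)
  CutCondition? b⁺ b⁻ w X = _ ℕₚ.≤? _

  CutCondition-resp : ∀ {b⁺ b⁻ w X Y} → X ≗ Y → CutCondition b⁺ b⁻ w X → CutCondition b⁺ b⁻ w Y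
  CutCondition-resp {b⁺} {b⁻} {w} {X} {Y} X≗Y = subst₂ _≤_ (eq b⁺) (cong₂ _+_ (eq b⁻)
    (sum-cong-≗ λ e → cong (λ x → w e * ind x) (cong₂ (λ x y → x ∧ not y) (X≗Y _) (X≗Y _))))
    where
    eq : ∀ b → weight X b ≡ weight Y b
    eq b = sum-cong-≗ λ v → cong (λ x → ind x * b v) (X≗Y v)

  Feasible : (Fin n → ℕ) → (Fin n → ℕ) → (Fin m → ℕ) → Set
  Feasible b⁺ b⁻ w = Σ[ y ∈ (Fin m → ℕ) ] (∀ e → y e ≤ w e)
    × (∀ v → sum (λ e → y e * ind (tl e == v)) + b⁻ v ≡ sum (λ e → y e * ind (hd e == v)) + b⁺ v)

  weight-modular : ∀ X Y b → weight X b + weight Y b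
                 ≡ weight (λ v → X v ∧ Y v) b + weight (λ v → X v ∨ Y v) b
  weight-modular X Y b = begin
    weight X b + weight Y b                         ≡⟨ sum-+ _ _ ⟨
    sum (λ v → ind (X v) * b v + ind (Y v) * b v)   ≡⟨ sum-cong-≗ (λ v → pointwise (X v) (Y v) (b v)) ⟩
    sum (λ v → ind (X v ∧ Y v) * b v + ind (X v ∨ Y v) * b v) ≡⟨ sum-+ _ _ ⟩
    _ ∎
    where
    pointwise : ∀ x y k → ind x * k + ind y * k ≡ ind (x ∧ y) * k + ind (x ∨ y) * k
    pointwise true  true  k = refl
    pointwise true  false k = ℕₚ.+-comm (k + 0) 0
    pointwise false y     k = refl

  weight-+ : ∀ X b b′ → weight X (λ v → b v + b′ v) ≡ weight X b + weight X b′
  weight-+ X b b′ = trans (sum-cong-≗ λ v → ℕₚ.*-distribˡ-+ (ind (X v)) _ _) (sum-+ _ _)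

  weight-δ : ∀ X a → weight X (λ v → ind (a == v)) ≡ ind (X a)
  weight-δ X a = trans (sum-cong-≗ λ v → ℕₚ.*-comm (ind (X v)) _) (sum-δ (ind ∘ X) a)

  -- Submodularity, sharpened by one arc: an arc from X minus Y to Y minus X leaves X but neither
  -- the intersection nor the union. Its unit of capacity is the gain that makes two violated cuts
  -- contradictory.
  capacity-uncross : ∀ w X Y e → 0 < w e →
    capacity w (λ v → X v ∧ Y v) + capacity w (λ v → X v ∨ Y v)
      + ind (X (tl e) ∧ not (Y (tl e)) ∧ not (X (hd e)) ∧ Y (hd e))
    ≤ capacity w X + capacity w Y
  capacity-uncross w X Y e₀ w>0 = ≤-trans (ℕₚ.+-monoʳ-≤ _ (≤-trans special (term≤sum _ e₀)))
    (subst₂ _≤_ (trans (sum-+ _ _) (cong (_+ sum extra) (sum-+ _ _))) (sum-+ _ _) (sum-mono pointwise))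
    where
    sp : Fin m → Bool
    sp e = X (tl e) ∧ not (Y (tl e)) ∧ not (X (hd e)) ∧ Y (hd e)
    extra : Fin m → ℕ
    extra e = w e * ind (sp e)
    special : ind (sp e₀) ≤ extra e₀
    special = subst (_≤ extra e₀) (ℕₚ.+-identityʳ _) (ℕₚ.*-monoˡ-≤ (ind (sp e₀)) w>0)
    bools = bools≤ 4 (λ a b c d → ind ((a ∧ b) ∧ not (c ∧ d)) + ind ((a ∨ b) ∧ not (c ∨ d))
                                + ind (a ∧ not b ∧ not c ∧ d))
                     (λ a b c d → ind (a ∧ not c) + ind (b ∧ not d))
    distrib : ∀ k a b c → k * a + k * b + k * c ≡ k * (a + b + c)
    distrib k a b c = sym (trans (ℕₚ.*-distribˡ-+ k (a + b) c) (cong (_+ k * c) (ℕₚ.*-distribˡ-+ k a b)))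
    pointwise : ∀ e → w e * ind (leaves (λ v → X v ∧ Y v) e) + w e * ind (leaves (λ v → X v ∨ Y v) e)
                       + extra e
                    ≤ w e * ind (leaves X e) + w e * ind (leaves Y e)
    pointwise e = subst₂ _≤_ (sym (distrib (w e) _ _ _)) (ℕₚ.*-distribˡ-+ (w e) _ _)
      (ℕₚ.*-monoʳ-≤ (w e) (bools (X (tl e)) (Y (tl e)) (X (hd e)) (Y (hd e))))

  module Step (b⁺ b⁻ : Fin n → ℕ) (w : Fin m → ℕ) (e₀ : Fin m) (w>0 : 0 < w e₀) where

    w′ : Fin m → ℕ
    w′ e = w e ∸ ind (e₀ == e)

    w-split : ∀ e → w e ≡ w′ e + ind (e₀ == e)
    w-split e with e₀ ≟ e
    ... | yes refl = sym (ℕₚ.m∸n+n≡m w>0)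
    ... | no _     = sym (ℕₚ.+-identityʳ _)

    -- The problem that remains after one unit is sent along `e₀`: the head has to pass it on, and
    -- the tail has delivered it, which is recorded as additional demand there.
    b⁺′ b⁻′ : Fin n → ℕ
    b⁺′ v = b⁺ v + ind (hd e₀ == v)
    b⁻′ v = b⁻ v + ind (tl e₀ == v)

    capacity-split : ∀ X → capacity w X ≡ capacity w′ X + ind (leaves X e₀)
    capacity-split X = begin
      capacity w X ≡⟨ sum-cong-≗ (λ e → trans (cong (_* ind (leaves X e)) (w-split e))
                                      (ℕₚ.*-distribʳ-+ (ind (leaves X e)) (w′ e) _)) ⟩
      sum (λ e → w′ e * ind (leaves X e) + ind (e₀ == e) * ind (leaves X e)) ≡⟨ sum-+ _ _ ⟩
      capacity w′ X + sum (λ e → ind (e₀ == e) * ind (leaves X e)) ≡⟨ cong (capacity w′ X +_) (sum-δ _ e₀) ⟩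
      capacity w′ X + ind (leaves X e₀) ∎

    sum-split : sum w ≡ sum w′ + 1
    sum-split = begin
      sum w                                 ≡⟨ sum-cong-≗ w-split ⟩
      sum (λ e → w′ e + ind (e₀ == e))      ≡⟨ sum-+ _ _ ⟩
      sum w′ + sum (λ e → ind (e₀ == e))    ≡⟨ cong (sum w′ +_) (sum-cong-≗ λ e → ℕₚ.*-identityʳ (ind (e₀ == e))) ⟨
      sum w′ + sum (λ e → ind (e₀ == e) * 1) ≡⟨ cong (sum w′ +_) (sum-δ _ e₀) ⟩
      sum w′ + 1 ∎

    -- Two violated cuts, one for each way to use up a unit of capacity of e₀, would uncross.
    either : (∀ X → CutCondition b⁺ b⁻ w X) →
             (∀ X → CutCondition b⁺ b⁻ w′ X) ⊎ (∀ X → CutCondition b⁺′ b⁻′ w′ X)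
    either cc with search (CutCondition? b⁺ b⁻ w′) (CutCondition-resp {b⁺} {b⁻} {w′})
    ... | inj₁ ok = inj₁ ok
    ... | inj₂ (X , ¬X) with search (CutCondition? b⁺′ b⁻′ w′) (CutCondition-resp {b⁺′} {b⁻′} {w′})
    ...   | inj₁ ok = inj₂ ok
    ...   | inj₂ (Y , ¬Y) = ⊥-elim (ℕₚ.<-irrefl refl (linear
      (weight X b⁺ ∷ weight X b⁻ ∷ capacity w′ X ∷ weight Y b⁺ ∷ weight Y b⁻ ∷ capacity w′ Y
        ∷ weight X∩Y b⁺ + weight X∪Y b⁺ ∷ weight X∩Y b⁻ + weight X∪Y b⁻
        ∷ capacity w X∩Y + capacity w X∪Y ∷ ind (leaves X e₀) ∷ ind (leaves Y e₀)
        ∷ ind (Y (tl e₀)) ∷ ind (Y (hd e₀)) ∷ ind special ∷ [])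
      ( (‵ 1 ⊕ (x₁ ⊕ x₂) ≼ x₀)
      ∷ (‵ 1 ⊕ (x₄ ⊕ t ⊕ x₅) ≼ x₃ ⊕ h)
      ∷ (x₀ ⊕ x₃ ≼ x₆)
      ∷ (x₇ ≼ x₁ ⊕ x₄)
      ∷ (x₆ ≼ x₇ ⊕ x₈)
      ∷ (x₈ ⊕ s ≼ (x₂ ⊕ x₉) ⊕ (x₅ ⊕ oy))
      ∷ (x₉ ⊕ oy ⊕ h ≼ ‵ 1 ⊕ t ⊕ s)
      ∷ [])
      (‵ 1 ≼ ‵ 0) 0 (1 ∷ 1 ∷ 1 ∷ 1 ∷ 1 ∷ 1 ∷ 1 ∷ [])
      ( ℕₚ.≰⇒> ¬X
      ∷ subst₂ (λ l r → suc (l + capacity w′ Y) ≤ r)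
          (trans (weight-+ Y b⁻ _) (cong (weight Y b⁻ +_) (weight-δ Y (tl e₀))))
          (trans (weight-+ Y b⁺ _) (cong (weight Y b⁺ +_) (weight-δ Y (hd e₀)))) (ℕₚ.≰⇒> ¬Y)
      ∷ ≤-reflexive (weight-modular X Y b⁺)
      ∷ ≤-reflexive (sym (weight-modular X Y b⁻))
      ∷ ≤-trans (+-mono-≤ (cc X∩Y) (cc X∪Y)) (≤-reflexive (interchange (weight X∩Y b⁻) _ _ _))
      ∷ subst₂ (λ l r → capacity w X∩Y + capacity w X∪Y + ind special ≤ l + r)
          (capacity-split X) (capacity-split Y) (capacity-uncross w X Y e₀ w>0)
      ∷ bools (X (tl e₀)) (Y (tl e₀)) (X (hd e₀)) (Y (hd e₀))
      ∷ [])))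
      where
      X∩Y X∪Y : Fin n → Bool
      X∩Y v = X v ∧ Y v
      X∪Y v = X v ∨ Y v
      special : Bool
      special = X (tl e₀) ∧ not (Y (tl e₀)) ∧ not (X (hd e₀)) ∧ Y (hd e₀)
      oy t h s : Lin 14
      oy = ♯ suc (suc (suc (suc (suc (suc (suc (suc (suc (suc zero)))))))))
      t  = ♯ suc (suc (suc (suc (suc (suc (suc (suc (suc (suc (suc zero))))))))))
      h  = ♯ suc (suc (suc (suc (suc (suc (suc (suc (suc (suc (suc (suc zero)))))))))))
      s  = ♯ suc (suc (suc (suc (suc (suc (suc (suc (suc (suc (suc (suc (suc zero))))))))))))
      bools = bools≤ 4 (λ a b c d → ind (a ∧ not c) + ind (b ∧ not d) + ind d)
                       (λ a b c d → 1 + ind b + ind (a ∧ not b ∧ not c ∧ d))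

    keep : Feasible b⁺ b⁻ w′ → Feasible b⁺ b⁻ w
    keep (y , y≤ , div) = y , (λ e → ≤-trans (y≤ e) (ℕₚ.m∸n≤m (w e) (ind (e₀ == e)))) , div

    push : Feasible b⁺′ b⁻′ w′ → Feasible b⁺ b⁻ w
    push (y , y≤ , div) = y″ , (λ e → subst (y″ e ≤_) (sym (w-split e)) (ℕₚ.+-monoˡ-≤ _ (y≤ e))) , div″
      where
      y″ : Fin m → ℕ
      y″ e = y e + ind (e₀ == e)
      split : ∀ (end : Fin m → Fin n) v → sum (λ e → y″ e * ind (end e == v))
            ≡ sum (λ e → y e * ind (end e == v)) + ind (end e₀ == v)
      split end v = trans (sum-cong-≗ λ e → ℕₚ.*-distribʳ-+ (ind (end e == v)) (y e) _)
        (trans (sum-+ _ _) (cong (sum (λ e → y e * ind (end e == v)) +_) (sum-δ _ e₀)))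
      div″ : ∀ v → sum (λ e → y″ e * ind (tl e == v)) + b⁻ v ≡ sum (λ e → y″ e * ind (hd e == v)) + b⁺ v
      div″ v = begin
        sum (λ e → y″ e * ind (tl e == v)) + b⁻ v ≡⟨ cong (_+ b⁻ v) (split tl v) ⟩
        (t + ind (tl e₀ == v)) + b⁻ v             ≡⟨ ℕₚ.+-assoc t _ _ ⟩
        t + (ind (tl e₀ == v) + b⁻ v)             ≡⟨ cong (t +_) (ℕₚ.+-comm _ (b⁻ v)) ⟩
        t + b⁻′ v                                 ≡⟨ div v ⟩
        h + b⁺′ v                                 ≡⟨ cong (h +_) (ℕₚ.+-comm (b⁺ v) _) ⟩
        h + (ind (hd e₀ == v) + b⁺ v)             ≡⟨ ℕₚ.+-assoc h _ _ ⟨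
        (h + ind (hd e₀ == v)) + b⁺ v             ≡⟨ cong (_+ b⁺ v) (split hd v) ⟨
        sum (λ e → y″ e * ind (hd e == v)) + b⁺ v ∎
        where
        t h : ℕ
        t = sum (λ e → y e * ind (tl e == v))
        h = sum (λ e → y e * ind (hd e == v))

  -- With no capacity left, the condition on singletons bounds `b⁺` by `b⁻` at every vertex, and the
  -- totals then force equality, so the zero flow works.
  feasible-exhausted : ∀ b⁺ b⁻ w → (∀ e → w e ≡ 0) → sum b⁻ ≤ sum b⁺ →
    (∀ X → CutCondition b⁺ b⁻ w X) → Feasible b⁺ b⁻ w
  feasible-exhausted b⁺ b⁻ w w≡0 tot cc = (λ _ → 0) , (λ _ → z≤n) ,
    λ v → cong₂ _+_ (trans (sum-zero {m} λ _ → refl) (sym (sum-zero {m} λ _ → refl)))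
                    (sym (sum-tight below tot v))
    where
    below : ∀ v → b⁺ v ≤ b⁻ v
    below v = subst₂ _≤_ (sum-δ b⁺ v)
      (trans (cong₂ _+_ (sum-δ b⁻ v) (sum-zero λ e → cong (_* _) (w≡0 e))) (ℕₚ.+-identityʳ _))
      (cc (v ==_))

  -- The max-flow min-cut theorem for supplies and demands, by induction on the total capacity:
  -- every round settles whether one unit of some arc is discarded or used.
  feasible-flow : ∀ k b⁺ b⁻ w → sum w ≡ k → sum b⁻ ≤ sum b⁺ →
    (∀ X → CutCondition b⁺ b⁻ w X) → Feasible b⁺ b⁻ w
  feasible-flow zero    b⁺ b⁻ w eq tot cc = feasible-exhausted b⁺ b⁻ w (sum≡0 w eq) tot cc
  feasible-flow (suc k) b⁺ b⁻ w eq tot cc with sum-positive w (subst (0 <_) (sym eq) (s≤s z≤n))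
  ... | e₀ , w>0 = case either cc of λ where
        (inj₁ ok) → keep (feasible-flow k b⁺ b⁻ w′ eq′ tot ok)
        (inj₂ ok) → push (feasible-flow k b⁺′ b⁻′ w′ eq′ tot′ ok)
    where
    open Step b⁺ b⁻ w e₀ w>0
    eq′ : sum w′ ≡ k
    eq′ = ℕₚ.suc-injective (trans (ℕₚ.+-comm 1 _) (trans (sym sum-split) eq))
    count : ∀ a → sum {n} (λ v → ind (a == v)) ≡ 1
    count a = trans (sum-cong-≗ λ v → sym (ℕₚ.*-identityʳ (ind (a == v)))) (sum-δ (λ _ → 1) a)
    tot′ : sum b⁻′ ≤ sum b⁺′
    tot′ = subst₂ _≤_ (sym (trans (sum-+ b⁻ _) (cong (sum b⁻ +_) (count (tl e₀)))))
                      (sym (trans (sum-+ b⁺ _) (cong (sum b⁺ +_) (count (hd e₀))))) (ℕₚ.+-monoˡ-≤ 1 tot)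

-- Degrees and cuts

card-sum : ∀ {n} (S : Subset n) → ∣ S ∣ ≡ sum (λ e → ind (lookup S e))
card-sum S = trans (go S) (sym (sum-is-sum _))
  where
  go : ∀ {n} (S : Subset n) → ∣ S ∣ ≡ Σ.sum (λ e → ind (lookup S e))
  go []          = refl
  go (true ∷ S)  = cong suc (go S)
  go (false ∷ S) = go S

sum-swap : ∀ {n m} (end : Fin m → Fin n) (g : Fin n → ℕ) (h : Fin m → ℕ) →
           sum (λ v → g v * sum (λ e → h e * ind (end e == v))) ≡ sum (λ e → h e * g (end e))
sum-swap end g h = begin
  sum (λ v → g v * sum (λ e → h e * ind (end e == v)))
    ≡⟨ sum-cong-≗ (λ v → sym (sum-*ˡ (g v) _)) ⟩
  sum (λ v → sum (λ e → g v * (h e * ind (end e == v))))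
    ≡⟨ ∑-comm _ ⟩
  sum (λ e → sum (λ v → g v * (h e * ind (end e == v))))
    ≡⟨ sum-cong-≗ (λ e → sum-cong-≗ λ v → rotate (g v) (h e) _) ⟩
  sum (λ e → sum (λ v → ind (end e == v) * (h e * g v)))
    ≡⟨ sum-cong-≗ (λ e → sum-δ (λ v → h e * g v) (end e)) ⟩
  sum (λ e → h e * g (end e)) ∎
  where
  rotate : ∀ a b c → a * (b * c) ≡ c * (b * a)
  rotate a b c = trans (ℕₚ.*-comm a _) (trans (cong (_* a) (ℕₚ.*-comm b c)) (ℕₚ.*-assoc c b a))

sum-incidence : ∀ {n m} (end : Fin m → Fin n) (g : Fin n → ℕ) →
                sum (λ v → g v * sum (λ e → ind (end e == v))) ≡ sum (λ e → g (end e))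
sum-incidence end g = trans
  (sum-cong-≗ λ v → cong (g v *_) (sum-cong-≗ λ e → sym (ℕₚ.+-identityʳ _)))
  (trans (sum-swap end g (λ _ → 1)) (sum-cong-≗ λ e → ℕₚ.+-identityʳ _))

module Cuts (G : Graph) where
  open Graph G

  deg : (Fin #E → Bool) → Fin #V → ℕ
  deg S v = sum λ e → ind (S e) * (ind (end₁ e == v) + ind (end₂ e == v))

  cross : (Fin #V → Bool) → Fin #E → Bool
  cross X e = X (end₁ e) xor X (end₂ e)

  cut : (Fin #E → Bool) → (Fin #V → Bool) → ℕ
  cut S X = sum λ e → ind (S e ∧ cross X e)

  every : Fin #E → Bool
  every _ = true

  degree-deg : ∀ S v → degree G S v ≡ deg (lookup S) v
  degree-deg S v = trans (cong₂ _+_ (half end₁) (half end₂))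
    (trans (sym (sum-+ _ _)) (sum-cong-≗ λ e → pointwise (lookup S e) (end₁ e == v) (end₂ e == v)))
    where
    half : ∀ end → ∣ S ∩ tabulate (λ e → does (end e ≟ v)) ∣ ≡ sum (λ e → ind (lookup S e ∧ (end e == v)))
    half end = trans (card-sum (S ∩ _)) (sum-cong-≗ λ e → cong ind
      (trans (lookup-zipWith _∧_ e S _) (cong (lookup S e ∧_) (lookup∘tabulate _ e))))
    pointwise : ∀ s a b → ind (s ∧ a) + ind (s ∧ b) ≡ ind s * (ind a + ind b)
    pointwise true  a b = sym (ℕₚ.+-identityʳ _)
    pointwise false a b = refl

  handshake : ∀ S (g : Fin #V → ℕ) →
    sum (λ v → g v * deg S v) ≡ sum (λ e → ind (S e) * (g (end₁ e) + g (end₂ e)))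
  handshake S g = begin
    sum (λ v → g v * deg S v)
      ≡⟨ sum-cong-≗ (λ v → trans (cong (g v *_) (trans (sum-cong-≗ λ e → ℕₚ.*-distribˡ-+ (ind (S e)) _ _) (sum-+ _ _)))
                            (ℕₚ.*-distribˡ-+ (g v) _ _)) ⟩
    sum (λ v → g v * sum (λ e → ind (S e) * ind (end₁ e == v)) + g v * sum (λ e → ind (S e) * ind (end₂ e == v)))
      ≡⟨ sum-+ _ _ ⟩
    _ ≡⟨ cong₂ _+_ (sum-swap end₁ g (ind ∘ S)) (sum-swap end₂ g (ind ∘ S)) ⟩
    _ ≡⟨ sum-+ _ _ ⟨
    sum (λ e → ind (S e) * g (end₁ e) + ind (S e) * g (end₂ e))
      ≡⟨ sum-cong-≗ (λ e → sym (ℕₚ.*-distribˡ-+ (ind (S e)) _ _)) ⟩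
    sum (λ e → ind (S e) * (g (end₁ e) + g (end₂ e))) ∎

  size : (Fin #V → Bool) → ℕ
  size X = sum λ v → ind (X v)

  size-complement : ∀ (X Y : Fin #V → Bool) → size (λ v → X v ∧ Y v) + size (λ v → not (X v) ∧ Y v) ≡ size Y
  size-complement X Y = trans (sym (sum-+ _ _)) (sum-cong-≗ λ v → pointwise (X v) (Y v))
    where
    pointwise : ∀ x y → ind (x ∧ y) + ind (not x ∧ y) ≡ ind y
    pointwise true  y = ℕₚ.+-identityʳ _
    pointwise false y = refl

  cut-complement : ∀ S X → cut S (λ v → not (X v)) ≡ cut S X
  cut-complement S X = sum-cong-≗ λ e →
    cong (λ x → ind (S e ∧ x)) (xor-annihilates-not (X (end₁ e)) (X (end₂ e)))

-- Bondy and Jaeger: a balanced valuation of a cubic graph yields a nowhere-zero flow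

module BalancedValuation (G : Graph) (cubic : ∀ v → Cuts.deg G (Cuts.every G) v ≡ 3)
  (s : Fin (Graph.#V G) → Bool)
  (neutral : Cuts.size G s ≡ Cuts.size G (λ v → not (s v)))
  (balanced : ∀ X → 5 * Cuts.size G (λ v → X v ∧ s v)
                  ≤ 5 * Cuts.size G (λ v → X v ∧ not (s v)) + 3 * Cuts.cut G (Cuts.every G) X)
  where
  open Graph G
  open Cuts G

  plus minus : (Fin #V → Bool) → ℕ
  plus  X = size λ v → X v ∧ s v
  minus X = size λ v → X v ∧ not (s v)

  size-split : ∀ X → size X ≡ plus X + minus X
  size-split X = trans (sum-cong-≗ λ v → pointwise (X v) (s v)) (sum-+ _ _)
    where
    pointwise : ∀ x y → ind x ≡ ind (x ∧ y) + ind (x ∧ not y)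
    pointwise true  true  = refl
    pointwise true  false = refl
    pointwise false y     = refl

  -- This is `balanced` for the complement of X, which has the same boundary and, as `s` is neutral,
  -- the opposite surplus.
  balanced′ : ∀ X → 5 * minus X ≤ 5 * plus X + 3 * cut every X
  balanced′ X = linear
    (plus X ∷ minus X ∷ plus Xᶜ ∷ minus Xᶜ ∷ size s ∷ cut every X ∷ [])
    ((5 ⊗ x₂ ≼ 5 ⊗ x₃ ⊕ 3 ⊗ x₅) ∷ (x₄ ≼ x₀ ⊕ x₂) ∷ (x₁ ⊕ x₃ ≼ x₄) ∷ [])
    (5 ⊗ x₁ ≼ 5 ⊗ x₀ ⊕ 3 ⊗ x₅) 0 (1 ∷ 5 ∷ 5 ∷ [])
    ( subst (λ k → 5 * plus Xᶜ ≤ 5 * minus Xᶜ + 3 * k) (cut-complement every X) (balanced Xᶜ)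
    ∷ ≤-reflexive (sym (size-complement X s))
    ∷ ≤-reflexive (trans (size-complement X _) (sym neutral)) ∷ [])
    where
    Xᶜ : Fin #V → Bool
    Xᶜ v = not (X v)

  size-handshake : ∀ X → 3 * size X ≡ sum (λ e → ind (X (end₁ e)) + ind (X (end₂ e)))
  size-handshake X = begin
    3 * size X                             ≡⟨ sum-*ˡ 3 _ ⟨
    sum (λ v → 3 * ind (X v))              ≡⟨ sum-cong-≗ (λ v → trans (ℕₚ.*-comm 3 (ind (X v))) (cong (ind (X v) *_) (sym (cubic v)))) ⟩
    sum (λ v → ind (X v) * deg every v)    ≡⟨ handshake every (ind ∘ X) ⟩
    _                                      ≡⟨ sum-cong-≗ (λ e → ℕₚ.+-identityʳ _) ⟩
    sum (λ e → ind (X (end₁ e)) + ind (X (end₂ e))) ∎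

  in₀ out₀ : Fin #V → ℕ
  in₀  v = sum λ e → ind (end₂ e == v)
  out₀ v = sum λ e → ind (end₁ e == v)

  -- `in₀` is the out-degree when every edge points from `end₂` to `end₁`, and a unit of flow turns
  -- an edge round, so a feasible flow is an orientation with out-degree 2 at positive and 1 at
  -- negative vertices. The right-hand side counts the edges that meet X, whose double is 3|X| +
  -- |∂X|; what has to be shown is that the surplus of X is at most |∂X|, which is weaker than
  -- `balanced`.
  orientation-cut : ∀ X → CutCondition end₁ end₂ (λ v → 1 + ind (s v)) in₀ (λ _ → 1) X
  orientation-cut X = linear
    (weight end₁ end₂ X (λ v → 1 + ind (s v)) ∷ weight end₁ end₂ X in₀ ∷ capacity end₁ end₂ (λ _ → 1) X
      ∷ size X ∷ plus X ∷ minus X ∷ cut every X ∷ sum (λ e → ind (X (end₁ e)) + ind (X (end₂ e))) ∷ [])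
    ( (x₀ ≼ x₃ ⊕ x₄) ∷ (x₃ ≼ x₄ ⊕ x₅) ∷ (x₄ ⊕ x₅ ≼ x₃) ∷ (3 ⊗ x₃ ≼ x₇) ∷ (5 ⊗ x₄ ≼ 5 ⊗ x₅ ⊕ 3 ⊗ x₆)
    ∷ (x₇ ⊕ x₆ ≼ 2 ⊗ x₁ ⊕ 2 ⊗ x₂) ∷ [])
    (x₀ ≼ x₁ ⊕ x₂) 9 (10 ∷ 0 ∷ 5 ∷ 5 ∷ 1 ∷ 5 ∷ [])
    ( ≤-reflexive (trans (sum-cong-≗ λ v → pointwise (X v) (s v)) (sum-+ _ _))
    ∷ ≤-reflexive (size-split X)
    ∷ ≤-reflexive (sym (size-split X))
    ∷ ≤-reflexive (size-handshake X)
    ∷ balanced X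
    ∷ subst₂ _≤_ (sum-+ _ _)
        (trans (sum-+ _ _) (cong₂ _+_
          (trans (sum-*ˡ 2 _) (cong (2 *_) (sym (sum-incidence end₂ (ind ∘ X))))) (sum-*ˡ 2 _)))
        (sum-mono λ e → edgewise (X (end₁ e)) (X (end₂ e)))
    ∷ [])
    where
    pointwise : ∀ x y → ind x * (1 + ind y) ≡ ind x + ind (x ∧ y)
    pointwise true  true  = refl
    pointwise true  false = refl
    pointwise false y     = refl
    edgewise : ∀ a b → ind a + ind b + ind (a xor b) ≤ 2 * ind b + 2 * (1 * ind (a ∧ not b))
    edgewise = bools≤ 2 (λ a b → ind a + ind b + ind (a xor b)) (λ a b → 2 * ind b + 2 * (1 * ind (a ∧ not b)))

  all : Fin #V → Bool
  all _ = true

  orientation-total : sum in₀ ≤ sum (λ v → 1 + ind (s v))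
  orientation-total = linear
    (sum in₀ ∷ sum (λ v → 1 + ind (s v)) ∷ size all ∷ size s ∷ size (λ v → not (s v)) ∷ sum {#E} (λ _ → 1) ∷ [])
    ((x₀ ≼ x₅) ∷ (x₂ ⊕ x₃ ≼ x₁) ∷ (2 ⊗ x₅ ≼ 3 ⊗ x₂) ∷ (x₂ ≼ x₃ ⊕ x₄) ∷ (x₄ ≼ x₃) ∷ [])
    (x₀ ≼ x₁) 1 (2 ∷ 2 ∷ 1 ∷ 1 ∷ 1 ∷ [])
    ( ≤-reflexive (trans (sum-cong-≗ λ v → sym (ℕₚ.+-identityʳ _)) (sum-incidence end₂ (λ _ → 1)))
    ∷ ≤-reflexive (sym (sum-+ _ _))
    ∷ ≤-reflexive (trans (sym (sum-*ˡ 2 _)) (sym (size-handshake all)))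
    ∷ ≤-reflexive (size-split all)
    ∷ ≤-reflexive (sym neutral) ∷ [])

  abstract
    orientation : Feasible end₁ end₂ (λ v → 1 + ind (s v)) in₀ (λ _ → 1)
    orientation = feasible-flow end₁ end₂ _ _ in₀ (λ _ → 1) refl orientation-total orientation-cut

  y : Fin #E → ℕ
  y = proj₁ orientation

  forward : Fin #E → Bool
  forward e = does (y e ℕₚ.≟ 1)

  y-forward : ∀ e → y e ≡ ind (forward e)
  y-forward e with proj₁ orientation e | proj₁ (proj₂ orientation) e
  ... | zero        | _           = refl
  ... | suc zero    | _           = refl
  ... | suc (suc _) | s≤s ()

  tail head : Fin #E → Fin #V
  tail e = if forward e then end₁ e else end₂ e
  head e = if forward e then end₂ e else end₁ e

  in₁ out₁ : Fin #V → ℕ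
  in₁  v = sum λ e → ind (head e == v)
  out₁ v = sum λ e → ind (tail e == v)

  imbalance : ∀ v → out₁ v ≡ 1 + ind (s v) × in₁ v + ind (s v) ≡ 2
  imbalance v = ℕₚ.≤-antisym (solve (x₀ ≼ x₇) (1 ∷ 0 ∷ 0 ∷ 0 ∷ 0 ∷ 0 ∷ 1 ∷ 0 ∷ 0 ∷ 1 ∷ []))
                             (solve (x₇ ≼ x₀) (0 ∷ 1 ∷ 0 ∷ 0 ∷ 0 ∷ 0 ∷ 0 ∷ 1 ∷ 1 ∷ []))
              , ℕₚ.≤-antisym (solve (x₁ ⊕ x₆ ≼ ‵ 2) (0 ∷ 0 ∷ 1 ∷ 0 ∷ 1 ∷ 0 ∷ 0 ∷ 1 ∷ []))
                             (solve (‵ 2 ≼ x₁ ⊕ x₆) (0 ∷ 0 ∷ 0 ∷ 1 ∷ 0 ∷ 1 ∷ 1 ∷ 0 ∷ []))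
    where
    A B : ℕ
    A = sum λ e → y e * ind (end₁ e == v)
    B = sum λ e → y e * ind (end₂ e == v)
    ρ = out₁ v ∷ in₁ v ∷ A ∷ B ∷ in₀ v ∷ out₀ v ∷ ind (s v) ∷ 1 + ind (s v) ∷ []
    pointwise : ∀ (f : Bool) (a b : Fin #V) k → k ≡ ind f →
                ind ((if f then a else b) == v) + k * ind (b == v) ≡ k * ind (a == v) + ind (b == v)
    pointwise true  a b k refl = cong₂ _+_ (sym (ℕₚ.+-identityʳ (ind (a == v)))) (ℕₚ.+-identityʳ (ind (b == v)))
    pointwise false a b k refl = ℕₚ.+-identityʳ _
    pointwise′ : ∀ (f : Bool) (a b : Fin #V) k → k ≡ ind f →
                ind ((if f then b else a) == v) + k * ind (a == v) ≡ k * ind (b == v) + ind (a == v)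
    pointwise′ true  a b k refl = cong₂ _+_ (sym (ℕₚ.+-identityʳ (ind (b == v)))) (ℕₚ.+-identityʳ (ind (a == v)))
    pointwise′ false a b k refl = ℕₚ.+-identityʳ _
    out-eq : out₁ v + B ≡ A + in₀ v
    out-eq = trans (sym (sum-+ _ _)) (trans (sum-cong-≗ λ e → pointwise (forward e) (end₁ e) (end₂ e) (y e) (y-forward e)) (sum-+ _ _))
    in-eq : in₁ v + A ≡ B + out₀ v
    in-eq = trans (sym (sum-+ _ _)) (trans (sum-cong-≗ λ e → pointwise′ (forward e) (end₁ e) (end₂ e) (y e) (y-forward e)) (sum-+ _ _))
    cubic′ : out₀ v + in₀ v ≡ 3
    cubic′ = trans (sym (sum-+ _ _)) (trans (sum-cong-≗ λ e → sym (ℕₚ.+-identityʳ _)) (cubic v))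
    hyps : List (Ineq 8)
    hyps = ( (x₀ ⊕ x₃ ≼ x₂ ⊕ x₄) ∷ (x₂ ⊕ x₄ ≼ x₀ ⊕ x₃) ∷ (x₁ ⊕ x₂ ≼ x₃ ⊕ x₅) ∷ (x₃ ⊕ x₅ ≼ x₁ ⊕ x₂)
      ∷ (x₅ ⊕ x₄ ≼ ‵ 3) ∷ (‵ 3 ≼ x₅ ⊕ x₄) ∷ (x₂ ⊕ x₄ ≼ x₃ ⊕ (‵ 1 ⊕ x₆)) ∷ (x₃ ⊕ (‵ 1 ⊕ x₆) ≼ x₂ ⊕ x₄)
      ∷ (x₇ ≼ ‵ 1 ⊕ x₆) ∷ (‵ 1 ⊕ x₆ ≼ x₇) ∷ [])
    solve : ∀ g cs → {T (Certified hyps cs 0 g)} → Holds ρ g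
    solve g cs {p} = linear ρ hyps g 0 cs {p}
      ( ≤-reflexive out-eq ∷ ≤-reflexive (sym out-eq) ∷ ≤-reflexive in-eq ∷ ≤-reflexive (sym in-eq)
      ∷ ≤-reflexive cubic′ ∷ ≤-reflexive (sym cubic′)
      ∷ ≤-reflexive (proj₂ (proj₂ orientation) v) ∷ ≤-reflexive (sym (proj₂ (proj₂ orientation) v))
      ∷ ≤-refl ∷ ≤-refl ∷ [])

  -- Let L edges leave X and E enter it. By the out-degrees, the surplus of X is L - E, and
  -- `balanced′` reads 5 (E - L) ≤ 3 (E + L), that is, E ≤ 4 L. This is Hoffman's condition for
  -- values from 1 to 4. The lower bound 1 is taken off every edge, which turns `in₁` and `out₁`
  -- into supply and demand and leaves capacity 3.
  value-cut : ∀ X → CutCondition tail head in₁ out₁ (λ _ → 3) X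
  value-cut X = linear
    (weight tail head X in₁ ∷ weight tail head X out₁ ∷ capacity tail head (λ _ → 3) X
      ∷ sum (λ e → ind (leaves tail head X e)) ∷ cut every X ∷ plus X ∷ minus X ∷ size X ∷ [])
    ( (3 ⊗ x₃ ≼ x₂) ∷ (x₀ ⊕ x₅ ≼ 2 ⊗ x₇) ∷ (x₇ ⊕ x₅ ≼ x₁) ∷ (x₇ ≼ x₅ ⊕ x₆)
    ∷ (5 ⊗ x₆ ≼ 5 ⊗ x₅ ⊕ 3 ⊗ x₄) ∷ (x₁ ⊕ x₄ ≼ x₀ ⊕ 2 ⊗ x₃) ∷ [])
    (x₀ ≼ x₁ ⊕ x₂) 1 (2 ∷ 5 ∷ 5 ∷ 5 ∷ 1 ∷ 3 ∷ [])
    ( ≤-reflexive (sym (sum-*ˡ 3 _))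
    ∷ ≤-reflexive (trans (sym (sum-+ _ _)) (trans (sum-cong-≗ λ v → ins v (X v)) (sum-*ˡ 2 _)))
    ∷ ≤-reflexive (trans (sym (sum-+ _ _)) (sum-cong-≗ λ v → outs v (X v)))
    ∷ ≤-reflexive (size-split X)
    ∷ balanced′ X
    ∷ ≤-reflexive (begin
        weight tail head X out₁ + cut every X ≡⟨ cong (_+ cut every X) (sum-incidence tail (ind ∘ X)) ⟩
        sum (λ e → ind (X (tail e))) + cut every X ≡⟨ sum-+ _ _ ⟨
        sum (λ e → ind (X (tail e)) + ind (cross X e)) ≡⟨ sum-cong-≗ (λ e → edgewise (forward e) (end₁ e) (end₂ e)) ⟩
        sum (λ e → ind (X (head e)) + 2 * ind (leaves tail head X e)) ≡⟨ sum-+ _ _ ⟩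
        _ ≡⟨ cong₂ _+_ (sym (sum-incidence head (ind ∘ X))) (sum-*ˡ 2 _) ⟩
        weight tail head X in₁ + 2 * sum (λ e → ind (leaves tail head X e)) ∎)
    ∷ [])
    where
    ins : ∀ v x → ind x * in₁ v + ind (x ∧ s v) ≡ 2 * ind x
    ins v true  = trans (cong (_+ ind (s v)) (ℕₚ.+-identityʳ _)) (proj₂ (imbalance v))
    ins v false = refl
    outs : ∀ v x → ind x + ind (x ∧ s v) ≡ ind x * out₁ v
    outs v true  = trans (sym (proj₁ (imbalance v))) (sym (ℕₚ.+-identityʳ _))
    outs v false = refl
    edgewise : ∀ (f : Bool) a b → ind (X (if f then a else b)) + ind (X a xor X b)
      ≡ ind (X (if f then b else a)) + 2 * ind (X (if f then a else b) ∧ not (X (if f then b else a)))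
    edgewise true  a b with X a | X b
    ... | true  | true  = refl
    ... | true  | false = refl
    ... | false | true  = refl
    ... | false | false = refl
    edgewise false a b with X a | X b
    ... | true  | true  = refl
    ... | true  | false = refl
    ... | false | true  = refl
    ... | false | false = refl

  ends : ∀ (end : Fin #E → Fin #V) → sum (λ v → sum (λ e → ind (end e == v))) ≡ sum {#E} (λ _ → 1)
  ends end = trans (sum-cong-≗ λ v → sym (ℕₚ.+-identityʳ _)) (sum-incidence end (λ _ → 1))

  abstract
    values : Feasible tail head in₁ out₁ (λ _ → 3)
    values = feasible-flow tail head _ in₁ out₁ (λ _ → 3) refl
      (≤-reflexive (trans (ends tail) (sym (ends head)))) value-cut

  flow : NowhereZeroFlow G 5
  flow = record
    { forward   = forward
    ; value     = λ e → 1 + y′ e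
    ; value-pos = λ e → s≤s z≤n
    ; value-<   = λ e → s≤s (s≤s (proj₁ (proj₂ values) e))
    ; kirchhoff = λ v → trans (total-split head v) (trans (sym (proj₂ (proj₂ values) v)) (sym (total-split tail v)))
    }
    where
    y′ : Fin #E → ℕ
    y′ = proj₁ values
    total-split : ∀ end v → total G end (λ e → 1 + y′ e) v
                ≡ sum (λ e → y′ e * ind (end e == v)) + sum (λ e → ind (end e == v))
    total-split end v = trans (sym (sum-is-sum _)) (trans (sum-cong-≗ λ e → pointwise (end e == v) (y′ e)) (sum-+ _ _))
      where
      pointwise : ∀ b k → (if b then 1 + k else 0) ≡ k * ind b + ind b
      pointwise true  k = trans (ℕₚ.+-comm 1 k) (cong (_+ 1) (sym (ℕₚ.*-identityʳ k)))
      pointwise false k = sym (trans (ℕₚ.+-identityʳ _) (ℕₚ.*-zeroʳ k))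

sum-unique : ∀ {n} (g : Fin n → Bool) i → g i ≡ true → (∀ j → g j ≡ true → i ≡ j) → sum (λ j → ind (g j)) ≡ 1
sum-unique g i gi uniq = trans (sum-cong-≗ λ j → cong ind (agree j))
  (trans (sum-cong-≗ λ j → sym (ℕₚ.*-identityʳ (ind (i == j)))) (sum-δ (λ _ → 1) i))
  where
  agree : ∀ j → g j ≡ (i == j)
  agree j with i ≟ j
  ... | yes refl = gi
  ... | no i≢j with g j in eq
  ...   | false = refl
  ...   | true  = ⊥-elim (i≢j (uniq j eq))

-- Two fixed-point-free involutions have a common alternating 2-colouring

module _ {n : ℕ} where

  open Data.List.Membership.DecPropositional (_≟_ {n}) using (_∈?_)

  Involutive : (Fin n → Fin n) → Set
  Involutive μ = ∀ v → μ (μ v) ≡ v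

  abstract
    _[_≔_] : {A : Set} → (Fin n → A) → Fin n → A → Fin n → A
    (f [ a ≔ x ]) v = if a == v then x else f v

    update-here : ∀ {A : Set} (f : Fin n → A) a x → (f [ a ≔ x ]) a ≡ x
    update-here f a x rewrite ==-refl a = refl

    update-there : ∀ {A : Set} (f : Fin n → A) {a v} x → a ≢ v → (f [ a ≔ x ]) v ≡ f v
    update-there f x a≢v rewrite ==-≢ a≢v = refl

  -- Contracts the path u′ = μ u , u , w , w′ = μ w to an edge u′ w′.
  module Contract (μ : Fin n → Fin n) (inv : Involutive μ) (fpf : ∀ v → μ v ≢ v)
                  (u w : Fin n) (u≢w : u ≢ w) (μu≢w : μ u ≢ w) where

    -- The two removed vertices are paired with each other, so the vertex set stays the same and no
    -- fixed point appears.
    μ′ : Fin n → Fin n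
    μ′ = (((μ [ u ≔ w ]) [ w ≔ u ]) [ μ u ≔ μ w ]) [ μ w ≔ μ u ]

    μw≢u : μ w ≢ u
    μw≢u p = μu≢w (trans (cong μ (sym p)) (inv w))
    μw≢μu : μ w ≢ μ u
    μw≢μu p = u≢w (trans (sym (inv u)) (trans (cong μ (sym p)) (inv w)))

    at-u : μ′ u ≡ w
    at-u = trans (update-there _ _ μw≢u) (trans (update-there _ _ (fpf u))
      (trans (update-there _ _ (u≢w ∘ sym)) (update-here _ u w)))
    at-w : μ′ w ≡ u
    at-w = trans (update-there _ _ (fpf w)) (trans (update-there _ _ μu≢w) (update-here _ w u))
    at-μu : μ′ (μ u) ≡ μ w
    at-μu = trans (update-there _ _ μw≢μu) (update-here _ (μ u) (μ w))
    at-μw : μ′ (μ w) ≡ μ u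
    at-μw = update-here _ (μ w) (μ u)
    elsewhere : ∀ {v} → u ≢ v → w ≢ v → μ u ≢ v → μ w ≢ v → μ′ v ≡ μ v
    elsewhere a b c d = trans (update-there _ _ d) (trans (update-there _ _ c)
      (trans (update-there _ _ b) (update-there _ _ a)))

    data Place (v : Fin n) : Set where
      isu  : u ≡ v → Place v
      isw  : w ≡ v → Place v
      isμu : μ u ≡ v → Place v
      isμw : μ w ≡ v → Place v
      far  : u ≢ v → w ≢ v → μ u ≢ v → μ w ≢ v → Place v

    place : ∀ v → Place v
    place v with u ≟ v | w ≟ v | μ u ≟ v | μ w ≟ v
    ... | yes p | _ | _ | _ = isu p
    ... | no _ | yes p | _ | _ = isw p
    ... | no _ | no _ | yes p | _ = isμu p
    ... | no _ | no _ | no _ | yes p = isμw p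
    ... | no a | no b | no c | no d = far a b c d

    inv′ : Involutive μ′
    inv′ v with place v
    ... | isu refl = trans (cong μ′ at-u) at-w
    ... | isw refl = trans (cong μ′ at-w) at-u
    ... | isμu refl = trans (cong μ′ at-μu) at-μw
    ... | isμw refl = trans (cong μ′ at-μw) at-μu
    ... | far a b c d = trans (cong μ′ (elsewhere a b c d)) (trans (elsewhere
      (λ p → c (trans (cong μ p) (inv v))) (λ p → d (trans (cong μ p) (inv v)))
      (λ p → a (flip p)) (λ p → b (flip p))) (inv v))
      where
      flip : ∀ {x} → μ x ≡ μ v → x ≡ v
      flip {x} p = trans (sym (inv x)) (trans (cong μ p) (inv v))

    fpf′ : ∀ v → μ′ v ≢ v
    fpf′ v p with place v
    ... | isu refl = u≢w (trans (sym p) at-u)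
    ... | isw refl = u≢w (trans (sym at-w) p)
    ... | isμu refl = μw≢μu (trans (sym at-μu) p)
    ... | isμw refl = μw≢μu (trans (sym p) at-μw)
    ... | far a b c d = fpf v (trans (sym (elsewhere a b c d)) p)

    colour : (Fin n → Bool) → Fin n → Bool
    colour s = (s [ u ≔ not (s (μ u)) ]) [ w ≔ not (s (μ w)) ]

    colour-u : ∀ s → colour s u ≡ not (s (μ u))
    colour-u s = trans (update-there _ _ (u≢w ∘ sym)) (update-here s u _)
    colour-w : ∀ s → colour s w ≡ not (s (μ w))
    colour-w s = update-here _ w _
    colour-far : ∀ s {v} → u ≢ v → w ≢ v → colour s v ≡ s v
    colour-far s a b = trans (update-there _ _ b) (update-there s _ a)

    colour-μ : ∀ s → (∀ v → s (μ′ v) ≡ not (s v)) → ∀ v → colour s (μ v) ≡ not (colour s v)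
    colour-μ s alt v with place v
    ... | isu refl = trans (colour-far s (λ p → fpf u (sym p)) (λ p → μu≢w (sym p)))
                      (trans (sym (not-involutive (s (μ u)))) (cong not (sym (colour-u s))))
    ... | isw refl = trans (colour-far s (λ p → μw≢u (sym p)) (λ p → fpf w (sym p)))
                      (trans (sym (not-involutive (s (μ w)))) (cong not (sym (colour-w s))))
    ... | isμu refl = trans (cong (colour s) (inv u)) (trans (colour-u s)
                       (cong not (sym (colour-far s (λ p → fpf u (sym p)) (λ p → μu≢w (sym p))))))
    ... | isμw refl = trans (cong (colour s) (inv w)) (trans (colour-w s)
                       (cong not (sym (colour-far s (λ p → μw≢u (sym p)) (λ p → fpf w (sym p))))))
    ... | far a b c d = trans (colour-far s (λ p → c (trans (cong μ p) (inv v))) (λ p → d (trans (cong μ p) (inv v))))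
      (trans (cong s (sym (elsewhere a b c d))) (trans (alt v) (cong not (sym (colour-far s a b)))))

    -- The contracted edge makes `μ u` and `μ w` opposite; `u` and `w` are opposite to them, hence
    -- to each other.
    colour-uw : ∀ s → (∀ v → s (μ′ v) ≡ not (s v)) → colour s w ≡ not (colour s u)
    colour-uw s alt = trans (colour-w s) (cong not
      (trans (cong s (sym at-μu)) (trans (alt (μ u)) (sym (colour-u s)))))

  -- A union of two matchings is bipartite, but its paths and circuits are never constructed: the
  -- pairs of `ν` are imposed one at a time, each by contracting it into `μ`. Fixed points of `ν`
  -- impose nothing.
  two-colouring-list : (ν : Fin n → Fin n) → Involutive ν → (L : List (Fin n)) →
    (μ : Fin n → Fin n) → Involutive μ → (∀ v → μ v ≢ v) →
    Σ[ s ∈ (Fin n → Bool) ] (∀ v → s (μ v) ≡ not (s v)) × (∀ v → v ∈ L → ν v ≢ v → s (ν v) ≡ not (s v))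
  two-colouring-list ν invν [] μ inv fpf = s , alt , λ v ()
    where
    s : Fin n → Bool
    -- The order of the indices selects one vertex from each pair of `μ`.
    s v = toℕ v <ᵇ toℕ (μ v)
    asym : ∀ a b → a ≢ b → (b <ᵇ a) ≡ not (a <ᵇ b)
    asym zero    zero    p = ⊥-elim (p refl)
    asym zero    (suc b) p = refl
    asym (suc a) zero    p = refl
    asym (suc a) (suc b) p = asym a b (p ∘ cong suc)
    alt : ∀ v → s (μ v) ≡ not (s v)
    alt v = trans (cong (λ x → toℕ (μ v) <ᵇ toℕ x) (inv v))
                  (asym (toℕ v) (toℕ (μ v)) (λ p → fpf v (sym (toℕ-injective p))))
  two-colouring-list ν invν (u ∷ L) μ inv fpf with u ∈? L | ν u ∈? L | ν u ≟ u | μ u ≟ ν u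
  ... | yes u∈ | _ | _ | _ = let s , alt , altν = two-colouring-list ν invν L μ inv fpf in
    s , alt , λ where
      v (here refl) p → altν v u∈ p
      v (there q)   p → altν v q p
  ... | no _ | yes νu∈ | _ | _ = let s , alt , altν = two-colouring-list ν invν L μ inv fpf in
    s , alt , λ where
      v (here refl) p → flip-not (trans (cong s (sym (invν v))) (altν (ν v) νu∈ (λ q → p (trans (sym q) (invν v)))))
      v (there q)   p → altν v q p
    where
    flip-not : ∀ {a b} → a ≡ not b → b ≡ not a
    flip-not {_} {true}  refl = refl
    flip-not {_} {false} refl = refl
  ... | no _ | no _ | yes νu≡u | _ = let s , alt , altν = two-colouring-list ν invν L μ inv fpf in
    s , alt , λ where
      v (here refl) p → ⊥-elim (p νu≡u)
      v (there q)   p → altν v q p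
  ... | no _ | no _ | no _ | yes μu≡νu = let s , alt , altν = two-colouring-list ν invν L μ inv fpf in
    s , alt , λ where
      v (here refl) p → trans (cong s (sym μu≡νu)) (alt v)
      v (there q)   p → altν v q p
  -- Neither `u` nor `ν u` occurs in the rest of the list, so recolouring both leaves the
  -- constraints already met intact.
  ... | no u∉ | no νu∉ | no νu≢u | no μu≢νu =
    let s , alt , altν = two-colouring-list ν invν L μ′ inv′ fpf′ in
    colour s , colour-μ s alt , λ where
      v (here refl) p → colour-uw s alt
      v (there q)   p → trans (colour-far s (λ r → νu∉ (subst (_∈ L) (trans (sym (invν v)) (cong ν (sym r))) q))
                                            (λ r → u∉ (subst (_∈ L) (trans (sym (invν v)) (trans (cong ν (sym r)) (invν u))) q)))
                        (trans (altν v q p) (cong not (sym (colour-far s (λ r → u∉ (subst (_∈ L) (sym r) q))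
                                                                         (λ r → νu∉ (subst (_∈ L) (sym r) q))))))
    where open Contract μ inv fpf u (ν u) (νu≢u ∘ sym) μu≢νu

  two-colouring : (μ ν : Fin n → Fin n) → Involutive μ → (∀ v → μ v ≢ v) → Involutive ν →
    Σ[ s ∈ (Fin n → Bool) ] (∀ v → s (μ v) ≡ not (s v)) × (∀ v → ν v ≢ v → s (ν v) ≡ not (s v))
  two-colouring μ ν inv fpf invν =
    let s , alt , altν = two-colouring-list ν invν (allFin n) μ inv fpf in
    s , alt , λ v → altν v (∈-allFin v)

-- Components

module Components (G : Graph) (S : Subset (Graph.#E G)) where
  open Graph G

  -- Union-find: processing an edge merges the class of its first end into that of its second.
  -- Equality of labels then decides connectedness.
  label : List (Fin #E) → Fin #V → Fin #V
  label []       v = v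
  label (e ∷ es) v = if lookup S e ∧ (label es v == label es (end₁ e)) then label es (end₂ e) else label es v

  edge-connected : ∀ {e} → lookup S e ≡ true → Connected G S (end₁ e) (end₂ e)
  edge-connected {e} p = Eq.return (e , lookup⇒[]= e S p , refl , refl)

  connected-label : ∀ es v → Connected G S v (label es v)
  connected-label []       v = Eq.reflexive _
  connected-label (e ∷ es) v with lookup S e in Se | label es v ≟ label es (end₁ e)
  ... | false | _     = connected-label es v
  ... | true  | no _  = connected-label es v
  ... | true  | yes p = Eq.transitive _ (connected-label es v)
    (Eq.transitive _ (subst (λ x → Connected G S x (end₁ e)) (sym p) (Eq.symmetric _ (connected-label es (end₁ e))))
    (Eq.transitive _ (edge-connected Se) (connected-label es (end₂ e))))

  label-edge : ∀ es {e} → e ∈ es → lookup S e ≡ true → label es (end₁ e) ≡ label es (end₂ e)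
  label-edge (e ∷ es) (here refl) Se rewrite Se | ==-refl (label es (end₁ e)) with label es (end₂ e) ≟ label es (end₁ e)
  ... | yes _ = refl
  ... | no  _ = refl
  label-edge (e ∷ es) (there q) Se =
    cong (λ x → if lookup S e ∧ (x == label es (end₁ e)) then label es (end₂ e) else x) (label-edge es q Se)

  rep : Fin #V → Fin #V
  rep = label (allFin #E)

  rep-edge : ∀ {e} → lookup S e ≡ true → rep (end₁ e) ≡ rep (end₂ e)
  rep-edge {e} = label-edge (allFin #E) (∈-allFin e)

  connected⇒rep : ∀ {u v} → Connected G S u v → rep u ≡ rep v
  connected⇒rep = Eq.gfold isEquivalence rep λ where (e , e∈S , refl , refl) → rep-edge ([]=⇒lookup e∈S)

  connected-rep : ∀ v → Connected G S v (rep v)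
  connected-rep = connected-label (allFin #E)

  rep⇒connected : ∀ {u v} → rep u ≡ rep v → Connected G S u v
  rep⇒connected {u} {v} p = Eq.transitive _ (connected-rep u)
    (subst (λ x → Connected G S x v) (sym p) (Eq.symmetric _ (connected-rep v)))

  rep-rep : ∀ v → rep (rep v) ≡ rep v
  rep-rep v = sym (connected⇒rep (connected-rep v))

-- Cubic graphs with a 2-factor whose odd circuits cannot be separated by five edges

record Setting : Set where
  field
    G : Graph
  open Graph G public
  open Cuts G public
  field
    cubic      : ∀ v → deg every v ≡ 3
    F          : Subset #E
    two-factor : ∀ v → deg (lookup F) v ≡ 2
  open Components G F public

  f : Fin #E → Bool
  f e = lookup F e

  M : Fin #E → Bool
  M e = not (f e)

  comp : Fin #V → Fin #V → Bool
  comp r v = rep v == r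

  field
    ω           : ℕ
    ω≤4         : ω ≤ 4
    c           : Fin ω → Fin #V
    c-injective : ∀ {i j} → rep (c i) ≡ rep (c j) → i ≡ j
    c-odd       : ∀ i → odd (size (comp (rep (c i)))) ≡ true
    c-all       : ∀ r → odd (size (comp r)) ≡ true → ∃[ i ] rep (c i) ≡ r
    -- The form in which m* ≥ 6 is used. Q is constant on both circuits, so removing its boundary
    -- leaves them intact in different components.
    separation  : ∀ Q i j → cut every Q ≤ 5 → (∀ v → rep v ≡ rep (c i) → Q v ≡ true) →
                  (∀ v → rep v ≡ rep (c j) → Q v ≡ false) → ⊥

-- Joins inside the 2-factor

module Joins (𝒮 : Setting) where
  open Setting 𝒮

  odd-sum-xor : ∀ {n} (a b : Fin n → Bool) (k : Fin n → ℕ) →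
    odd (sum (λ e → ind (a e xor b e) * k e)) ≡ odd (sum (λ e → ind (a e) * k e)) xor odd (sum (λ e → ind (b e) * k e))
  odd-sum-xor a b k = trans (odd-sum λ e → pointwise (a e) (b e) (k e))
    (trans (cong odd (sum-+ _ _)) (odd-+ (sum (λ e → ind (a e) * k e)) _))
    where
    pointwise : ∀ a b k → odd (ind (a xor b) * k) ≡ odd (ind a * k + ind b * k)
    pointwise true  true  k = sym (odd-double (k + 0))
    pointwise true  false k = cong odd (sym (ℕₚ.+-identityʳ (k + 0)))
    pointwise false b     k = refl

  M-degree : ∀ v → deg M v ≡ 1
  M-degree v = ℕₚ.+-cancelˡ-≡ 2 _ _ (begin
    2 + deg M v                 ≡⟨ cong (_+ deg M v) (two-factor v) ⟨
    deg f v + deg M v           ≡⟨ sum-+ _ _ ⟨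
    _                           ≡⟨ sum-cong-≗ (λ e → pointwise (f e) _) ⟩
    deg every v                 ≡⟨ cubic v ⟩
    3                           ∎)
    where
    pointwise : ∀ a k → ind a * k + ind (not a) * k ≡ 1 * k
    pointwise true  k = ℕₚ.+-identityʳ _
    pointwise false k = refl

  deg-mono : ∀ {S T} → (∀ e → S e ≡ true → T e ≡ true) → ∀ v → deg S v ≤ deg T v
  deg-mono {S} {T} S⊆T v = sum-mono λ e → ℕₚ.*-monoˡ-≤ _ (pointwise (S e) (T e) (S⊆T e))
    where
    pointwise : ∀ a b → (a ≡ true → b ≡ true) → ind a ≤ ind b
    pointwise true  b h rewrite h refl = s≤s z≤n
    pointwise false b h = z≤n

  -- A T-join for the vertex set T given by `b`, confined to the 2-factor.
  Join : (Fin #V → Bool) → Set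
  Join b = Σ[ J ∈ (Fin #E → Bool) ] (∀ e → J e ≡ true → f e ≡ true) × (∀ w → odd (deg J w) ≡ b w)

  edge-degree : ∀ e w → deg (e ==_) w ≡ ind (end₁ e == w) + ind (end₂ e == w)
  edge-degree e w = sum-δ _ e

  join-edge : ∀ {x y u v} (J : Join (λ w → (u == w) xor (v == w))) e → f e ≡ true →
    (∀ w → (x == w) xor (y == w) ≡ (end₁ e == w) xor (end₂ e == w)) → y ≡ u → Join (λ w → (x == w) xor (v == w))
  join-edge {x} {y} {u} {v} (J , J⊆F , par) e fe ends refl =
      (λ e′ → (e == e′) xor J e′)
    , sub
    , λ w → trans (odd-sum-xor (e ==_) J _) (trans (cong₂ _xor_ (trans (cong odd (edge-degree e w))
        (trans (odd-+ (ind (end₁ e == w)) _) (trans (cong₂ _xor_ (odd-ind (end₁ e == w)) (odd-ind (end₂ e == w))) (sym (ends w))))) (par w))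
        (bools≡ 3 (λ a b d → (a xor b) xor (b xor d)) (λ a b d → a xor d) (x == w) (y == w) (v == w)))
    where
    sub : ∀ e′ → (e == e′) xor J e′ ≡ true → f e′ ≡ true
    sub e′ p with e ≟ e′
    ... | yes refl = fe
    ... | no _     = J⊆F e′ p

  path-join : ∀ {u v} → Connected G F u v → Join (λ w → (u == w) xor (v == w))
  path-join {u} Star.ε = (λ _ → false) , (λ e ()) , λ w → trans (cong odd (sum-zero {#E} λ _ → refl))
    (sym (xor-same (u == w)))
  path-join {v = v} (SC.fwd (e , e∈F , refl , refl) Star.◅ p) =
    join-edge {end₁ e} {end₂ e} {end₂ e} {v} (path-join p) e ([]=⇒lookup e∈F) (λ w → refl) refl
  path-join {v = v} (SC.bwd (e , e∈F , refl , refl) Star.◅ p) =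
    join-edge {end₂ e} {end₁ e} {end₁ e} {v} (path-join p) e ([]=⇒lookup e∈F) (λ w → xor-comm (end₂ e == w) (end₁ e == w)) refl

  -- Connect each marked vertex to the representative of its component.
  join : ∀ b → (∀ r → odd (size (λ v → b v ∧ comp r v)) ≡ false) → Join b
  join b even = J , sub , par
    where
    J′ : ∀ v → Join (λ w → (v == w) xor (rep v == w))
    J′ v = path-join (connected-rep v)
    J : Fin #E → Bool
    J e = odd (sum λ v → ind (b v) * ind (proj₁ (J′ v) e))
    sub : ∀ e → J e ≡ true → f e ≡ true
    sub e p with sum-positive (λ v → ind (b v) * ind (proj₁ (J′ v) e)) (positive _ p)
      where
      positive : ∀ n → odd n ≡ true → 0 < n
      positive (suc n) _ = s≤s z≤n
    ... | v , q with b v | proj₁ (J′ v) e in eq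
    ...   | true | true = proj₁ (proj₂ (J′ v)) e eq
    odd-ind-* : ∀ n k → odd (ind (odd n) * k) ≡ odd (n * k)
    odd-ind-* zero    k = refl
    odd-ind-* (suc n) k rewrite odd-+ k (n * k) | sym (odd-ind-* n k) with odd n | odd k in eq
    ... | true  | true  rewrite ℕₚ.+-identityʳ k | eq = refl
    ... | true  | false rewrite ℕₚ.+-identityʳ k | eq = refl
    ... | false | true  rewrite ℕₚ.+-identityʳ k | eq = refl
    ... | false | false rewrite ℕₚ.+-identityʳ k | eq = refl
    odd-* : ∀ x y z → odd y ≡ z → odd (ind x * y) ≡ odd (ind x * ind z)
    odd-* true  y z p = trans (cong odd (ℕₚ.+-identityʳ y)) (trans p (sym (trans (cong odd (ℕₚ.+-identityʳ (ind z))) (odd-ind z))))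
    odd-* false y z p = refl
    split : ∀ x a b → odd (ind x * ind (a xor b)) ≡ odd (ind a * ind x + ind (x ∧ b))
    split = bools≡ 3 (λ x a b → odd (ind x * ind (a xor b))) (λ x a b → odd (ind a * ind x + ind (x ∧ b)))
    par : ∀ w → odd (deg J w) ≡ b w
    par w = begin
      odd (deg J w)
        ≡⟨ odd-sum (λ e → odd-ind-* (sum λ v → ind (b v) * ind (proj₁ (J′ v) e)) (inc e)) ⟩
      odd (sum λ e → sum (λ v → ind (b v) * ind (proj₁ (J′ v) e)) * inc e)
        ≡⟨ cong odd (sum-cong-≗ λ e → trans (ℕₚ.*-comm _ (inc e)) (trans (sym (sum-*ˡ (inc e) _))
             (sum-cong-≗ λ v → trans (ℕₚ.*-comm (inc e) _) (ℕₚ.*-assoc (ind (b v)) _ _)))) ⟩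
      odd (sum λ e → sum λ v → ind (b v) * (ind (proj₁ (J′ v) e) * inc e))
        ≡⟨ cong odd (∑-comm _) ⟩
      odd (sum λ v → sum λ e → ind (b v) * (ind (proj₁ (J′ v) e) * inc e))
        ≡⟨ cong odd (sum-cong-≗ λ v → sum-*ˡ (ind (b v)) _) ⟩
      odd (sum λ v → ind (b v) * deg (proj₁ (J′ v)) w)
        ≡⟨ odd-sum (λ v → trans (odd-* (b v) _ _ (proj₂ (proj₂ (J′ v)) w))
             (trans (split (b v) (v == w) (rep v == w)) (cong (λ x → odd (ind x * ind (b v) + ind (b v ∧ comp w v))) (==-sym v w)))) ⟩
      odd (sum λ v → ind (w == v) * ind (b v) + ind (b v ∧ comp w v))
        ≡⟨ cong odd (sum-+ _ _) ⟩
      odd (sum (λ v → ind (w == v) * ind (b v)) + size (λ v → b v ∧ comp w v))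
        ≡⟨ odd-+ (sum λ v → ind (w == v) * ind (b v)) _ ⟩
      -- The first summand counts the paths starting at `w`, the second those ending there, which
      -- are even in number by hypothesis.
      odd (sum (λ v → ind (w == v) * ind (b v))) xor odd (size (λ v → b v ∧ comp w v))
        ≡⟨ cong₂ _xor_ (trans (cong odd (sum-δ (ind ∘ b) w)) (odd-ind (b w))) (even w) ⟩
      b w xor false
        ≡⟨ xor-identityʳ (b w) ⟩
      b w ∎
      where
      inc : Fin #E → ℕ
      inc e = ind (end₁ e == w) + ind (end₂ e == w)

  -- Matchings of the 2-factor

  Transversal : (Fin ω → Fin #V) → Set
  Transversal z = ∀ i → rep (z i) ≡ rep (c i)

  mark : (Fin ω → Fin #V) → Fin #V → ℕ
  mark z v = sum λ i → ind (z i == v)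

  record NearPerfect (z : Fin ω → Fin #V) : Set where
    field
      N      : Fin #E → Bool
      N⊆F    : ∀ e → N e ≡ true → f e ≡ true
      N-degree : ∀ v → deg N v + mark z v ≡ 1

  module _ {z : Fin ω → Fin #V} (tr : Transversal z) where

    z-injective : ∀ {i j} → z i ≡ z j → i ≡ j
    z-injective {i} {j} p = c-injective (trans (sym (tr i)) (trans (cong rep p) (tr j)))

    mark-z : ∀ i → mark z (z i) ≡ 1
    mark-z i = sum-unique (λ j → z j == z i) i (==-refl (z i)) λ j p → z-injective (sym (==-true p))

    mark-other : ∀ {v} → (∀ i → z i ≢ v) → mark z v ≡ 0
    mark-other h = sum-zero λ i → cong ind (==-≢ (h i))

    marked? : ∀ v → Dec (∃[ i ] z i ≡ v)
    marked? v = any? λ i → z i ≟ v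

  count-odd : ∀ r → odd (sum λ i → ind (rep (c i) == r)) ≡ odd (size (comp r))
  count-odd r with any? (λ i → rep (c i) ≟ r)
  ... | yes (i , refl) = trans (cong odd (sum-unique (λ j → rep (c j) == rep (c i)) i (==-refl (rep (c i)))
                           λ j p → c-injective (sym (==-true p)))) (sym (c-odd i))
  ... | no h with odd (size (comp r)) in eq
  ...   | true  = ⊥-elim (h (c-all r eq))
  ...   | false = cong odd (sum-zero λ i → cong ind (==-≢ λ p → h (i , p)))

  even-or-odd≤2 : ∀ n → n ≤ 2 → (odd n ≡ true × n ≡ 1) ⊎ (odd n ≡ false × (n ≡ 0 ⊎ n ≡ 2))
  even-or-odd≤2 0 _ = inj₂ (refl , inj₁ refl)
  even-or-odd≤2 1 _ = inj₁ (refl , refl)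
  even-or-odd≤2 2 _ = inj₂ (refl , inj₂ refl)
  even-or-odd≤2 (suc (suc (suc _))) (s≤s (s≤s ()))

  -- An odd circuit has one marked vertex and an even one has none, so every circuit has evenly many
  -- unmarked vertices and they admit a join. As F is 2-regular, the join has degree 1 at them and
  -- degree 0 or 2 at `z i`. Complementation along a circuit keeps degree 1 and turns degree 2 into
  -- 0.
  near-perfect′ : ∀ {z} → Transversal z → NearPerfect z
  near-perfect′ {z} tr = record { N = N ; N⊆F = λ e p → proj₁ (∧-true p) ; N-degree = N-degree }
    where
    b : Fin #V → Bool
    b v = not (odd (mark z v))

    even : ∀ r → odd (size (λ v → b v ∧ comp r v)) ≡ false
    even r = begin
      odd (size (λ v → b v ∧ comp r v))
        ≡⟨ odd-sum (λ v → pointwise (mark z v) (comp r v)) ⟩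
      odd (sum λ v → ind (comp r v) + ind (comp r v) * mark z v)
        ≡⟨ cong odd (sum-+ _ _) ⟩
      odd (size (comp r) + sum (λ v → ind (comp r v) * mark z v))
        ≡⟨ odd-+ (size (comp r)) _ ⟩
      odd (size (comp r)) xor odd (sum (λ v → ind (comp r v) * mark z v))
        ≡⟨ cong (λ x → odd (size (comp r)) xor odd x)
             (trans (sum-incidence z (λ v → ind (comp r v))) (sum-cong-≗ λ i → cong (λ x → ind (x == r)) (tr i))) ⟩
      odd (size (comp r)) xor odd (sum (λ i → ind (rep (c i) == r)))
        ≡⟨ cong (odd (size (comp r)) xor_) (count-odd r) ⟩
      odd (size (comp r)) xor odd (size (comp r))
        ≡⟨ xor-same (odd (size (comp r))) ⟩
      false ∎
      where
      pointwise : ∀ n x → odd (ind (not (odd n) ∧ x)) ≡ odd (ind x + ind x * n)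
      pointwise n true  rewrite ℕₚ.+-identityʳ n with odd n
      ... | true  = refl
      ... | false = refl
      pointwise n false with odd n
      ... | true  = refl
      ... | false = refl

    Jb = join b even
    J = proj₁ Jb

    -- Complementing the join on a circuit makes it miss z i.
    flag : Fin #V → Bool
    flag r = does (any? λ i → (rep (c i) == r) ∧ not (does (deg J (z i) ℕₚ.≟ 0)) ≟ᵇ true)

    N : Fin #E → Bool
    N e = f e ∧ (J e xor flag (rep (end₁ e)))

    incident : ∀ e v → f e ≡ true → (end₁ e == v) ∨ (end₂ e == v) ≡ true → rep (end₁ e) ≡ rep v
    incident e v fe p with end₁ e ≟ v | end₂ e ≟ v
    ... | yes refl | _        = refl
    ... | no _     | yes refl = rep-edge fe
    incident e v fe () | no _ | no _

    deg-N : ∀ v → deg N v ≡ deg (λ e → f e ∧ (J e xor flag (rep v))) v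
    deg-N v = sum-cong-≗ pointwise
      where
      pointwise : ∀ e → ind (N e) * (ind (end₁ e == v) + ind (end₂ e == v))
        ≡ ind (f e ∧ (J e xor flag (rep v))) * (ind (end₁ e == v) + ind (end₂ e == v))
      pointwise e with f e in fe | incident e v
      ... | false | _ = refl
      ... | true  | h with end₁ e == v | end₂ e == v
      ...   | true  | _     rewrite h refl refl = refl
      ...   | false | true  rewrite h refl refl = refl
      ...   | false | false = trans (ℕₚ.*-zeroʳ (ind (J e xor flag (rep (end₁ e))))) (sym (ℕₚ.*-zeroʳ (ind (J e xor flag (rep v)))))

    unflagged : ∀ v → flag (rep v) ≡ false → deg N v ≡ deg J v
    unflagged v p = trans (deg-N v) (trans (cong (λ b → deg (λ e → f e ∧ (J e xor b)) v) p)
      (sum-cong-≗ λ e → cong (λ b → ind b * _) (pointwise (f e) (J e) (proj₁ (proj₂ Jb) e))))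
      where
      pointwise : ∀ a b → (b ≡ true → a ≡ true) → a ∧ (b xor false) ≡ b
      pointwise true  true  h = refl
      pointwise true  false h = refl
      pointwise false true  h = h refl
      pointwise false false h = refl

    flagged : ∀ v → flag (rep v) ≡ true → deg N v + deg J v ≡ 2
    flagged v p = trans (cong (_+ deg J v) (trans (deg-N v) (cong (λ b → deg (λ e → f e ∧ (J e xor b)) v) p)))
      (trans (sym (sum-+ _ _)) (trans (sum-cong-≗ λ e → pointwise (f e) (J e) _ (proj₁ (proj₂ Jb) e)) (two-factor v)))
      where
      pointwise : ∀ a b k → (b ≡ true → a ≡ true) → ind (a ∧ (b xor true)) * k + ind b * k ≡ ind a * k
      pointwise true  true  k h = refl
      pointwise true  false k h = ℕₚ.+-identityʳ _
      pointwise false true  k h = case h refl of λ ()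
      pointwise false false k h = refl

    flag-z : ∀ i → flag (rep (z i)) ≡ not (does (deg J (z i) ℕₚ.≟ 0))
    flag-z i with any? (λ j → (rep (c j) == rep (z i)) ∧ not (does (deg J (z j) ℕₚ.≟ 0)) ≟ᵇ true)
    ... | yes (j , p) with ∧-true {rep (c j) == rep (z i)} p
    ...   | q , r = sym (trans (cong (λ k → not (does (deg J (z k) ℕₚ.≟ 0))) (c-injective (trans (sym (tr i)) (sym (==-true q))))) r)
    flag-z i | no h with not (does (deg J (z i) ℕₚ.≟ 0)) in eq
    ...   | false = refl
    ...   | true  = ⊥-elim (h (i , cong₂ _∧_ (trans (cong (_== rep (z i)) (sym (tr i))) (==-refl (rep (z i)))) eq))

    J≤2 : ∀ v → deg J v ≤ 2
    J≤2 v = subst (deg J v ≤_) (two-factor v) (deg-mono (proj₁ (proj₂ Jb)) v)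

    N-degree : ∀ v → deg N v + mark z v ≡ 1
    N-degree v with marked? tr v
    ... | yes (i , refl) rewrite mark-z tr i = cong (_+ 1) zero-degree
      where
      zero-degree : deg N (z i) ≡ 0
      zero-degree with even-or-odd≤2 (deg J (z i)) (J≤2 (z i))
      ... | inj₁ (p , _) = case trans (sym p) (trans (proj₂ (proj₂ Jb) (z i)) (cong (λ n → not (odd n)) (mark-z tr i))) of λ ()
      ... | inj₂ (_ , inj₁ q) = trans (unflagged (z i) (trans (flag-z i) (cong (λ n → not (does (n ℕₚ.≟ 0))) q))) q
      ... | inj₂ (_ , inj₂ q) = ℕₚ.+-cancelʳ-≡ 2 _ 0
        (trans (cong (deg N (z i) +_) (sym q)) (flagged (z i) (trans (flag-z i) (cong (λ n → not (does (n ℕₚ.≟ 0))) q))))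
    ... | no h rewrite mark-other tr (λ i p → h (i , p)) = trans (ℕₚ.+-identityʳ _) one
      where
      one : deg N v ≡ 1
      one with even-or-odd≤2 (deg J v) (J≤2 v)
      ... | inj₂ (p , _) = case trans (sym p) (trans (proj₂ (proj₂ Jb) v) (cong (λ n → not (odd n)) (mark-other tr (λ i p → h (i , p))))) of λ ()
      ... | inj₁ (_ , q) with flag (rep v) in eq
      ...   | false = trans (unflagged v eq) q
      ...   | true  = ℕₚ.+-cancelʳ-≡ 1 _ 1 (trans (cong (deg N v +_) (sym q)) (flagged v eq))

  abstract
    near-perfect : ∀ {z} → Transversal z → NearPerfect z
    near-perfect = near-perfect′

-- The involution of a matching

module Partner (G : Graph) (S : Fin (Graph.#E G) → Bool) (deg≤1 : ∀ v → Cuts.deg G S v ≤ 1) where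
  open Graph G
  open Cuts G

  incidence : Fin #V → Fin #E → ℕ
  incidence v e = ind (S e) * (ind (end₁ e == v) + ind (end₂ e == v))

  incident-unique : ∀ {v e e′} → 0 < incidence v e → 0 < incidence v e′ → e ≡ e′
  incident-unique {v} {e} {e′} p q with e ≟ e′
  ... | yes r = r
  ... | no r  = ⊥-elim (ℕₚ.<⇒≱ {1} {2} (s≤s (s≤s z≤n))
                  (≤-trans (+-mono-≤ p q) (≤-trans (two-terms≤sum (incidence v) r) (deg≤1 v))))

  incidence₁ : ∀ {e} → S e ≡ true → 0 < incidence (end₁ e) e
  incidence₁ {e} p rewrite p | ==-refl (end₁ e) = s≤s z≤n

  incidence₂ : ∀ {e} → S e ≡ true → 0 < incidence (end₂ e) e
  incidence₂ {e} p rewrite p | ==-refl (end₂ e) = subst (λ x → 0 < x + 0) (ℕₚ.+-comm 1 (ind (end₁ e == end₂ e))) (s≤s z≤n)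

  loopless : ∀ {e} → S e ≡ true → end₁ e ≢ end₂ e
  loopless {e} p q = ℕₚ.<⇒≱ {1} {2} (s≤s (s≤s z≤n)) (≤-trans two (≤-trans (term≤sum (incidence (end₁ e)) e) (deg≤1 (end₁ e))))
    where
    two : 2 ≤ incidence (end₁ e) e
    two rewrite p | ==-refl (end₁ e) | sym q | ==-refl (end₁ e) = s≤s (s≤s z≤n)

  matched? : ∀ v → Dec (∃[ e ] 0 < incidence v e)
  matched? v = any? λ e → 0 ℕₚ.<? incidence v e

  partner : Fin #V → Fin #V
  partner v with matched? v
  ... | yes (e , _) = if end₁ e == v then end₂ e else end₁ e
  ... | no _        = v

  partner₁ : ∀ {e} → S e ≡ true → partner (end₁ e) ≡ end₂ e
  partner₁ {e} p with matched? (end₁ e)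
  ... | no h = ⊥-elim (h (e , incidence₁ p))
  ... | yes (e′ , q) with incident-unique {end₁ e} {e′} {e} q (incidence₁ p)
  ...   | refl rewrite ==-refl (end₁ e) = refl

  partner₂ : ∀ {e} → S e ≡ true → partner (end₂ e) ≡ end₁ e
  partner₂ {e} p with matched? (end₂ e)
  ... | no h = ⊥-elim (h (e , incidence₂ p))
  ... | yes (e′ , q) with incident-unique {end₂ e} {e′} {e} q (incidence₂ p)
  ...   | refl rewrite ==-≢ (loopless p) = refl

  data Matched (v : Fin #V) : Set where
    first  : ∀ e → S e ≡ true → end₁ e ≡ v → Matched v
    second : ∀ e → S e ≡ true → end₂ e ≡ v → Matched v
    free   : deg S v ≡ 0 → partner v ≡ v → Matched v

  unmatched : ∀ {v} → ¬ (∃[ e ] 0 < incidence v e) → partner v ≡ v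
  unmatched {v} h with matched? v
  ... | yes p = ⊥-elim (h p)
  ... | no _  = refl

  incident-end : ∀ {v e} → 0 < incidence v e → S e ≡ true × (end₁ e ≡ v ⊎ end₂ e ≡ v)
  incident-end {v} {e} q with S e | end₁ e ≟ v | end₂ e ≟ v
  ... | true | yes p | _     = refl , inj₁ p
  ... | true | no _  | yes p = refl , inj₂ p
  incident-end () | true  | no _ | no _
  incident-end () | false | _    | _

  matched : ∀ v → Matched v
  matched v with matched? v
  ... | no h = free (sum-zero λ e → ℕₚ.n≤0⇒n≡0 (ℕₚ.≮⇒≥ λ p → h (e , p))) (unmatched h)
  ... | yes (e , q) with incident-end q
  ...   | Se , inj₁ p = first e Se p
  ...   | Se , inj₂ p = second e Se p

  partner-involutive : Involutive partner
  partner-involutive v with matched v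
  ... | first e Se refl = trans (cong partner (partner₁ Se)) (partner₂ Se)
  ... | second e Se refl = trans (cong partner (partner₂ Se)) (partner₁ Se)
  ... | free _ p = trans (cong partner p) p

-- Colourings that alternate along both matchings

module Signings (𝒮 : Setting) where
  open Setting 𝒮
  open Joins 𝒮

  Alternating : (Fin #V → Bool) → (Fin #E → Bool) → Set
  Alternating s S = ∀ e → S e ≡ true → s (end₂ e) ≡ not (s (end₁ e))

  module _ {z : Fin ω → Fin #V} (tr : Transversal z) (P : NearPerfect z) where
    open NearPerfect P

    N≤1 : ∀ v → deg N v ≤ 1
    N≤1 v = subst (deg N v ≤_) (N-degree v) (ℕₚ.m≤m+n _ _)

    module μ = Partner G M (λ v → ≤-reflexive (M-degree v))
    module ν = Partner G N N≤1

    z-free : ∀ i → deg N (z i) ≡ 0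
    z-free i = ℕₚ.+-cancelʳ-≡ 1 _ 0 (trans (cong (deg N (z i) +_) (sym (mark-z tr i))) (N-degree (z i)))

    -- The vertices `z i` are free in N, so virtual edges between `z i` and `z (τ i)` may be added
    -- to N; they force opposite signs on the chosen pairs.
    ν⁺ : (Fin ω → Fin ω) → Fin #V → Fin #V
    ν⁺ τ v with marked? tr v
    ... | yes (i , _) = z (τ i)
    ... | no _        = ν.partner v

    ν⁺-z : ∀ τ i → ν⁺ τ (z i) ≡ z (τ i)
    ν⁺-z τ i with marked? tr (z i)
    ... | yes (j , p) = cong (z ∘ τ) (z-injective tr p)
    ... | no h        = ⊥-elim (h (i , refl))

    ν⁺-other : ∀ τ {v} → (∀ i → z i ≢ v) → ν⁺ τ v ≡ ν.partner v
    ν⁺-other τ {v} h with marked? tr v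
    ... | yes (i , p) = ⊥-elim (h i p)
    ... | no _        = refl

    unmarked : ∀ {v} → 0 < deg N v → ∀ i → z i ≢ v
    unmarked p i refl = ℕₚ.<-irrefl (sym (z-free i)) p

    N-positive : ∀ {v e} → 0 < ν.incidence v e → 0 < deg N v
    N-positive {v} {e} p = ≤-trans p (term≤sum (ν.incidence v) e)

    ν⁺-involutive : ∀ {τ} → (∀ i → τ (τ i) ≡ i) → Involutive (ν⁺ τ)
    ν⁺-involutive {τ} inv v with marked? tr v
    ... | yes (i , refl) = trans (ν⁺-z τ (τ i)) (cong z (inv i))
    ... | no h with ν.matched v
    ...   | ν.first e Ne refl  = trans (ν⁺-other τ (subst (λ x → ∀ i → z i ≢ x) (sym (ν.partner₁ Ne)) (unmarked (N-positive (ν.incidence₂ Ne)))))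
                                  (ν.partner-involutive (end₁ e))
    ...   | ν.second e Ne refl = trans (ν⁺-other τ (subst (λ x → ∀ i → z i ≢ x) (sym (ν.partner₂ Ne)) (unmarked (N-positive (ν.incidence₁ Ne)))))
                                  (ν.partner-involutive (end₂ e))
    ...   | ν.free _ p         = trans (cong (ν⁺ τ) p) (trans (ν⁺-other τ (λ i q → h (i , q))) p)

    μ-fixed-point-free : ∀ v → μ.partner v ≢ v
    μ-fixed-point-free v p with μ.matched v
    ... | μ.first e Me refl  = μ.loopless Me (trans (sym p) (μ.partner₁ Me))
    ... | μ.second e Me refl = μ.loopless Me (trans (sym (μ.partner₂ Me)) p)
    ... | μ.free q _         = case trans (sym q) (M-degree v) of λ ()

    signing′ : ∀ (τ : Fin ω → Fin ω) → (∀ i → τ (τ i) ≡ i) → Σ[ s ∈ (Fin #V → Bool) ]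
      Alternating s M × Alternating s N × (∀ i → τ i ≢ i → s (z (τ i)) ≡ not (s (z i)))
    signing′ τ inv =
      let s , alt , altν = two-colouring μ.partner (ν⁺ τ) μ.partner-involutive μ-fixed-point-free (ν⁺-involutive inv)
      in s , (λ e Me → trans (cong s (sym (μ.partner₁ Me))) (alt (end₁ e)))
           , (λ e Ne → let ν⁺≡ = trans (ν⁺-other τ (unmarked (N-positive (ν.incidence₁ Ne)))) (ν.partner₁ Ne) in
               trans (cong s (sym ν⁺≡)) (altν (end₁ e) λ p → ν.loopless Ne (trans (sym p) ν⁺≡)))
           , (λ i p → trans (cong s (sym (ν⁺-z τ i))) (altν (z i) λ q → p (z-injective tr (trans (sym (ν⁺-z τ i)) q))))

    abstract
      signing : ∀ (τ : Fin ω → Fin ω) → (∀ i → τ (τ i) ≡ i) → Σ[ s ∈ (Fin #V → Bool) ]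
        Alternating s M × Alternating s N × (∀ i → τ i ≢ i → s (z (τ i)) ≡ not (s (z i)))
      signing = signing′

-- Arithmetic of a violated cut

one-surplus : ∀ D i j c n → D + 3 * (i + j + c) < 3 → 0 < D → 1 + n ≡ D + j → odd (n + c) ≡ false →
  D ≡ 1 × i ≡ 0 × c ≡ 0 × n ≡ 0
one-surplus D zero zero zero n h _ p q with ℕₚ.<⇒<ᵇ h
one-surplus 1 zero zero zero 0 h _ p q | _ = refl , refl , refl , refl
one-surplus 2 zero zero zero 1 h _ refl () | _
one-surplus (suc (suc (suc D))) zero zero zero n h _ p q | ()
one-surplus D zero zero (suc c) n h _ p q = ⊥-elim (ℕₚ.<-irrefl refl
  (linear (D ∷ c ∷ []) ((‵ 1 ⊕ (x₀ ⊕ 3 ⊗ (‵ 1 ⊕ x₁)) ≼ ‵ 3) ∷ []) (‵ 1 ≼ ‵ 0) 0 (1 ∷ []) (h ∷ [])))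
one-surplus D zero (suc j) c n h _ p q = ⊥-elim (ℕₚ.<-irrefl refl
  (linear (D ∷ j ∷ c ∷ []) ((‵ 1 ⊕ (x₀ ⊕ 3 ⊗ (‵ 1 ⊕ x₁ ⊕ x₂)) ≼ ‵ 3) ∷ []) (‵ 1 ≼ ‵ 0) 0 (1 ∷ []) (h ∷ [])))
one-surplus D (suc i) j c n h _ p q = ⊥-elim (ℕₚ.<-irrefl refl
  (linear (D ∷ i ∷ j ∷ c ∷ []) ((‵ 1 ⊕ (x₀ ⊕ 3 ⊗ (‵ 1 ⊕ x₁ ⊕ x₂ ⊕ x₃)) ≼ ‵ 3) ∷ []) (‵ 1 ≼ ‵ 0) 0 (1 ∷ []) (h ∷ [])))

-- As in `one-surplus`, D is the surplus of positive vertices, i and j are the slacks of the counts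
-- along M and N, and n and c number the boundary edges in N and in F outside N. The inequality
-- leaves finitely many values, most of them excluded by parity; D = 4 with n = 2 is the only
-- survivor whose cut meets F.
two-surplus : ∀ D i j c n → D + 3 * (i + j + c) < 6 → 0 < D → 2 + n ≡ D + j → odd (n + c) ≡ false → odd (D + i) ≡ odd n →
  i ≡ 0 × c ≡ 0 × (D ≡ 2 × n ≡ 0 ⊎ D ≡ 4 × n ≡ 2)
two-surplus D zero zero zero n h _ p q r with ℕₚ.<⇒<ᵇ h
two-surplus 1 zero zero zero n h _ () q r | _
two-surplus 2 zero zero zero 0 h _ p q r | _ = refl , refl , inj₁ (refl , refl)
two-surplus 3 zero zero zero 1 h _ refl () r | _
two-surplus 4 zero zero zero 2 h _ p q r | _ = refl , refl , inj₂ (refl , refl)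
two-surplus 5 zero zero zero 3 h _ refl () r | _
two-surplus (suc (suc (suc (suc (suc (suc D)))))) zero zero zero n h _ p q r | ()
two-surplus D zero zero (suc zero) n h _ p q r with ℕₚ.<⇒<ᵇ (linear {1} (D ∷ []) ((‵ 1 ⊕ (x₀ ⊕ ‵ 3) ≼ ‵ 6) ∷ []) (‵ 1 ⊕ x₀ ≼ ‵ 3) 0 (1 ∷ []) (h ∷ []))
two-surplus 1 zero zero (suc zero) n h _ () q r | _
two-surplus 2 zero zero (suc zero) 0 h _ refl () r | _
two-surplus (suc (suc (suc D))) zero zero (suc zero) n h _ p q r | ()
two-surplus D zero zero (suc (suc c)) n h _ p q r = ⊥-elim (ℕₚ.<-irrefl refl
  (linear (D ∷ c ∷ []) ((‵ 1 ⊕ (x₀ ⊕ 3 ⊗ (‵ 2 ⊕ x₁)) ≼ ‵ 6) ∷ []) (‵ 1 ≼ ‵ 0) 0 (1 ∷ []) (h ∷ [])))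
two-surplus D zero (suc zero) c n h _ p q r with ℕₚ.<⇒<ᵇ (linear {2} (D ∷ c ∷ []) ((‵ 1 ⊕ (x₀ ⊕ 3 ⊗ (‵ 1 ⊕ x₁)) ≼ ‵ 6) ∷ []) (‵ 1 ⊕ x₀ ≼ ‵ 3) 0 (1 ∷ []) (h ∷ []))
two-surplus 1 zero (suc zero) c 0 h _ refl q () | _
two-surplus 2 zero (suc zero) c 1 h _ refl q () | _
two-surplus (suc (suc (suc D))) zero (suc zero) c n h _ p q r | ()
two-surplus D zero (suc (suc j)) c n h _ p q r = ⊥-elim (ℕₚ.<-irrefl refl
  (linear (D ∷ j ∷ c ∷ []) ((‵ 1 ⊕ (x₀ ⊕ 3 ⊗ (‵ 2 ⊕ x₁ ⊕ x₂)) ≼ ‵ 6) ∷ []) (‵ 1 ≼ ‵ 0) 0 (1 ∷ []) (h ∷ [])))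
two-surplus D (suc zero) zero c n h _ p q r with ℕₚ.<⇒<ᵇ (linear {2} (D ∷ c ∷ []) ((‵ 1 ⊕ (x₀ ⊕ 3 ⊗ (‵ 1 ⊕ x₁)) ≼ ‵ 6) ∷ []) (‵ 1 ⊕ x₀ ≼ ‵ 3) 0 (1 ∷ []) (h ∷ []))
two-surplus 1 (suc zero) zero c n h _ () q r | _
two-surplus 2 (suc zero) zero c 0 h _ refl q () | _
two-surplus (suc (suc (suc D))) (suc zero) zero c n h _ p q r | ()
two-surplus D (suc zero) (suc j) c n h _ p q r = ⊥-elim (ℕₚ.<-irrefl refl
  (linear (D ∷ j ∷ c ∷ []) ((‵ 1 ⊕ (x₀ ⊕ 3 ⊗ (‵ 1 ⊕ (‵ 1 ⊕ x₁) ⊕ x₂)) ≼ ‵ 6) ∷ []) (‵ 1 ≼ ‵ 0) 0 (1 ∷ []) (h ∷ [])))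
two-surplus D (suc (suc i)) j c n h _ p q r = ⊥-elim (ℕₚ.<-irrefl refl
  (linear (D ∷ i ∷ j ∷ c ∷ []) ((‵ 1 ⊕ (x₀ ⊕ 3 ⊗ (‵ 2 ⊕ x₁ ⊕ x₂ ⊕ x₃)) ≼ ‵ 6) ∷ []) (‵ 1 ≼ ‵ 0) 0 (1 ∷ []) (h ∷ [])))

-- For a set X, a and b count its positive and negative vertices, m, n and k its boundary edges in
-- M, in N and in the rest of F, and `z⁺`, `z⁻` the positive and negative `z i` in X.
module Surplus (a b m n k z⁺ z⁻ : ℕ)
  (violated : 5 * b + 3 * (m + (n + k)) < 5 * a) (M-bound : a ≤ b + m) (N-bound : a + z⁻ ≤ b + n + z⁺)
  (z⁺≤2 : z⁺ ≤ 2) (F-even : odd (n + k) ≡ false) (M-parity : odd m ≡ odd n xor odd (z⁺ + z⁻)) where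

  -- Otherwise both matchings bound a - b, by m and by n, so that 3 (m + n) ≥ 6 (a - b), against the
  -- violation.
  surplus : z⁻ < z⁺
  surplus = ℕₚ.≰⇒> λ z⁺≤z⁻ → ℕₚ.<-irrefl refl (linear (a ∷ b ∷ m ∷ n ∷ k ∷ z⁺ ∷ z⁻ ∷ [])
    ((‵ 1 ⊕ (5 ⊗ x₁ ⊕ 3 ⊗ (x₂ ⊕ (x₃ ⊕ x₄))) ≼ 5 ⊗ x₀) ∷ (x₀ ≼ x₁ ⊕ x₂) ∷ (x₀ ⊕ x₆ ≼ x₁ ⊕ x₃ ⊕ x₅) ∷ (x₅ ≼ x₆) ∷ [])
    (‵ 1 ≼ ‵ 0) 0 (6 ∷ 15 ∷ 15 ∷ 15 ∷ []) (violated ∷ M-bound ∷ N-bound ∷ z⁺≤z⁻ ∷ []))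

  Outcome : Set
  Outcome = (n ≡ 0 × k ≡ 0 × m ≤ 5) ⊎ (z⁺ ≡ 2 + z⁻ × k ≡ 0 × m ≡ 4 × n ≡ 2 × a ≡ b + 4)

  module _ (D i : ℕ) (b+D≡a : b + D ≡ a) (D+i≡m : D + i ≡ m) where

    D>0 : 0 < D
    D>0 = positive (linear (a ∷ b ∷ m ∷ n ∷ k ∷ D ∷ []) ((‵ 1 ⊕ (5 ⊗ x₁ ⊕ 3 ⊗ (x₂ ⊕ (x₃ ⊕ x₄))) ≼ 5 ⊗ x₀) ∷ (x₀ ≼ x₁ ⊕ x₅) ∷ [])
      (‵ 1 ≼ 5 ⊗ x₅) 0 (1 ∷ 5 ∷ []) (violated ∷ ≤-reflexive (sym b+D≡a) ∷ []))
      where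
      positive : ∀ {d} → 1 ≤ 5 * d → 0 < d
      positive {suc d} _ = s≤s z≤n

    D≤ : ∀ t → z⁺ ≡ t + z⁻ → D ≤ t + n
    D≤ t p = linear (a ∷ b ∷ n ∷ z⁺ ∷ z⁻ ∷ D ∷ t ∷ [])
      ((x₀ ⊕ x₄ ≼ x₁ ⊕ x₂ ⊕ x₃) ∷ (x₁ ⊕ x₅ ≼ x₀) ∷ (x₃ ≼ x₆ ⊕ x₄) ∷ []) (x₅ ≼ x₆ ⊕ x₂) 0 (1 ∷ 1 ∷ 1 ∷ [])
      (N-bound ∷ ≤-reflexive b+D≡a ∷ ≤-reflexive p ∷ [])

    -- Substitute m = D + i and n = D + j - t into 3 (m + n + k) < 5 D.
    bound : ∀ t j → D + j ≡ t + n → D + 3 * (i + j + k) < 3 * t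
    bound t j p = linear (a ∷ b ∷ m ∷ n ∷ k ∷ D ∷ i ∷ j ∷ t ∷ [])
      ((‵ 1 ⊕ (5 ⊗ x₁ ⊕ 3 ⊗ (x₂ ⊕ (x₃ ⊕ x₄))) ≼ 5 ⊗ x₀) ∷ (x₀ ≼ x₁ ⊕ x₅) ∷ (x₅ ⊕ x₆ ≼ x₂) ∷ (x₅ ⊕ x₇ ≼ x₈ ⊕ x₃) ∷ [])
      (‵ 1 ⊕ (x₅ ⊕ 3 ⊗ (x₆ ⊕ x₇ ⊕ x₄)) ≼ 3 ⊗ x₈) 0 (1 ∷ 5 ∷ 3 ∷ 3 ∷ [])
      (violated ∷ ≤-reflexive (sym b+D≡a) ∷ ≤-reflexive D+i≡m ∷ ≤-reflexive p ∷ [])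

    one : z⁺ ≡ 1 + z⁻ → Outcome
    one p with ℕₚ.m≤n⇒∃[o]m+o≡n (D≤ 1 p)
    ... | j , q with one-surplus D i j k n (bound 1 j q) D>0 (sym q) F-even
    ...   | D≡1 , i≡0 , k≡0 , n≡0 = inj₁ (n≡0 , k≡0 , subst (_≤ 5) (trans (sym (cong₂ _+_ D≡1 i≡0)) D+i≡m) (s≤s z≤n))

    parity : z⁺ ≡ 2 + z⁻ → odd (D + i) ≡ odd n
    parity p = trans (cong odd D+i≡m) (trans M-parity (trans (cong (odd n xor_) even-z)
      (xor-identityʳ (odd n))))
      where
      even-z : odd (z⁺ + z⁻) ≡ false
      even-z = trans (cong (λ t → odd (t + z⁻)) p)
        (trans (not-involutive (odd (z⁻ + z⁻))) (odd-double z⁻))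

    two : z⁺ ≡ 2 + z⁻ → Outcome
    two p with ℕₚ.m≤n⇒∃[o]m+o≡n (D≤ 2 p)
    ... | j , q with two-surplus D i j k n (bound 2 j q) D>0 (sym q) F-even (parity p)
    ...   | i≡0 , k≡0 , inj₁ (D≡2 , n≡0) = inj₁ (n≡0 , k≡0 , subst (_≤ 5) (trans (sym (cong₂ _+_ D≡2 i≡0)) D+i≡m) (s≤s (s≤s z≤n)))
    ...   | i≡0 , k≡0 , inj₂ (D≡4 , n≡2) = inj₂ (p , k≡0 , trans (sym D+i≡m) (cong₂ _+_ D≡4 i≡0) , n≡2 ,
              trans (sym b+D≡a) (cong (b +_) D≡4))

  outcome : Outcome
  outcome with ℕₚ.m≤n⇒∃[o]m+o≡n b≤a
    where
    b≤a : b ≤ a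
    b≤a = linear (a ∷ b ∷ m ∷ n ∷ k ∷ []) ((‵ 1 ⊕ (5 ⊗ x₁ ⊕ 3 ⊗ (x₂ ⊕ (x₃ ⊕ x₄))) ≼ 5 ⊗ x₀) ∷ []) (x₁ ≼ x₀) 4 (1 ∷ []) (violated ∷ [])
  ... | D , b+D≡a with ℕₚ.m≤n⇒∃[o]m+o≡n D≤m
    where
    D≤m : D ≤ m
    D≤m = linear (a ∷ b ∷ m ∷ D ∷ []) ((x₀ ≼ x₁ ⊕ x₂) ∷ (x₁ ⊕ x₃ ≼ x₀) ∷ []) (x₃ ≼ x₂) 0 (1 ∷ 1 ∷ []) (M-bound ∷ ≤-reflexive b+D≡a ∷ [])
  ...   | i , D+i≡m with ℕₚ.m≤n⇒∃[o]m+o≡n surplus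
  ...     | zero , q        = one D i b+D≡a D+i≡m (trans (sym q) (cong suc (ℕₚ.+-identityʳ z⁻)))
  ...     | suc zero , q    = two D i b+D≡a D+i≡m (trans (sym q) (cong suc (ℕₚ.+-comm z⁻ 1)))
  ...     | suc (suc t) , q = ⊥-elim (ℕₚ.<-irrefl refl (linear (z⁺ ∷ z⁻ ∷ t ∷ []) ((x₀ ≼ ‵ 2) ∷ (‵ 1 ⊕ x₁ ⊕ (‵ 2 ⊕ x₂) ≼ x₀) ∷ [])
                                (‵ 1 ≼ ‵ 0) 0 (1 ∷ 1 ∷ []) (z⁺≤2 ∷ ≤-reflexive q ∷ [])))

-- Sets that violate the balance condition

module BadCuts (𝒮 : Setting) where
  open Setting 𝒮
  open Joins 𝒮
  open Signings 𝒮

  private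
    _⟪_ : (Fin #V → Bool) → (Fin #V → Bool) → Fin #V → Bool
    (X ⟪ s) v = X v ∧ s v

  neg : (Fin #V → Bool) → Fin #V → Bool
  neg s v = not (s v)

  odd-cut : ∀ S X → odd (cut S X) ≡ odd (sum λ v → ind (X v) * deg S v)
  odd-cut S X = trans (odd-sum λ e → pointwise (S e) (X (end₁ e)) (X (end₂ e))) (cong odd (sym (handshake S (ind ∘ X))))
    where
    pointwise : ∀ s a b → odd (ind (s ∧ (a xor b))) ≡ odd (ind s * (ind a + ind b))
    pointwise = bools≡ 3 (λ s a b → odd (ind (s ∧ (a xor b)))) (λ s a b → odd (ind s * (ind a + ind b)))

  cut-F-even : ∀ X → odd (cut f X) ≡ false
  cut-F-even X = trans (odd-cut f X) (trans (cong odd (trans (sum-cong-≗ λ v → trans (cong (ind (X v) *_) (two-factor v))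
    (ℕₚ.*-comm (ind (X v)) 2)) (sum-*ˡ 2 (ind ∘ X)))) (trans (cong odd (cong (size X +_) (ℕₚ.+-identityʳ (size X)))) (odd-double (size X))))

  cut-split : ∀ X → cut every X ≡ cut M X + cut f X
  cut-split X = trans (sum-cong-≗ λ e → pointwise (f e) (cross X e)) (sum-+ _ _)
    where
    pointwise : ∀ a b → ind b ≡ ind (not a ∧ b) + ind (a ∧ b)
    pointwise true  b = refl
    pointwise false b = sym (ℕₚ.+-identityʳ _)

  cut-positive : ∀ S X {e} → S e ≡ true → cross X e ≡ true → 0 < cut S X
  cut-positive S X {e} p q = ≤-trans (≤-reflexive (sym (cong₂ (λ a b → ind (a ∧ b)) p q))) (term≤sum (λ e → ind (S e ∧ cross X e)) e)

  not-crossing : ∀ S X → cut S X ≡ 0 → ∀ {e} → S e ≡ true → cross X e ≡ false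
  not-crossing S X p {e} Se with cross X e in eq
  ... | false = refl
  ... | true  = ⊥-elim (ℕₚ.<-irrefl (sym p) (cut-positive S X Se eq))

  cross-false : ∀ X {e} → cross X e ≡ false → X (end₁ e) ≡ X (end₂ e)
  cross-false X {e} p with X (end₁ e) | X (end₂ e)
  ... | true  | true  = refl
  ... | false | false = refl

  respects : ∀ {A : Set} (X : Fin #V → A) → (∀ {e} → f e ≡ true → X (end₁ e) ≡ X (end₂ e)) → ∀ {u v} → rep u ≡ rep v → X u ≡ X v
  respects X h p = Eq.gfold isEquivalence X (λ where (e , e∈F , refl , refl) → h ([]=⇒lookup e∈F)) (rep⇒connected p)

  uncrossed : ∀ X → cut f X ≡ 0 → ∀ {u v} → rep u ≡ rep v → X u ≡ X v
  uncrossed X p = respects X λ fe → cross-false X (not-crossing f X p fe)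

  signed : (Fin #E → Bool) → (Fin #V → Bool) → (Fin #V → Bool) → Fin #E → ℕ
  signed S X s e = ind (S e) * (ind (X (end₁ e) ∧ s (end₁ e)) + ind (X (end₂ e) ∧ s (end₂ e)))

  -- The ends of an S-edge have opposite signs: inside X they cancel, and across the boundary at
  -- most one positive end remains.
  signed≤ : ∀ {S s} X → Alternating s S → ∀ e → signed S X s e ≤ signed S X (neg s) e + ind (S e ∧ cross X e)
  signed≤ {S} {s} X alt e with S e in Se
  ... | false = z≤n
  ... | true rewrite alt e Se = bools≤ 3
        (λ a b t → 1 * (ind (a ∧ t) + ind (b ∧ not t)))
        (λ a b t → 1 * (ind (a ∧ not t) + ind (b ∧ not (not t))) + ind (a xor b)) (X (end₁ e)) (X (end₂ e)) (s (end₁ e))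

  Alternating-neg : ∀ {S s} → Alternating s S → Alternating (neg s) S
  Alternating-neg alt e Se = cong not (alt e Se)

  neg-neg : ∀ (X s : Fin #V → Bool) v → ind (X v ∧ neg (neg s) v) ≡ ind (X v ∧ s v)
  neg-neg X s v = cong ind (bools≡ 2 (λ x s → x ∧ not (not s)) _∧_ (X v) (s v))

  imbalance≤ : ∀ {S s} X → Alternating s S →
    sum (λ v → ind (X v ∧ s v) * deg S v) ≤ sum (λ v → ind (X v ∧ neg s v) * deg S v) + cut S X
  imbalance≤ {S} {s} X alt = subst₂ _≤_ (sym (handshake S (λ v → ind (X v ∧ s v))))
    (trans (sum-+ _ _) (cong (_+ cut S X) (sym (handshake S (λ v → ind (X v ∧ neg s v)))))) (sum-mono (signed≤ {S} {s} X alt))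

  size-unit : ∀ {S} (Y : Fin #V → Bool) → (∀ v → Y v ≡ true → deg S v ≡ 1) → sum (λ v → ind (Y v) * deg S v) ≡ size Y
  size-unit {S} Y h = sum-cong-≗ λ v → pointwise (Y v) (deg S v) (h v)
    where
    pointwise : ∀ y d → (y ≡ true → d ≡ 1) → ind y * d ≡ ind y
    pointwise true  d p = trans (ℕₚ.+-identityʳ d) (p refl)
    pointwise false d p = refl

  excess≤ : ∀ {S s} X → (∀ v → X v ≡ true → deg S v ≡ 1) → Alternating s S → size (X ⟪ s) ≤ size (X ⟪ neg s) + cut S X
  excess≤ {S} {s} X h alt = subst₂ (λ a b → a ≤ b + cut S X)
    (size-unit {S} (X ⟪ s) (λ v p → h v (proj₁ (∧-true p)))) (size-unit {S} (X ⟪ neg s) (λ v p → h v (proj₁ (∧-true p))))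
    (imbalance≤ {S} {s} X alt)

  excess≥ : ∀ {S s} X → (∀ v → X v ≡ true → deg S v ≡ 1) → Alternating s S → size (X ⟪ neg s) ≤ size (X ⟪ s) + cut S X
  excess≥ {S} {s} X h alt = subst (λ k → size (X ⟪ neg s) ≤ k + cut S X) (sum-cong-≗ (neg-neg X s)) (excess≤ {S} {neg s} X h (Alternating-neg {S} {s} alt))

  module _ {z : Fin ω → Fin #V} (tr : Transversal z) (P : NearPerfect z) where
    open NearPerfect P

    z-count : (Fin #V → Bool) → ℕ
    z-count Y = sum λ i → ind (Y (z i))

    N-degree-split : ∀ (Y : Fin #V → Bool) → sum (λ v → ind (Y v) * deg N v) + z-count Y ≡ size Y
    N-degree-split Y = trans (cong (sum (λ v → ind (Y v) * deg N v) +_) (sym (sum-incidence z (ind ∘ Y))))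
      (trans (sym (sum-+ _ _)) (sum-cong-≗ λ v → trans (sym (ℕₚ.*-distribˡ-+ (ind (Y v)) _ _))
        (trans (cong (ind (Y v) *_) (N-degree v)) (ℕₚ.*-identityʳ _))))

    N-excess≤ : ∀ {s} X → Alternating s N →
      size (X ⟪ s) + z-count (X ⟪ neg s) ≤ size (X ⟪ neg s) + cut N X + z-count (X ⟪ s)
    N-excess≤ {s} X alt = linear
      (size (X ⟪ s) ∷ size (X ⟪ neg s) ∷ cut N X ∷ z-count (X ⟪ s) ∷ z-count (X ⟪ neg s)
        ∷ sum (λ v → ind (X v ∧ s v) * deg N v) ∷ sum (λ v → ind (X v ∧ neg s v) * deg N v) ∷ [])
      ((x₅ ≼ x₆ ⊕ x₂) ∷ (x₀ ≼ x₅ ⊕ x₃) ∷ (x₆ ⊕ x₄ ≼ x₁) ∷ [])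
      (x₀ ⊕ x₄ ≼ x₁ ⊕ x₂ ⊕ x₃) 0 (1 ∷ 1 ∷ 1 ∷ [])
      (imbalance≤ {N} {s} X alt ∷ ≤-reflexive (sym (N-degree-split (X ⟪ s))) ∷ ≤-reflexive (N-degree-split (X ⟪ neg s)) ∷ [])

    Coloured : (Fin #V → Bool) → Set
    Coloured s = Alternating s M × Alternating s N

    -- The one extremal case left by the counts. Equality in them has local consequences: X contains
    -- exactly the positive `z i`, and every N-edge crossing X has its positive end inside and its
    -- negative end outside.
    record BadCut (s X : Fin #V → Bool) : Set where
      field
        four     : ω ≡ 4
        cut-M    : cut M X ≡ 4
        cut-N    : cut N X ≡ 2
        F⊆N      : ∀ {e} → f e ≡ true → cross X e ≡ true → N e ≡ true
        sides    : ∀ i → X (z i) ≡ s (z i)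
        tight    : ∀ {e} → N e ≡ true → cross X e ≡ true → X (end₁ e) ≡ s (end₁ e) × X (end₂ e) ≡ s (end₂ e)

    C : Fin #E → Bool
    C e = f e ∧ not (N e)

    cut-F-split : ∀ X → cut f X ≡ cut N X + cut C X
    cut-F-split X = trans (sum-cong-≗ λ e → pointwise (f e) (N e) (cross X e) (N⊆F e)) (sum-+ _ _)
      where
      pointwise : ∀ a b x → (b ≡ true → a ≡ true) → ind (a ∧ x) ≡ ind (b ∧ x) + ind ((a ∧ not b) ∧ x)
      pointwise true  true  x h = sym (ℕₚ.+-identityʳ _)
      pointwise true  false x h = refl
      pointwise false true  x h = case h refl of λ ()
      pointwise false false x h = refl

    module _ {s : Fin #V → Bool} (col : Coloured s) where

      private
        all : Fin #V → Bool
        all _ = true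
        no-cut : ∀ S → cut S all ≡ 0
        no-cut S = sum-zero λ e → cong ind (∧-zeroʳ (S e))

      neutral : size s ≡ size (neg s)
      neutral = ℕₚ.≤-antisym
        (subst (size s ≤_) (trans (cong (size (neg s) +_) (no-cut M)) (ℕₚ.+-identityʳ _)) (excess≤ {M} {s} all (λ v _ → M-degree v) (proj₁ col)))
        (subst (size (neg s) ≤_) (trans (cong (size s +_) (no-cut M)) (ℕₚ.+-identityʳ _)) (excess≥ {M} {s} all (λ v _ → M-degree v) (proj₁ col)))

      z-neutral : z-count s ≡ z-count (neg s)
      z-neutral = ℕₚ.≤-antisym
        (linear (size s ∷ size (neg s) ∷ z-count s ∷ z-count (neg s) ∷ cut N all ∷ [])
          ((x₁ ⊕ x₂ ≼ x₀ ⊕ x₄ ⊕ x₃) ∷ (x₀ ≼ x₁) ∷ (x₄ ≼ ‵ 0) ∷ []) (x₂ ≼ x₃) 0 (1 ∷ 1 ∷ 1 ∷ [])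
          ( subst₂ (λ a b → size (neg s) + a ≤ b + cut N all + z-count (neg s)) (sum-cong-≗ λ i → neg-neg all s (z i)) (sum-cong-≗ λ v → neg-neg all s v)
              (N-excess≤ {neg s} all (Alternating-neg {N} {s} (proj₂ col)))
          ∷ ≤-reflexive neutral ∷ ≤-reflexive (no-cut N) ∷ []))
        (linear (size s ∷ size (neg s) ∷ z-count s ∷ z-count (neg s) ∷ cut N all ∷ [])
          ((x₀ ⊕ x₃ ≼ x₁ ⊕ x₄ ⊕ x₂) ∷ (x₁ ≼ x₀) ∷ (x₄ ≼ ‵ 0) ∷ []) (x₃ ≼ x₂) 0 (1 ∷ 1 ∷ 1 ∷ [])
          (N-excess≤ {s} all (proj₂ col) ∷ ≤-reflexive (sym neutral) ∷ ≤-reflexive (no-cut N) ∷ []))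

      z-total : z-count s + z-count s ≡ ω
      z-total = trans (cong (z-count s +_) z-neutral) (trans (sym (sum-+ _ _))
        (trans (sum-cong-≗ λ i → pointwise (s (z i))) (sum-one ω)))
        where
        pointwise : ∀ b → ind b + ind (not b) ≡ 1
        pointwise true  = refl
        pointwise false = refl
        sum-one : ∀ n → sum {n} (λ _ → 1) ≡ n
        sum-one n = trans (sum-is-sum {n} (λ _ → 1)) (go n)
          where
          go : ∀ n → Σ.sum {n} (λ _ → 1) ≡ n
          go zero    = refl
          go (suc n) = cong suc (go n)

      z-total≤4 : z-count s + z-count s ≤ 4
      z-total≤4 = subst (_≤ 4) (sym z-total) ω≤4

      z⁺≤ : ∀ X → z-count (X ⟪ s) ≤ z-count s
      z⁺≤ X = sum-mono λ i → bools≤ 2 (λ a b → ind (a ∧ b)) (λ a b → ind b) (X (z i)) (s (z i))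

      -- The signs of all `z i` balance, so a set with a positive surplus of them contains one and
      -- misses another.
      z-separated : ∀ X → z-count (X ⟪ neg s) < z-count (X ⟪ s) → (∃[ i ] X (z i) ≡ true) × (∃[ j ] X (z j) ≡ false)
      z-separated X p = inside , outside
        where
        inside : ∃[ i ] X (z i) ≡ true
        inside with sum-positive (λ i → ind (X (z i) ∧ s (z i))) (≤-trans (s≤s z≤n) p)
        ... | i , q with X (z i) in eq
        ...   | true = i , eq
        outside : ∃[ j ] X (z j) ≡ false
        outside with any? (λ j → X (z j) ≟ᵇ false)
        ... | yes q = q
        ... | no h = ⊥-elim (ℕₚ.<-irrefl (trans (trans (count (neg s)) (sym z-neutral)) (sym (count s))) p)
          where
          count : ∀ t → z-count (X ⟪ t) ≡ z-count t
          count t = sum-cong-≗ λ i → cong (λ x → ind (x ∧ t (z i))) (not-≢ {false} (λ q → h (i , sym q)))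

      separated : ∀ X → cut f X ≡ 0 → cut every X ≤ 5 → z-count (X ⟪ neg s) < z-count (X ⟪ s) → ⊥
      separated X p q r = let (i , Xi) , (j , Xj) = z-separated X r in
        separation X i j q (λ v e → trans (uncrossed X p (trans e (sym (tr i)))) Xi) (λ v e → trans (uncrossed X p (trans e (sym (tr j)))) Xj)

      tight-edge : ∀ {n t′} a b t → n ≡ true → t′ ≡ not t →
        ind n * (ind (a ∧ t) + ind (b ∧ t′)) ≡ ind n * (ind (a ∧ not t) + ind (b ∧ not t′)) + ind (n ∧ (a xor b)) →
        a xor b ≡ true → a ≡ t × b ≡ t′
      tight-edge true  false true  refl refl p q = refl , refl
      tight-edge false true  false refl refl p q = refl , refl

      agree : ∀ x y → ind (x ∧ y) ≡ ind y → ind (x ∧ not y) ≡ 0 → x ≡ y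
      agree true  true  _ _ = refl
      agree false false _ _ = refl

      bad-cut : ∀ X → z-count (X ⟪ s) ≤ 2 → z-count (X ⟪ s) ≡ 2 + z-count (X ⟪ neg s) → cut C X ≡ 0 → cut M X ≡ 4 → cut N X ≡ 2 →
        size (X ⟪ s) ≡ size (X ⟪ neg s) + 4 → BadCut s X
      bad-cut X z⁺≤2 p k≡0 m≡4 n≡2 a≡ = record
        { four  = ℕₚ.≤-antisym ω≤4 ω≥4
        ; cut-M = m≡4
        ; cut-N = n≡2
        ; F⊆N   = λ {e} fe ce → in-N fe ce
        ; sides = λ i → agree (X (z i)) (s (z i))
            (sum-tight (λ i → bools≤ 2 (λ x y → ind (x ∧ y)) (λ x y → ind y) (X (z i)) (s (z i))) all-plus i)
            (sum≡0 _ (ℕₚ.n≤0⇒n≡0 no-minus) i)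
        ; tight = λ {e} Ne ce → tight-edge (X (end₁ e)) (X (end₂ e)) (s (end₁ e)) Ne (proj₂ col e Ne)
            (sum-tight (signed≤ {N} {s} X (proj₂ col)) saturated e) ce }
        where
        ω≥4 : 4 ≤ ω
        ω≥4 = subst (4 ≤_) z-total (+-mono-≤ 2≤P 2≤P)
          where
          2≤P : 2 ≤ z-count s
          2≤P = ≤-trans (ℕₚ.m≤m+n 2 _) (≤-trans (≤-reflexive (sym p)) (z⁺≤ X))
        in-N : ∀ {e} → f e ≡ true → cross X e ≡ true → N e ≡ true
        in-N {e} fe ce with N e in Ne
        ... | true  = refl
        ... | false = case trans (sym ce) (not-crossing C X k≡0 {e} (cong₂ (λ x y → x ∧ not y) fe Ne)) of λ ()
        all-plus : z-count s ≤ z-count (X ⟪ s)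
        all-plus = linear (z-count (X ⟪ s) ∷ z-count (X ⟪ neg s) ∷ z-count s ∷ []) ((x₂ ⊕ x₂ ≼ ‵ 4) ∷ (‵ 2 ⊕ x₁ ≼ x₀) ∷ []) (x₂ ≼ x₀) 1 (1 ∷ 2 ∷ [])
          (z-total≤4 ∷ ≤-reflexive (sym p) ∷ [])
        no-minus : z-count (X ⟪ neg s) ≤ 0
        no-minus = linear (z-count (X ⟪ s) ∷ z-count (X ⟪ neg s) ∷ []) ((x₀ ≼ ‵ 2) ∷ (‵ 2 ⊕ x₁ ≼ x₀) ∷ []) (x₁ ≼ ‵ 0) 0 (1 ∷ 1 ∷ []) (z⁺≤2 ∷ ≤-reflexive (sym p) ∷ [])
        -- The surplus is 4, made up of n = 2 and z⁺ - z⁻ = 2, so the count along N is an equality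
        -- and every edge attains the bound of `signed≤`.
        saturated : sum (λ e → signed N X (neg s) e + ind (N e ∧ cross X e)) ≤ sum (signed N X s)
        saturated = linear
          (size (X ⟪ s) ∷ size (X ⟪ neg s) ∷ cut N X ∷ z-count (X ⟪ s) ∷ z-count (X ⟪ neg s) ∷ sum (signed N X s) ∷ sum (signed N X (neg s))
            ∷ sum (λ e → signed N X (neg s) e + ind (N e ∧ cross X e)) ∷ [])
          ((x₇ ≼ x₆ ⊕ x₂) ∷ (x₅ ⊕ x₃ ≼ x₀) ∷ (x₀ ≼ x₅ ⊕ x₃) ∷ (x₆ ⊕ x₄ ≼ x₁) ∷ (x₁ ⊕ ‵ 4 ≼ x₀) ∷ (x₂ ≼ ‵ 2) ∷ (x₃ ≼ ‵ 2 ⊕ x₄) ∷ [])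
          (x₇ ≼ x₅) 0 (1 ∷ 0 ∷ 1 ∷ 1 ∷ 1 ∷ 1 ∷ 1 ∷ [])
          ( ≤-reflexive (sum-+ _ _)
          ∷ ≤-reflexive split⁺ ∷ ≤-reflexive (sym split⁺)
          ∷ ≤-reflexive (trans (cong (_+ z-count (X ⟪ neg s)) (sym (handshake N (λ v → ind (X v ∧ neg s v))))) (N-degree-split (X ⟪ neg s)))
          ∷ ≤-reflexive (sym a≡) ∷ ≤-reflexive n≡2 ∷ ≤-reflexive p ∷ [])
          where
          split⁺ : sum (signed N X s) + z-count (X ⟪ s) ≡ size (X ⟪ s)
          split⁺ = trans (cong (_+ z-count (X ⟪ s)) (sym (handshake N (λ v → ind (X v ∧ s v))))) (N-degree-split (X ⟪ s))

      analyse : ∀ X → 5 * size (X ⟪ neg s) + 3 * cut every X < 5 * size (X ⟪ s) → BadCut s X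
      analyse X violated = conclude outcome
        where
        z⁺≤2 : z-count (X ⟪ s) ≤ 2
        z⁺≤2 = linear (z-count (X ⟪ s) ∷ z-count s ∷ []) ((x₀ ≼ x₁) ∷ (x₁ ⊕ x₁ ≼ ‵ 4) ∷ []) (x₀ ≼ ‵ 2) 1 (2 ∷ 1 ∷ []) (z⁺≤ X ∷ z-total≤4 ∷ [])
        z-split : z-count (X ⟪ s) + z-count (X ⟪ neg s) ≡ z-count X
        z-split = trans (sym (sum-+ _ _)) (sum-cong-≗ λ i → pointwise (X (z i)) (s (z i)))
          where
          pointwise : ∀ x y → ind (x ∧ y) + ind (x ∧ not y) ≡ ind x
          pointwise true  true  = refl
          pointwise true  false = refl
          pointwise false y     = refl
        M-parity : odd (cut M X) ≡ odd (cut N X) xor odd (z-count (X ⟪ s) + z-count (X ⟪ neg s))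
        M-parity = trans (odd-cut M X) (trans (cong odd (trans (size-unit {M} X (λ v _ → M-degree v)) (sym (N-degree-split X))))
          (trans (odd-+ (sum λ v → ind (X v) * deg N v) _) (cong₂ _xor_ (sym (odd-cut N X)) (cong odd (sym z-split)))))
        open Surplus (size (X ⟪ s)) (size (X ⟪ neg s)) (cut M X) (cut N X) (cut C X) (z-count (X ⟪ s)) (z-count (X ⟪ neg s))
          (subst (λ t → 5 * size (X ⟪ neg s) + 3 * t < 5 * size (X ⟪ s)) (trans (cut-split X) (cong (cut M X +_) (cut-F-split X))) violated)
          (excess≤ {M} {s} X (λ v _ → M-degree v) (proj₁ col)) (N-excess≤ {s} X (proj₂ col)) z⁺≤2
          (trans (cong odd (sym (cut-F-split X))) (cut-F-even X)) M-parity
        conclude : Outcome → BadCut s X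
        conclude (inj₁ (n≡0 , k≡0 , m≤5)) = ⊥-elim (separated X F-zero
          (subst (_≤ 5) (sym (trans (cut-split X) (trans (cong (cut M X +_) F-zero) (ℕₚ.+-identityʳ _)))) m≤5) surplus)
          where
          F-zero : cut f X ≡ 0
          F-zero = trans (cut-F-split X) (cong₂ _+_ n≡0 k≡0)
        conclude (inj₂ (p , k≡0 , m≡4 , n≡2 , a≡)) = bad-cut X z⁺≤2 p k≡0 m≡4 n≡2 a≡

      flow-or-bad-cut′ : NowhereZeroFlow G 5 ⊎ (∃[ X ] BadCut s X)
      flow-or-bad-cut′ with search (λ X → 5 * size (X ⟪ s) ℕₚ.≤? 5 * size (X ⟪ neg s) + 3 * cut every X) resp
        where
        resp : ∀ {X Y} → X ≗ Y → 5 * size (X ⟪ s) ≤ 5 * size (X ⟪ neg s) + 3 * cut every X →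
          5 * size (Y ⟪ s) ≤ 5 * size (Y ⟪ neg s) + 3 * cut every Y
        resp {X} {Y} X≗Y = subst₂ _≤_ (cong (5 *_) (sz s)) (cong₂ _+_ (cong (5 *_) (sz (neg s)))
          (cong (3 *_) (sum-cong-≗ λ e → cong ind (cong₂ _xor_ (X≗Y _) (X≗Y _)))))
          where
          sz : ∀ t → size (X ⟪ t) ≡ size (Y ⟪ t)
          sz t = sum-cong-≗ λ v → cong (λ x → ind (x ∧ t v)) (X≗Y v)
      ... | inj₁ ok       = inj₁ (BalancedValuation.flow G cubic s neutral ok)
      ... | inj₂ (X , bd) = inj₂ (X , analyse X (ℕₚ.≰⇒> bd))

      abstract
        flow-or-bad-cut : NowhereZeroFlow G 5 ⊎ (∃[ X ] BadCut s X)
        flow-or-bad-cut = flow-or-bad-cut′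

-- Uncrossing cuts of six edges

module SixCuts (𝒮 : Setting) where
  open Setting 𝒮
  open Joins 𝒮
  open BadCuts 𝒮

  parity : (Fin #V → Bool) → Fin #V → Bool
  parity X r = odd (size λ v → X v ∧ comp r v)

  -- The parity pattern prescribed by σ: `σ i` on the odd circuit i and false on even circuits. The
  -- form of a sum makes it additive, like `parity`, under complementation and intersection.
  sides-in : (Fin ω → Bool) → Fin #V → Bool
  sides-in σ r = odd (sum λ i → ind (σ i ∧ (rep (c i) == r)))

  sides-in-own : ∀ σ i → sides-in σ (rep (c i)) ≡ σ i
  sides-in-own σ i = trans (odd-sum λ j → pointwise j) (trans (cong odd (sum-δ (ind ∘ σ) i)) (odd-ind (σ i)))
    where
    pointwise : ∀ j → odd (ind (σ j ∧ (rep (c j) == rep (c i)))) ≡ odd (ind (i == j) * ind (σ j))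
    pointwise j with i ≟ j
    ... | yes refl rewrite ==-refl (rep (c i)) =
      cong odd (trans (cong ind (∧-identityʳ (σ i))) (sym (ℕₚ.+-identityʳ (ind (σ i)))))
    ... | no p rewrite ==-≢ (λ q → p (sym (c-injective {j} {i} q))) = cong (λ x → odd (ind x)) (∧-zeroʳ (σ j))

  sides-in-none : ∀ σ {r} → (∀ i → rep (c i) ≢ r) → sides-in σ r ≡ false
  sides-in-none σ h = cong odd (sum-zero λ i →
    cong ind (trans (cong (σ i ∧_) (==-≢ (h i))) (∧-zeroʳ (σ i))))

  parity-constant : ∀ X r x → (∀ v → rep v ≡ r → X v ≡ x) → parity X r ≡ x ∧ odd (size (comp r))
  parity-constant X r x h = trans (cong odd (sum-cong-≗ pointwise)) (scale x)
    where
    pointwise : ∀ v → ind (X v ∧ comp r v) ≡ ind (x ∧ comp r v)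
    pointwise v with rep v ≟ r
    ... | yes p = cong (λ y → ind (y ∧ true)) (h v p)
    ... | no _  = cong ind (∧-false (X v) x)
    scale : ∀ x → odd (size (λ v → x ∧ comp r v)) ≡ x ∧ odd (size (comp r))
    scale true  = refl
    scale false = cong odd (sum-zero {#V} λ _ → refl)

  -- What the proof retains of a violated cut: the six edges and, for each
  -- circuit C of F, the parity of X ∩ C.  Given σ, only circuits i with σ i meet X oddly.
  record Six (σ : Fin ω → Bool) (X : Fin #V → Bool) (r : Fin #V) : Set where
    field
      six      : cut every X ≡ 6
      two      : cut f X ≡ 2
      par      : ∀ q → parity X q ≡ sides-in σ q
      crossing : ∀ {e} → f e ≡ true → cross X e ≡ true → rep (end₁ e) ≡ r
  open Six

  -- All crossing edges of F lie on circuit r, so the intersection of X with another circuit is left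
  -- by no edge of F.
  constant : ∀ {σ X r} → Six σ X r → ∀ {q} → q ≢ r → ∀ {u v} → rep u ≡ q → rep v ≡ q → X u ≡ X v
  constant {X = X} {r} S {q} q≢r {u} {v} p p′ = inside (respects Xq Xq-edge (trans p (sym p′))) p p′
    where
    Xq : Fin #V → Bool
    Xq v = X v ∧ comp q v
    Xq-edge : ∀ {e} → f e ≡ true → Xq (end₁ e) ≡ Xq (end₂ e)
    Xq-edge {e} fe with rep (end₁ e) ≟ q
    ... | no h rewrite ==-≢ (λ x → h (trans (rep-edge fe) x)) = ∧-false (X (end₁ e)) (X (end₂ e))
    ... | yes h rewrite sym (rep-edge fe) | h | ==-refl q = cong (_∧ true) (cross-false X {e} not-crossed)
      where
      not-crossed : cross X e ≡ false
      not-crossed with cross X e in eq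
      ... | false = refl
      ... | true  = ⊥-elim (q≢r (trans (sym h) (crossing S fe eq)))
    inside : Xq u ≡ Xq v → rep u ≡ q → rep v ≡ q → X u ≡ X v
    inside eq refl h rewrite h | ==-refl (rep u) =
      trans (sym (∧-identityʳ (X u))) (trans eq (∧-identityʳ (X v)))

  -- X is constant on an uncrossed circuit, and as that circuit is odd, the parity of the
  -- intersection reveals the constant.
  side : ∀ {σ X r} → Six σ X r → ∀ i → rep (c i) ≢ r → ∀ v → rep v ≡ rep (c i) → X v ≡ σ i
  side {σ} {X} {r} S i h v p = trans (sym (trans (parity-constant X (rep (c i)) (X v) λ u q → constant S h q p)
      (trans (cong (X v ∧_) (c-odd i)) (∧-identityʳ (X v)))))
    (trans (par S (rep (c i))) (sides-in-own σ i))

  odd-cut-every : ∀ X → odd (cut every X) ≡ odd (size X)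
  odd-cut-every X = trans (odd-cut every X) (odd-sum λ v → trans (cong (λ d → odd (ind (X v) * d)) (cubic v)) (triple (X v)))
    where
    triple : ∀ b → odd (ind b * 3) ≡ odd (ind b)
    triple true  = refl
    triple false = refl

  size-by-components : ∀ Q → size Q ≡ sum (λ r → size (λ v → Q v ∧ comp r v))
  size-by-components Q = trans (sum-cong-≗ λ v → sym (trans (sum-cong-≗ λ r → pointwise (Q v) (comp r v)) (sum-δ (λ _ → ind (Q v)) (rep v))))
    (∑-comm λ v r → ind (Q v ∧ comp r v))
    where
    pointwise : ∀ a b → ind (a ∧ b) ≡ ind b * ind a
    pointwise true  true  = refl
    pointwise true  false = refl
    pointwise false true  = refl
    pointwise false false = refl

  odd-size : ∀ {Q g} → (∀ r → parity Q r ≡ sides-in g r) → odd (size Q) ≡ odd (sum (ind ∘ g))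
  odd-size {Q} {g} h = trans (cong odd (size-by-components Q)) (trans (odd-sum h)
    (cong odd (trans (∑-comm _) (sum-cong-≗ λ i → trans (sum-cong-≗ λ r → pointwise (g i) (rep (c i) == r)) (sum-δ (λ _ → ind (g i)) (rep (c i)))))))
    where
    pointwise : ∀ a b → ind (a ∧ b) ≡ ind b * ind a
    pointwise true  true  = refl
    pointwise true  false = refl
    pointwise false true  = refl
    pointwise false false = refl

  -- Complementation

  flip : {A : Set} → Bool → (A → Bool) → A → Bool
  flip b X v = b xor X v

  parity-not : ∀ (X Y : Fin #V → Bool) r → parity (λ v → not (X v) ∧ Y v) r ≡ parity Y r xor parity (λ v → X v ∧ Y v) r
  parity-not X Y r = trans (odd-sum λ v → pointwise (X v) (Y v) (comp r v)) (trans (cong odd (sum-+ _ _)) (odd-+ (size λ v → Y v ∧ comp r v) _))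
    where
    pointwise : ∀ x y z → odd (ind ((not x ∧ y) ∧ z)) ≡ odd (ind (y ∧ z) + ind ((x ∧ y) ∧ z))
    pointwise = bools≡ 3 (λ x y z → odd (ind ((not x ∧ y) ∧ z))) (λ x y z → odd (ind (y ∧ z) + ind ((x ∧ y) ∧ z)))

  sides-in-not : ∀ (σ τ : Fin ω → Bool) r → sides-in (λ i → not (σ i) ∧ τ i) r ≡ sides-in τ r xor sides-in (λ i → σ i ∧ τ i) r
  sides-in-not σ τ r = trans (odd-sum λ i → pointwise (σ i) (τ i) (rep (c i) == r)) (trans (cong odd (sum-+ _ _)) (odd-+ (sum λ i → ind (τ i ∧ (rep (c i) == r))) _))
    where
    pointwise : ∀ x y z → odd (ind ((not x ∧ y) ∧ z)) ≡ odd (ind (y ∧ z) + ind ((x ∧ y) ∧ z))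
    pointwise = bools≡ 3 (λ x y z → odd (ind ((not x ∧ y) ∧ z))) (λ x y z → odd (ind (y ∧ z) + ind ((x ∧ y) ∧ z)))

  odd-cong : ∀ {n} {g h : Fin n → Bool} → (∀ i → g i ≡ h i) → odd (sum (ind ∘ g)) ≡ odd (sum (ind ∘ h))
  odd-cong p = cong odd (sum-cong-≗ λ i → cong ind (p i))

  Six-not : ∀ {σ X r} → Six σ X r → Six (λ i → not (σ i)) (λ v → not (X v)) r
  Six-not {σ} {X} {r} S = record
    { six = trans (cut-complement every X) (six S)
    ; two = trans (cut-complement f X) (two S)
    ; par = λ q → begin
        parity (λ v → not (X v)) q
          ≡⟨ odd-cong (λ v → cong (_∧ comp q v) (bools≡ 1 not (λ a → not a ∧ true) (X v))) ⟩
        parity (λ v → not (X v) ∧ true) q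
          ≡⟨ parity-not X (λ _ → true) q ⟩
        odd (size (comp q)) xor parity (λ v → X v ∧ true) q
          ≡⟨ cong₂ _xor_ (sym (count-odd q)) (trans (odd-cong λ v → cong (_∧ comp q v) (∧-identityʳ (X v))) (par S q)) ⟩
        sides-in (λ _ → true) q xor sides-in σ q
          ≡⟨ cong (sides-in (λ _ → true) q xor_) (odd-cong λ i → cong (_∧ (rep (c i) == q)) (sym (∧-identityʳ (σ i)))) ⟩
        sides-in (λ _ → true) q xor sides-in (λ i → σ i ∧ true) q
          ≡⟨ sides-in-not σ (λ _ → true) q ⟨
        sides-in (λ i → not (σ i) ∧ true) q
          ≡⟨ odd-cong (λ i → cong (_∧ (rep (c i) == q)) (bools≡ 1 (λ a → not a ∧ true) not (σ i))) ⟩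
        sides-in (λ i → not (σ i)) q ∎
    ; crossing = λ {e} fe ce → crossing S fe (trans (sym (xor-annihilates-not (X (end₁ e)) (X (end₂ e)))) ce)
    }

  Six-flip : ∀ b {σ X r} → Six σ X r → Six (flip b σ) (flip b X) r
  Six-flip true  S = Six-not S
  Six-flip false S = S

  Six-resp : ∀ {σ τ X r} → (∀ i → σ i ≡ τ i) → Six σ X r → Six τ X r
  Six-resp h S = record { six = six S ; two = two S
    ; par = λ q → trans (par S q) (odd-cong λ i → cong (_∧ (rep (c i) == q)) (h i)) ; crossing = crossing S }

  -- The parities of X and of Y on a circuit do not determine that of their intersection. This
  -- condition supplies it; it holds for cuts from the same transversal and for cuts crossing
  -- different circuits, the two situations in which cuts are compared.
  Compatible : (Fin ω → Bool) → (Fin #V → Bool) → (Fin ω → Bool) → (Fin #V → Bool) → Set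
  Compatible σ X τ Y = ∀ r → parity (λ v → X v ∧ Y v) r ≡ sides-in (λ i → σ i ∧ τ i) r

  Compatible-sym : ∀ {σ X τ Y} → Compatible σ X τ Y → Compatible τ Y σ X
  Compatible-sym {σ} {X} {τ} {Y} h r = trans (odd-cong λ v → cong (_∧ comp r v) (∧-comm (Y v) (X v)))
    (trans (h r) (odd-cong λ i → cong (_∧ (rep (c i) == r)) (∧-comm (σ i) (τ i))))

  Compatible-flip : ∀ b {σ X τ Y r} → Six τ Y r → Compatible σ X τ Y → Compatible (flip b σ) (flip b X) τ Y
  Compatible-flip false S h = h
  Compatible-flip true {σ} {X} {τ} {Y} S h r = trans (parity-not X Y r)
    (trans (cong₂ _xor_ (par S r) (h r)) (sym (sides-in-not σ τ r)))

  one-constant : ∀ {σ X r τ Y r′} → Six σ X r → Six τ Y r′ → ∀ {q} → q ≢ r → parity (λ v → X v ∧ Y v) q ≡ sides-in (λ i → σ i ∧ τ i) q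
  one-constant {σ} {X} {r} {τ} {Y} S S′ {q} q≢r with any? (λ i → rep (c i) ≟ q)
  ... | yes (i , refl) = trans (trans (odd-cong pointwise) (scale (σ i)))
      (trans (cong (σ i ∧_) (trans (par S′ q) (sides-in-own τ i))) (sym (sides-in-own (λ i → σ i ∧ τ i) i)))
    where
    pointwise : ∀ v → (X v ∧ Y v) ∧ comp q v ≡ (σ i ∧ Y v) ∧ comp q v
    pointwise v with rep v ≟ q
    ... | yes p = cong (λ x → (x ∧ Y v) ∧ true) (side S i q≢r v p)
    ... | no _  = ∧-false (X v ∧ Y v) (σ i ∧ Y v)
    scale : ∀ x → parity (λ v → x ∧ Y v) q ≡ x ∧ parity Y q
    scale true  = refl
    scale false = cong odd (sum-zero {#V} λ _ → refl)
  ... | no h = trans (vanish (any? λ u → rep u ≟ q)) (sym (sides-in-none (λ i → σ i ∧ τ i) λ i p → h (i , p)))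
    where
    vanish : Dec (∃[ u ] rep u ≡ q) → parity (λ v → X v ∧ Y v) q ≡ false
    vanish (no g) = cong odd (sum-zero λ v → trans (cong (λ x → ind ((X v ∧ Y v) ∧ x)) (==-≢ λ p → g (v , p)))
      (cong ind (∧-zeroʳ (X v ∧ Y v))))
    vanish (yes (u , p)) = trans (odd-cong pointwise) (scale (X u))
      where
      pointwise : ∀ v → (X v ∧ Y v) ∧ comp q v ≡ (X u ∧ Y v) ∧ comp q v
      pointwise v with rep v ≟ q
      ... | yes p′ = cong (λ x → (x ∧ Y v) ∧ true) (constant S q≢r p′ p)
      ... | no _   = ∧-false (X v ∧ Y v) (X u ∧ Y v)
      scale : ∀ x → parity (λ v → x ∧ Y v) q ≡ false
      scale true  = trans (par S′ q) (sides-in-none τ λ i p → h (i , p))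
      scale false = cong odd (sum-zero {#V} λ _ → refl)

  -- Cuts that cross different circuits meet every circuit in a quadrant as they should.
  compatible : ∀ {σ X r τ Y r′} → Six σ X r → Six τ Y r′ → r ≢ r′ → Compatible σ X τ Y
  compatible {σ} {X} {r} {τ} {Y} {r′} S S′ r≢r′ q with q ≟ r
  ... | no q≢r = one-constant S S′ q≢r
  ... | yes refl = trans (odd-cong λ v → cong (_∧ comp q v) (∧-comm (X v) (Y v)))
    (trans (one-constant S′ S r≢r′) (odd-cong λ i → cong (_∧ (rep (c i) == q)) (∧-comm (τ i) (σ i))))

  quadrant-cuts : ∀ X Y → cut every (λ v → X v ∧ Y v) + cut every (λ v → not (X v) ∧ not (Y v)) ≤ cut every X + cut every Y
  quadrant-cuts X Y = subst₂ _≤_ (sum-+ _ _) (sum-+ _ _) (sum-mono λ e → bools≤ 4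
    (λ a b x y → ind ((a ∧ x) xor (b ∧ y)) + ind ((not a ∧ not x) xor (not b ∧ not y)))
    (λ a b x y → ind (a xor b) + ind (x xor y)) (X (end₁ e)) (X (end₂ e)) (Y (end₁ e)) (Y (end₂ e)))

  odd-≥7 : ∀ {k} → odd k ≡ true → ¬ k ≤ 5 → 7 ≤ k
  odd-≥7 {k} p q with ℕₚ.m≤n⇒m<n∨m≡n (ℕₚ.≰⇒> q)
  ... | inj₁ h    = h
  ... | inj₂ refl = case p of λ ()

  Unique : (Fin ω → Bool) → Fin ω → Set
  Unique g i = g i ≡ true × (∀ j → g j ≡ true → i ≡ j)

  -- Exactly one circuit meets the quadrant in an odd number of vertices, so the quadrant is odd,
  -- and in a cubic graph the boundary has the parity of the set.
  odd-quadrant : ∀ {σ X r τ Y r′} → Six σ X r → Six τ Y r′ → Compatible σ X τ Y → ∀ {i} → Unique (λ i → σ i ∧ τ i) i →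
    odd (cut every (λ v → X v ∧ Y v)) ≡ true
  odd-quadrant {σ} {X} {τ = τ} {Y} S S′ comp-XY {i} (p , u) = trans (odd-cut-every (λ v → X v ∧ Y v))
    (trans (odd-size {λ v → X v ∧ Y v} {λ i → σ i ∧ τ i} comp-XY) (cong odd (sum-unique (λ i → σ i ∧ τ i) i p u)))

  module _ {σ : Fin ω → Bool} {X : Fin #V → Bool} {r : Fin #V} {τ : Fin ω → Bool} {Y : Fin #V → Bool} {r′ : Fin #V}
           (S : Six σ X r) (S′ : Six τ Y r′) (comp-XY : Compatible σ X τ Y)
           {i j : Fin ω} (ui : Unique (λ i → σ i ∧ τ i) i) (uj : Unique (λ i → not (σ i) ∧ not (τ i)) j) where

    odd⁻ : odd (cut every (λ v → not (X v) ∧ not (Y v))) ≡ true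
    odd⁻ = odd-quadrant (Six-not S) (Six-not S′) (Compatible-sym {τ = λ i → not (σ i)} {λ v → not (X v)}
      (Compatible-flip true {τ} {Y} {λ i → not (σ i)} {λ v → not (X v)} (Six-not S)
        (Compatible-sym {λ i → not (σ i)} {λ v → not (X v)} {τ} {Y} (Compatible-flip true {σ} {X} {τ} {Y} S′ comp-XY)))) uj

    cuts≤12 : cut every (λ v → X v ∧ Y v) + cut every (λ v → not (X v) ∧ not (Y v)) ≤ 12
    cuts≤12 = ≤-trans (quadrant-cuts X Y) (≤-reflexive (cong₂ _+_ (six S) (six S′)))

    -- Otherwise both of these opposite quadrants have odd cuts of size at least 7.
    opposite-crossed : rep (c i) ≢ r → rep (c i) ≢ r′ → rep (c j) ≢ r → rep (c j) ≢ r′ → ⊥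
    opposite-crossed ir ir′ jr jr′ = ℕₚ.<-irrefl refl
      (linear (cut every (λ v → X v ∧ Y v) ∷ cut every (λ v → not (X v) ∧ not (Y v)) ∷ [])
        ((x₀ ⊕ x₁ ≼ ‵ 12) ∷ (‵ 7 ≼ x₀) ∷ (‵ 7 ≼ x₁) ∷ []) (‵ 1 ≼ ‵ 0) 0 (1 ∷ 1 ∷ 1 ∷ [])
        ( cuts≤12
        ∷ odd-≥7 (odd-quadrant S S′ comp-XY ui) (λ h → separation (λ v → X v ∧ Y v) i j h
            (λ v p → trans (cong₂ _∧_ (side S i ir v p) (side S′ i ir′ v p)) (proj₁ ui))
            (λ v p → trans (cong₂ _∧_ (side S j jr v p) (side S′ j jr′ v p)) (nor {σ j} {τ j} (proj₁ uj))))
        ∷ odd-≥7 odd⁻ (λ h → separation (λ v → not (X v) ∧ not (Y v)) j i h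
            (λ v p → trans (cong₂ (λ a b → not a ∧ not b) (side S j jr v p) (side S′ j jr′ v p)) (proj₁ uj))
            (λ v p → trans (cong₂ (λ a b → not a ∧ not b) (side S i ir v p) (side S′ i ir′ v p)) (both {σ i} {τ i} (proj₁ ui)))) ∷ []))
      where
      nor : ∀ {a b} → not a ∧ not b ≡ true → a ∧ b ≡ false
      nor {false} {false} _ = refl
      both : ∀ {a b} → a ∧ b ≡ true → not a ∧ not b ≡ false
      both {true} {true} _ = refl

    -- The opposite quadrant separates the uncrossed circuits j and k, so its odd boundary has at
    -- least 7 edges, which leaves at most 5 of the 12.
    small-quadrant : ∀ k → rep (c j) ≢ r → rep (c j) ≢ r′ → rep (c k) ≢ r → rep (c k) ≢ r′ → not (σ k) ∧ not (τ k) ≡ false →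
      cut every (λ v → X v ∧ Y v) ≤ 5
    small-quadrant k jr jr′ kr kr′ k∉ = linear
      (cut every (λ v → X v ∧ Y v) ∷ cut every (λ v → not (X v) ∧ not (Y v)) ∷ [])
      ((x₀ ⊕ x₁ ≼ ‵ 12) ∷ (‵ 7 ≼ x₁) ∷ []) (x₀ ≼ ‵ 5) 0 (1 ∷ 1 ∷ [])
      ( cuts≤12
      ∷ odd-≥7 odd⁻ (λ h → separation (λ v → not (X v) ∧ not (Y v)) j k h
          (λ v p → trans (cong₂ (λ a b → not a ∧ not b) (side S j jr v p) (side S′ j jr′ v p)) (proj₁ uj))
          (λ v p → trans (cong₂ (λ a b → not a ∧ not b) (side S k kr v p) (side S′ k kr′ v p)) k∉)) ∷ [])

-- Hubs and rings of hubs

module Hubs (𝒮 : Setting) where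
  open Setting 𝒮
  open Joins 𝒮
  open BadCuts 𝒮
  open SixCuts 𝒮
  open Six

  -- σ and τ are different splits of four indices into pairs: each of the four quadrants receives
  -- exactly one index.
  Independent : (σ τ : Fin ω → Bool) → Set
  Independent σ τ = (∀ i j → σ i ≡ σ j → τ i ≡ τ j → i ≡ j) × (∀ x y → ∃[ i ] σ i ≡ x × τ i ≡ y)

  Independent-not : ∀ {σ τ} → Independent σ τ → Independent σ (λ i → not (τ i))
  Independent-not (inj , sur) = (λ i j p q → inj i j p (not-injective q))
    , λ x y → let i , p , q = sur x (not y) in i , p , trans (cong not q) (not-involutive y)

  Independent-sym : ∀ {σ τ} → Independent σ τ → Independent τ σ
  Independent-sym (inj , sur) = (λ i j p q → inj i j q p) , λ x y → let i , p , q = sur y x in i , q , p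

  unique : ∀ {σ τ} → Independent σ τ → ∀ {i} → σ i ≡ true → τ i ≡ true → Unique (λ i → σ i ∧ τ i) i
  unique (inj , _) {i} p q = cong₂ _∧_ p q , λ j r → let a , b = ∧-true r in inj i j (trans p (sym a)) (trans q (sym b))

  diagonal : ∀ {σ X r τ Y r′} → Six σ X r → Six τ Y r′ → Compatible σ X τ Y → Independent σ τ →
    ∃[ i ] σ i ≡ τ i × (rep (c i) ≡ r ⊎ rep (c i) ≡ r′)
  diagonal {σ} {r = r} {τ} {r′ = r′} S S′ comp-XY ind-στ@(_ , sur) with sur true true | sur false false
  ... | i , σi , τi | j , σj , τj with rep (c i) ≟ r | rep (c i) ≟ r′ | rep (c j) ≟ r | rep (c j) ≟ r′
  ...   | yes p | _ | _ | _ = i , trans σi (sym τi) , inj₁ p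
  ...   | no _ | yes p | _ | _ = i , trans σi (sym τi) , inj₂ p
  ...   | no _ | no _ | yes p | _ = j , trans σj (sym τj) , inj₁ p
  ...   | no _ | no _ | no _ | yes p = j , trans σj (sym τj) , inj₂ p
  ...   | no ir | no ir′ | no jr | no jr′ = ⊥-elim (opposite-crossed S S′ comp-XY (unique ind-στ σi τi)
          (unique {λ i → not (σ i)} {λ i → not (τ i)} (Independent-not {λ i → not (σ i)} {τ} (Independent-sym {τ} (Independent-not {τ} (Independent-sym {σ} ind-στ))))
            (cong not σj) (cong not τj)) ir ir′ jr jr′)

  -- By `diagonal`, applied to Y and to its complement, each pair of opposite quadrants holds the
  -- index of a crossed circuit. Each cut crosses a single circuit, so the two crossed circuits are
  -- odd, distinct and in adjacent quadrants: exactly one of σ and τ separates them.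
  crossed-circuits : ∀ {σ X r τ Y r′} → Six σ X r → Six τ Y r′ → Compatible σ X τ Y → Independent σ τ →
    ∃[ p ] ∃[ q ] rep (c p) ≡ r × rep (c q) ≡ r′ × (σ p xor τ p) ≢ (σ q xor τ q)
  crossed-circuits {σ} {X} {r} {τ} {Y} {r′} S S′ comp-XY ind-στ
    with diagonal S S′ comp-XY ind-στ
       | diagonal S (Six-not S′) (Compatible-sym {λ i → not (τ i)} {λ v → not (Y v)} {σ} {X} (Compatible-flip true {τ} {Y} S (Compatible-sym {σ} {X} {τ} {Y} comp-XY))) (Independent-not {σ} {τ} ind-στ)
  ... | i , i-even , hi | k , k-odd , hk = combine-hits hi hk
    where
    differ : (σ i xor τ i) ≢ (σ k xor τ k)
    differ h = case trans (sym (trans (cong (_xor τ i) i-even) (xor-same (τ i))))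
      (trans h (trans (cong (_xor τ k) k-odd) (xor-inverseˡ (τ k)))) of λ ()
    distinct : ∀ {r} → rep (c i) ≡ r → rep (c k) ≡ r → ⊥
    distinct p q = differ (cong (λ j → σ j xor τ j) (c-injective (trans p (sym q))))
    combine-hits : rep (c i) ≡ r ⊎ rep (c i) ≡ r′ → rep (c k) ≡ r ⊎ rep (c k) ≡ r′ →
      ∃[ p ] ∃[ q ] rep (c p) ≡ r × rep (c q) ≡ r′ × (σ p xor τ p) ≢ (σ q xor τ q)
    combine-hits (inj₁ a) (inj₁ b) = ⊥-elim (distinct a b)
    combine-hits (inj₁ a) (inj₂ b) = i , k , a , b , differ
    combine-hits (inj₂ a) (inj₁ b) = k , i , b , a , differ ∘ sym
    combine-hits (inj₂ a) (inj₂ b) = ⊥-elim (distinct a b)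

  uncrossed-edge : ∀ {σ X p} → Six σ X (rep (c p)) → ∀ {e} → f e ≡ true → rep (end₁ e) ≢ rep (c p) → cross X e ≡ false
  uncrossed-edge {X = X} S {e} fe h with cross X e in eq
  ... | false = refl
  ... | true  = ⊥-elim (h (crossing S fe eq))

  -- The quadrant X ∩ Y around the circuit p crossed by X, when X does not separate
  -- p from the circuit q crossed by Y.
  module _ {σ : Fin ω → Bool} {X : Fin #V → Bool} {τ : Fin ω → Bool} {Y : Fin #V → Bool} {p q : Fin ω}
           (S : Six σ X (rep (c p))) (S′ : Six τ Y (rep (c q))) (comp-XY : Compatible σ X τ Y)
           (ind-στ : Independent σ τ) (σp : σ p ≡ true) (σq : σ q ≡ true) (τp : τ p ≡ true) (τq : τ q ≡ false) where

    hub : Fin #V → Bool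
    hub v = X v ∧ Y v

    private
      p≢q : p ≢ q
      p≢q refl = case trans (sym τp) τq of λ ()

      by-sides : ∀ {i j} → σ i ≡ false → σ j ≡ true → rep (c i) ≢ rep (c j)
      by-sides a b h = case trans (sym a) (trans (cong σ (c-injective h)) b) of λ ()

    -- σ puts both crossed circuits on the side of X, so the two circuits on the other side are
    -- uncrossed; one of them lies in the opposite quadrant and the other outside it, as
    -- `small-quadrant` requires.
    hub-small : cut every hub ≤ 5
    hub-small with proj₂ ind-στ false false | proj₂ ind-στ false true
    ... | j , σj , τj | k , σk , τk = small-quadrant S S′ comp-XY (unique ind-στ σp τp)
      (unique {λ i → not (σ i)} {λ i → not (τ i)} (Independent-not {λ i → not (σ i)} {τ} (Independent-sym {τ} (Independent-not {τ} (Independent-sym {σ} ind-στ))))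
            (cong not σj) (cong not τj)) k
      (by-sides σj σp) (by-sides σj σq) (by-sides σk σp) (by-sides σk σq) (cong₂ (λ a b → not a ∧ not b) σk τk)

    -- Circuit p, crossed by X, lies in Y, and circuit q, crossed by Y, lies in X. Hence all four
    -- crossings by edges of F survive in the intersection.
    hub-edge : ∀ e → f e ≡ true → ind (cross hub e) ≡ ind (cross X e) + ind (cross Y e)
    hub-edge e fe with rep (end₁ e) ≟ rep (c p) | rep (end₁ e) ≟ rep (c q)
    ... | yes a | _ = within (trans (side S′ p (p≢q ∘ c-injective) (end₁ e) a) τp)
                             (trans (side S′ p (p≢q ∘ c-injective) (end₂ e) (trans (sym (rep-edge fe)) a)) τp)
      where
      within : Y (end₁ e) ≡ true → Y (end₂ e) ≡ true → ind (cross hub e) ≡ ind (cross X e) + ind (cross Y e)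
      within y₁ y₂ rewrite y₁ | y₂ with X (end₁ e) | X (end₂ e)
      ... | true  | true  = refl
      ... | true  | false = refl
      ... | false | true  = refl
      ... | false | false = refl
    ... | no _ | yes b = within (trans (side S q (p≢q ∘ sym ∘ c-injective) (end₁ e) b) σq)
                                (trans (side S q (p≢q ∘ sym ∘ c-injective) (end₂ e) (trans (sym (rep-edge fe)) b)) σq)
      where
      within : X (end₁ e) ≡ true → X (end₂ e) ≡ true → ind (cross hub e) ≡ ind (cross X e) + ind (cross Y e)
      within y₁ y₂ rewrite y₁ | y₂ = refl
    ... | no a | no b = outside (uncrossed-edge S fe a) (uncrossed-edge S′ fe b)
      where
      outside : cross X e ≡ false → cross Y e ≡ false → ind (cross hub e) ≡ ind (cross X e) + ind (cross Y e)
      outside x y rewrite x | y | cross-false X {e} x | cross-false Y {e} y with X (end₂ e) ∧ Y (end₂ e)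
      ... | true  = refl
      ... | false = refl

    -- Four of the at most five boundary edges belong to F.
    hub-M : cut M hub ≤ 1
    hub-M = linear (cut every hub ∷ cut M hub ∷ cut f hub ∷ []) ((x₀ ≼ ‵ 5) ∷ (x₁ ⊕ x₂ ≼ x₀) ∷ (‵ 4 ≼ x₂) ∷ []) (x₁ ≼ ‵ 1) 0 (1 ∷ 1 ∷ 1 ∷ [])
      ( hub-small ∷ ≤-reflexive (sym (cut-split hub))
      ∷ ≤-reflexive (sym (trans (sum-cong-≗ λ e → pointwise (f e) (cross hub e) (cross X e) (cross Y e) (hub-edge e))
          (trans (sum-+ _ _) (cong₂ _+_ (two S) (two S′))))) ∷ [])
      where
      pointwise : ∀ a h x y → (a ≡ true → ind h ≡ ind x + ind y) → ind (a ∧ h) ≡ ind (a ∧ x) + ind (a ∧ y)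
      pointwise true  h x y g = g refl
      pointwise false h x y g = refl

  -- Three cuts A, B, C crossing distinct circuits u, v, w: the hubs A ∖ B, B ∖ C, C ∖ A
  -- form a ring containing these circuits and leaving at most three edges.
  no-ring : ∀ {α A u β B v γ C w} (SA : Six α A (rep (c u))) (SB : Six β B (rep (c v))) (SC : Six γ C (rep (c w))) →
    Independent α β → Independent β γ → Independent γ α → ∀ x →
    α u ≡ true → α v ≡ true → α w ≡ false → α x ≡ false →
    β u ≡ false → β v ≡ true → β w ≡ true → β x ≡ false →
    γ u ≡ true → γ v ≡ false → γ w ≡ true → γ x ≡ false → ⊥
  no-ring {α} {A} {u} {β} {B} {v} {γ} {C} {w} SA SB SC αβ βγ γα x αu αv αw αx βu βv βw βx γu γv γw γx =
    separation W u x (≤-trans W-small (s≤s (s≤s (s≤s z≤n)))) inside outside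
    where
    W : Fin #V → Bool
    W y = (A y ∧ not (B y)) ∨ (B y ∧ not (C y)) ∨ (C y ∧ not (A y))

    apart : ∀ {σ : Fin ω → Bool} {i j} → σ i ≡ true → σ j ≡ false → rep (c i) ≢ rep (c j)
    apart {σ} a b h = case trans (sym a) (trans (cong σ (c-injective h)) b) of λ ()

    u≢v : rep (c u) ≢ rep (c v)
    u≢v = apart {γ} γu γv
    v≢w : rep (c v) ≢ rep (c w)
    v≢w = apart {α} αv αw
    w≢u : rep (c w) ≢ rep (c u)
    w≢u = apart {β} βw βu

    one-hub : ∀ {σ X p τ Y q} → Six σ X (rep (c p)) → Six τ Y (rep (c q)) → rep (c p) ≢ rep (c q) → Independent σ τ →
      σ p ≡ true → σ q ≡ true → τ p ≡ false → τ q ≡ true → cut M (λ y → X y ∧ not (Y y)) ≤ 1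
    one-hub {σ} {τ = τ} S S′ p≢q i a b d e = hub-M S (Six-not S′) (compatible S (Six-not S′) p≢q) (Independent-not {σ} {τ} i) a b (cong not d) (cong not e)

    W-M : cut M W ≤ 3
    W-M = ≤-trans (subst (cut M W ≤_) (trans (sum-+ _ _) (cong (_+ cut M (λ y → C y ∧ not (A y))) (sum-+ _ _))) (sum-mono pointwise))
      (+-mono-≤ (+-mono-≤ (one-hub SA SB u≢v αβ αu αv βu βv) (one-hub SB SC v≢w βγ βv βw γv γw)) (one-hub SC SA w≢u γα γw γu αw αu))
      where
      pointwise : ∀ e → ind (M e ∧ cross W e) ≤ ind (M e ∧ cross (λ y → A y ∧ not (B y)) e) + ind (M e ∧ cross (λ y → B y ∧ not (C y)) e)
                        + ind (M e ∧ cross (λ y → C y ∧ not (A y)) e)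
      pointwise e = bools≤ 7
        (λ m a b d a′ b′ d′ → ind (m ∧ (((a ∧ not b) ∨ (b ∧ not d) ∨ (d ∧ not a)) xor ((a′ ∧ not b′) ∨ (b′ ∧ not d′) ∨ (d′ ∧ not a′)))))
        (λ m a b d a′ b′ d′ → ind (m ∧ ((a ∧ not b) xor (a′ ∧ not b′))) + ind (m ∧ ((b ∧ not d) xor (b′ ∧ not d′)))
                            + ind (m ∧ ((d ∧ not a) xor (d′ ∧ not a′))))
        (M e) (A (end₁ e)) (B (end₁ e)) (C (end₁ e)) (A (end₂ e)) (B (end₂ e)) (C (end₂ e))

    -- Circuit `u` is cut by `A` alone: its part in `A` lies in the hub `A` minus `B`, the rest in
    -- `C` minus `A`. The other two circuits are covered cyclically.
    W-u : ∀ y → rep y ≡ rep (c u) → W y ≡ true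
    W-u y h rewrite side SB u u≢v y h | βu | side SC u (w≢u ∘ sym) y h | γu = bools≡ 1 (λ a → (a ∧ true) ∨ false ∨ (true ∧ not a)) (λ a → true) (A y)
    W-v : ∀ y → rep y ≡ rep (c v) → W y ≡ true
    W-v y h rewrite side SA v (u≢v ∘ sym) y h | αv | side SC v v≢w y h | γv = bools≡ 1 (λ a → (true ∧ not a) ∨ (a ∧ true) ∨ (false ∧ false)) (λ a → true) (B y)
    W-w : ∀ y → rep y ≡ rep (c w) → W y ≡ true
    W-w y h rewrite side SA w w≢u y h | αw | side SB w (v≢w ∘ sym) y h | βw = bools≡ 1 (λ a → (false ∧ false) ∨ (true ∧ not a) ∨ (a ∧ true)) (λ a → true) (C y)

    W-F : cut f W ≡ 0
    W-F = sum-zero λ e → pointwise e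
      where
      uncrossing : ∀ e → f e ≡ true → W (end₁ e) ≡ W (end₂ e)
      uncrossing e fe with rep (end₁ e) ≟ rep (c u) | rep (end₁ e) ≟ rep (c v) | rep (end₁ e) ≟ rep (c w)
      ... | yes h | _ | _ = trans (W-u _ h) (sym (W-u _ (trans (sym (rep-edge fe)) h)))
      ... | no _ | yes h | _ = trans (W-v _ h) (sym (W-v _ (trans (sym (rep-edge fe)) h)))
      ... | no _ | no _ | yes h = trans (W-w _ h) (sym (W-w _ (trans (sym (rep-edge fe)) h)))
      ... | no a | no b | no d = cong₂ _∨_ (cong₂ (λ x y → x ∧ not y) A≡ B≡) (cong₂ _∨_ (cong₂ (λ x y → x ∧ not y) B≡ C≡) (cong₂ (λ x y → x ∧ not y) C≡ A≡))
        where
        A≡ = cross-false A {e} (uncrossed-edge SA fe a)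
        B≡ = cross-false B {e} (uncrossed-edge SB fe b)
        C≡ = cross-false C {e} (uncrossed-edge SC fe d)
      pointwise : ∀ e → ind (f e ∧ cross W e) ≡ 0
      pointwise e with f e in fe
      ... | false = refl
      ... | true  = cong ind (trans (cong (_xor W (end₂ e)) (uncrossing e fe)) (xor-same (W (end₂ e))))

    W-small : cut every W ≤ 3
    W-small = subst (_≤ 3) (sym (trans (cut-split W) (trans (cong (cut M W +_) W-F) (ℕₚ.+-identityʳ (cut M W))))) W-M

    inside : ∀ y → rep y ≡ rep (c u) → W y ≡ true
    inside = W-u
    outside : ∀ y → rep y ≡ rep (c x) → W y ≡ false
    outside y h rewrite side SA x (apart {α} αu αx ∘ sym) y h | αx | side SB x (apart {β} βv βx ∘ sym) y h | βx
      | side SC x (apart {γ} γw γx ∘ sym) y h | γx = refl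

-- Violated cuts as cuts of six edges, and links inside a hub

module Matched (𝒮 : Setting) where
  open Setting 𝒮
  open Joins 𝒮
  open Signings 𝒮
  open BadCuts 𝒮
  open SixCuts 𝒮
  open Hubs 𝒮

  module _ {z : Fin ω → Fin #V} (tr : Transversal z) (P : NearPerfect z) where
    open NearPerfect P

    -- On a circuit, N covers all vertices of Q except the `z i`. The N-edges leaving Q there are
    -- all the edges of the circuit that leave Q, an even number, so the parity is that of the
    -- number of `z i` in Q.
    quadrant-parity : ∀ Q → (∀ {e} → f e ≡ true → cross Q e ≡ true → N e ≡ true) → ∀ r → parity Q r ≡ sides-in (λ i → Q (z i)) r
    quadrant-parity Q F⊆N r = begin
      odd (size Qr)                                               ≡⟨ cong odd (N-degree-split tr P Qr) ⟨
      odd (sum (λ v → ind (Qr v) * deg N v) + z-count tr P Qr)    ≡⟨ odd-+ (sum λ v → ind (Qr v) * deg N v) _ ⟩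
      odd (sum (λ v → ind (Qr v) * deg N v)) xor odd (z-count tr P Qr)
        ≡⟨ cong (_xor odd (z-count tr P Qr)) (trans (sym (odd-cut N Qr)) (trans (cong odd same-cut) (cut-F-even Qr))) ⟩
      odd (z-count tr P Qr)                                       ≡⟨ odd-cong (λ i → cong (λ x → Q (z i) ∧ (x == r)) (tr i)) ⟩
      sides-in (λ i → Q (z i)) r                                  ∎
      where
      Qr : Fin #V → Bool
      Qr v = Q v ∧ comp r v
      same-cut : cut N Qr ≡ cut f Qr
      same-cut = sum-cong-≗ λ e → pointwise e
        where
        agree-N : ∀ e → f e ≡ true → cross Qr e ≡ true → N e ≡ true
        agree-N e fe ce = F⊆N fe (inner (Q (end₁ e)) (Q (end₂ e)) (comp r (end₁ e)) (trans (cong (λ x → Qr (end₁ e) xor (Q (end₂ e) ∧ (x == r))) (rep-edge fe)) ce))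
          where
          inner : ∀ a b x → (a ∧ x) xor (b ∧ x) ≡ true → a xor b ≡ true
          inner true  false x     p = refl
          inner false true  x     p = refl
          inner true  true  true  ()
          inner true  true  false ()
          inner false false x     ()
        pointwise : ∀ e → ind (N e ∧ cross Qr e) ≡ ind (f e ∧ cross Qr e)
        pointwise e with cross Qr e in ce | f e in fe | N e in Ne
        ... | false | a     | b     = cong ind (bools≡ 2 (λ a b → b ∧ false) (λ a b → a ∧ false) a b)
        ... | true  | true  | true  = refl
        ... | true  | false | false = refl
        ... | true  | true  | false = case trans (sym (agree-N e fe ce)) Ne of λ ()
        ... | true  | false | true  = case trans (sym (N⊆F e Ne)) fe of λ ()

    BadCut-not : ∀ {s X} → BadCut tr P s X → BadCut tr P (neg s) (λ v → not (X v))
    BadCut-not {s} {X} b = record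
      { four  = four
      ; cut-M = trans (cut-complement M X) cut-M
      ; cut-N = trans (cut-complement N X) cut-N
      ; F⊆N   = λ {e} fe ce → F⊆N fe (trans (sym (uncomplement e)) ce)
      ; sides = λ i → cong not (sides i)
      ; tight = λ {e} Ne ce → let p , q = tight Ne (trans (sym (uncomplement e)) ce) in cong not p , cong not q }
      where
      open BadCut b
      uncomplement : ∀ e → cross (λ v → not (X v)) e ≡ cross X e
      uncomplement e = xor-annihilates-not (X (end₁ e)) (X (end₂ e))

    BadCut-flip : ∀ b {s X} → BadCut tr P s X → BadCut tr P (flip b s) (flip b X)
    BadCut-flip true  h = BadCut-not h
    BadCut-flip false h = h

    Coloured-flip : ∀ b {s} → Coloured tr P s → Coloured tr P (flip b s)
    Coloured-flip true {s} (p , q) = Alternating-neg {M} {s} p , Alternating-neg {N} {s} q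
    Coloured-flip false h = h

    bad-cut-F : ∀ {s X} → BadCut tr P s X → cut f X ≡ 2
    bad-cut-F {s} {X} b = trans (sum-cong-≗ λ e → pointwise e) cut-N
      where
      open BadCut b
      pointwise : ∀ e → ind (f e ∧ cross X e) ≡ ind (N e ∧ cross X e)
      pointwise e with cross X e in ce | f e in fe | N e in Ne
      ... | false | a     | b     = cong ind (∧-false a b)
      ... | true  | true  | true  = refl
      ... | true  | false | false = refl
      ... | true  | true  | false = case trans (sym (F⊆N fe ce)) Ne of λ ()
      ... | true  | false | true  = case trans (sym (N⊆F e Ne)) fe of λ ()

    -- Every circuit crosses the boundary an even number of times, so the two crossing edges of F
    -- share a circuit.
    bad⇒six′ : ∀ {s X} → BadCut tr P s X → ∃[ r ] Six (λ i → X (z i)) X r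
    bad⇒six′ {s} {X} b with sum-positive (λ e → ind (f e ∧ cross X e)) (subst (0 <_) (sym (bad-cut-F b)) (s≤s z≤n))
    ... | e₀ , pos = r , record
      { six = trans (cut-split X) (cong₂ _+_ (BadCut.cut-M b) (bad-cut-F b))
      ; two = bad-cut-F b
      ; par = quadrant-parity X (BadCut.F⊆N b)
      ; crossing = λ {e} fe ce → one-circuit fe ce }
      where
      r : Fin #V
      r = rep (end₁ e₀)
      here-edges there-edges : Fin #E → Bool
      here-edges  e = f e ∧ comp r (end₁ e)
      there-edges e = f e ∧ not (comp r (end₁ e))
      e₀-crosses : f e₀ ≡ true × cross X e₀ ≡ true
      e₀-crosses = ∧-true (positive pos)
        where
        positive : ∀ {b} → 0 < ind b → b ≡ true
        positive {true} _ = refl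
      here-cut : cut here-edges X ≡ cut f (λ v → X v ∧ comp r v)
      here-cut = sum-cong-≗ λ e → pointwise e
        where
        pointwise : ∀ e → ind ((f e ∧ comp r (end₁ e)) ∧ cross X e) ≡ ind (f e ∧ ((X (end₁ e) ∧ comp r (end₁ e)) xor (X (end₂ e) ∧ comp r (end₂ e))))
        pointwise e with f e in fe
        ... | false = refl
        ... | true rewrite rep-edge fe = cong ind (bools≡ 3 (λ x a b → x ∧ (a xor b)) (λ x a b → (a ∧ x) xor (b ∧ x)) (comp r (end₂ e)) (X (end₁ e)) (X (end₂ e)))
      here≥2 : 2 ≤ cut here-edges X
      here≥2 = at-least (cut here-edges X) (cut-positive here-edges X (cong₂ _∧_ (proj₁ e₀-crosses) (==-refl r)) (proj₂ e₀-crosses))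
        (trans (cong odd here-cut) (cut-F-even (λ v → X v ∧ comp r v)))
        where
        at-least : ∀ k → 0 < k → odd k ≡ false → 2 ≤ k
        at-least (suc (suc k)) _ _ = s≤s (s≤s z≤n)
        at-least (suc zero) _ ()
      split : cut here-edges X + cut there-edges X ≡ 2
      split = trans (sym (sum-+ _ _)) (trans (sum-cong-≗ λ e → pointwise (f e) (comp r (end₁ e)) (cross X e)) (bad-cut-F b))
        where
        pointwise : ∀ a x y → ind ((a ∧ x) ∧ y) + ind ((a ∧ not x) ∧ y) ≡ ind (a ∧ y)
        pointwise true  true  y = ℕₚ.+-identityʳ _
        pointwise true  false y = refl
        pointwise false x     y = refl
      there≡0 : cut there-edges X ≡ 0
      there≡0 = ℕₚ.n≤0⇒n≡0 (linear (cut here-edges X ∷ cut there-edges X ∷ []) ((‵ 2 ≼ x₀) ∷ (x₀ ⊕ x₁ ≼ ‵ 2) ∷ []) (x₁ ≼ ‵ 0) 0 (1 ∷ 1 ∷ []) (here≥2 ∷ ≤-reflexive split ∷ []))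
      one-circuit : ∀ {e} → f e ≡ true → cross X e ≡ true → rep (end₁ e) ≡ r
      one-circuit {e} fe ce with rep (end₁ e) ≟ r
      ... | yes h = h
      ... | no h  = case trans (sym ce) (not-crossing there-edges X there≡0 {e} (cong₂ (λ a b → a ∧ not b) fe (==-≢ h))) of λ ()

    abstract
      bad⇒six : ∀ {s X} → BadCut tr P s X → ∃[ r ] Six (λ i → X (z i)) X r
      bad⇒six = bad⇒six′

    -- An edge of F leaving the quadrant crosses X or Y and so belongs to the matching N that both
    -- cuts share.
    bad-compatible : ∀ {s X t Y} → BadCut tr P s X → BadCut tr P t Y → Compatible (λ i → X (z i)) X (λ i → Y (z i)) Y
    bad-compatible {X = X} {Y = Y} b b′ = quadrant-parity (λ v → X v ∧ Y v) λ {e} fe ce →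
      from (X (end₁ e)) (X (end₂ e)) (Y (end₁ e)) (Y (end₂ e)) (BadCut.F⊆N b fe) (BadCut.F⊆N b′ fe) ce
      where
      from : ∀ a b x y {A : Set} → (a xor b ≡ true → A) → (x xor y ≡ true → A) → (a ∧ x) xor (b ∧ y) ≡ true → A
      from true  false x     y     g h p = g refl
      from false true  x     y     g h p = g refl
      from true  true  x     y     g h p = h p
      from false false x     y     g h ()

  -- A hub contains vertices of its two circuits, of opposite signs, that are joined by a
  -- path of M-edges and N-edges on even circuits.

  on-odd : Fin #V → Bool
  on-odd v = does (any? λ i → rep (c i) ≟ rep v)

  on-odd-rep : ∀ {u v} → rep u ≡ rep v → on-odd u ≡ on-odd v
  on-odd-rep p = cong (λ r → does (any? λ i → rep (c i) ≟ r)) p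

  on-odd-c : ∀ {v} i → rep (c i) ≡ rep v → on-odd v ≡ true
  on-odd-c {v} i p = dec-true (any? λ i → rep (c i) ≟ rep v) (i , p)

  -- N-edges of odd circuits are left out because a change of transversal replaces them; links have
  -- to survive that change.
  links : (Fin #E → Bool) → Subset #E
  links N = tabulate λ e → M e ∨ (N e ∧ not (on-odd (end₁ e)))

  module Link (N : Fin #E → Bool) where
    module L = Components G (links N)

    link-M : ∀ {e} → M e ≡ true → L.rep (end₁ e) ≡ L.rep (end₂ e)
    link-M {e} Me = L.rep-edge (trans (lookup∘tabulate _ e) (cong (λ b → b ∨ (N e ∧ not (on-odd (end₁ e)))) Me))

    link-N : ∀ {e} → N e ≡ true → on-odd (end₁ e) ≡ false → L.rep (end₁ e) ≡ L.rep (end₂ e)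
    link-N {e} Ne oe = L.rep-edge (trans (lookup∘tabulate _ e)
      (trans (cong₂ (λ a b → M e ∨ (a ∧ not b)) Ne oe) (∨-zeroʳ (M e))))

    linked : ∀ {A : Set} (g : Fin #V → A) → (∀ e → M e ≡ true → g (end₁ e) ≡ g (end₂ e)) →
      (∀ e → N e ≡ true → on-odd (end₁ e) ≡ false → g (end₁ e) ≡ g (end₂ e)) → ∀ {u v} → L.rep u ≡ L.rep v → g u ≡ g v
    linked g gM gN p = Eq.gfold isEquivalence g (λ where (e , e∈ , refl , refl) → edge e (trans (sym (lookup∘tabulate _ e)) ([]=⇒lookup e∈))) (L.rep⇒connected p)
      where
      edge : ∀ e → M e ∨ (N e ∧ not (on-odd (end₁ e))) ≡ true → g (end₁ e) ≡ g (end₂ e)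
      edge e h with M e in Me | N e in Ne | on-odd (end₁ e) in oe
      ... | true  | _    | _     = gM e Me
      ... | false | true | false = gN e Ne oe

  module _ {z : Fin ω → Fin #V} (tr : Transversal z) (P : NearPerfect z) {s X t Y : Fin #V → Bool} {p q : Fin ω}
    (col : Coloured tr P t) (bX : BadCut tr P s X) (bY : BadCut tr P t Y)
    (SX : Six (λ i → X (z i)) X (rep (c p))) (SY : Six (λ i → Y (z i)) Y (rep (c q)))
    (indep : Independent (λ i → X (z i)) (λ i → Y (z i)))
    (Xp : X (z p) ≡ true) (Xq : X (z q) ≡ true) (Yp : Y (z p) ≡ true) (Yq : Y (z q) ≡ false) where
    open NearPerfect P
    open Link N

    private
      H : Fin #V → Bool
      H v = X v ∧ Y v
      H-M : cut M H ≤ 1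
      H-M = hub-M SX SY (bad-compatible tr P bX bY) indep Xp Xq Yp Yq

    Connection : Set
    Connection = ∃[ x ] ∃[ v ] rep x ≡ rep (c q) × rep v ≡ rep (c p) × L.rep x ≡ L.rep v × t v ≡ not (t x)

    private
      seeds : Fin #V → Bool
      seeds x = comp (rep (c q)) x ∧ H x
      -- The part of the hub linked to a positive seed. Without a connection it would have two more
      -- positive than negative vertices, although at most one M-edge leaves it.
      B : Fin #V → Bool
      B v = H v ∧ does (any? λ x → (seeds x ∧ t x) ∧ (L.rep x == L.rep v) ≟ᵇ true)

      B-link : ∀ {u v} → H u ≡ H v → L.rep u ≡ L.rep v → B u ≡ B v
      B-link h p = cong₂ (λ a r → a ∧ does (any? λ x → (seeds x ∧ t x) ∧ (L.rep x == r) ≟ᵇ true)) h p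

      B⊆H : ∀ {v} → B v ≡ true → H v ≡ true
      B⊆H h = proj₁ (∧-true h)

      B-M : cut M B ≤ cut M H
      B-M = sum-mono λ e → pointwise e
        where
        pointwise : ∀ e → ind (M e ∧ cross B e) ≤ ind (M e ∧ cross H e)
        pointwise e with M e in Me | cross H e in ch
        ... | false | _     = z≤n
        ... | true  | true  = ind≤1 _
        ... | true  | false = ≤-reflexive (cong ind (trans (cong (_xor B (end₂ e)) (B-link (cross-false H {e} ch) (link-M Me)))
                                (xor-same (B (end₂ e)))))

      Bₑ Bₒ : Fin #V → Bool
      Bₑ v = B v ∧ not (on-odd v)
      Bₒ v = B v ∧ on-odd v

      Nₑ : Fin #E → Bool
      Nₑ e = N e ∧ not (on-odd (end₁ e))

      Nₑ-degree : ∀ v → Bₑ v ≡ true → deg Nₑ v ≡ 1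
      Nₑ-degree v h = trans (sum-cong-≗ λ e → pointwise e) (trans (sym (ℕₚ.+-identityʳ (deg N v)))
          (trans (cong (deg N v +_) (sym (mark-other tr unmarked-v))) (N-degree v)))
        where
        even-v : on-odd v ≡ false
        even-v = not-injective (proj₂ (∧-true h))
        unmarked-v : ∀ i → z i ≢ v
        unmarked-v i refl = case trans (sym even-v) (on-odd-c i (sym (tr i))) of λ ()
        pointwise : ∀ e → ind (Nₑ e) * (ind (end₁ e == v) + ind (end₂ e == v)) ≡ ind (N e) * (ind (end₁ e == v) + ind (end₂ e == v))
        pointwise e with N e in Ne | end₁ e ≟ v | end₂ e ≟ v
        ... | false | _ | _ = refl
        ... | true | yes refl | _ rewrite even-v = refl
        ... | true | no _ | yes refl rewrite on-odd-rep (rep-edge (N⊆F e Ne)) | even-v = refl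
        ... | true | no _ | no _ = ℕₚ.*-zeroʳ (ind (not (on-odd (end₁ e))))

      hub-crossing : ∀ {e} → f e ≡ true → cross H e ≡ true → on-odd (end₁ e) ≡ true
      hub-crossing {e} fe ch with on-odd (end₁ e) in oe
      ... | true  = refl
      ... | false = case trans (sym ch) (trans (cong (_xor H (end₂ e)) (cong₂ _∧_ (cross-false X {e} (uncrossed-edge SX fe (away p))) (cross-false Y {e} (uncrossed-edge SY fe (away q)))))
                      (xor-same (H (end₂ e)))) of λ ()
        where
        away : ∀ i → rep (end₁ e) ≢ rep (c i)
        away i h = case trans (sym oe) (on-odd-c i (sym h)) of λ ()

      Nₑ-cut : cut Nₑ Bₑ ≡ 0
      Nₑ-cut = sum-zero λ e → pointwise e
        where
        pointwise : ∀ e → ind ((N e ∧ not (on-odd (end₁ e))) ∧ cross Bₑ e) ≡ 0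
        pointwise e with N e in Ne | on-odd (end₁ e) in oe
        ... | false | _     = refl
        ... | true  | true  = refl
        ... | true  | false = cong ind (trans (cong (_xor Bₑ (end₂ e)) (cong₂ (λ a b → a ∧ not b)
              (B-link H≡ (link-N Ne oe)) (trans (sym oe) (on-odd-rep (rep-edge (N⊆F e Ne)))))) (xor-same (Bₑ (end₂ e))))
          where
          H≡ : H (end₁ e) ≡ H (end₂ e)
          H≡ with cross H e in ch
          ... | false = cross-false H {e} ch
          ... | true  = case trans (sym oe) (hub-crossing (N⊆F e Ne) ch) of λ ()

      -- The edges of F leaving the hub lie on odd circuits, and N-edges of even circuits are links,
      -- so N matches this part of B within itself.
      even-balance : size (λ v → Bₑ v ∧ neg t v) ≤ size (λ v → Bₑ v ∧ t v)
      even-balance = subst (size (λ v → Bₑ v ∧ neg t v) ≤_) (trans (cong (size (λ v → Bₑ v ∧ t v) +_) Nₑ-cut) (ℕₚ.+-identityʳ _))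
        (excess≥ {Nₑ} {t} Bₑ Nₑ-degree (λ e Ne → proj₂ col e (proj₁ (∧-true Ne))))

      seed-degree : ∀ v → seeds v ≡ true → deg N v ≡ 1
      seed-degree v h = trans (sym (ℕₚ.+-identityʳ (deg N v))) (trans (cong (deg N v +_) (sym (mark-other tr unmarked-v))) (N-degree v))
        where
        unmarked-v : ∀ i → z i ≢ v
        unmarked-v i refl = case trans (sym (proj₂ (∧-true {X (z i)} (proj₂ (∧-true {comp (rep (c q)) (z i)} h))))) (trans (cong (λ j → Y (z j)) i≡q) Yq) of λ ()
          where
          i≡q : i ≡ q
          i≡q = c-injective (trans (sym (tr i)) (==-true (proj₁ (∧-true {comp (rep (c q)) (z i)} h))))

      -- `z q` lies outside Y, so N covers every seed. N-edges between seeds cancel, and the two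
      -- N-edges by which circuit q leaves Y have their positive ends inside, by `tight`.
      seed-excess : size (λ v → seeds v ∧ neg t v) + 2 ≤ size (λ v → seeds v ∧ t v)
      seed-excess = subst₂ _≤_
        (trans (sum-+ _ _) (cong₂ _+_ (trans (sym (handshake N (λ v → ind (seeds v ∧ neg t v)))) (size-unit {N} (λ v → seeds v ∧ neg t v) (λ v h → seed-degree v (proj₁ (∧-true h)))))
          (bad-cut-F tr P bY)))
        (trans (sym (handshake N (λ v → ind (seeds v ∧ t v)))) (size-unit {N} (λ v → seeds v ∧ t v) (λ v h → seed-degree v (proj₁ (∧-true h)))))
        (sum-mono λ e → pointwise e)
        where
        on-q : ∀ a b y₁ y₂ t₁ t₂ → t₂ ≡ not t₁ → (y₁ xor y₂ ≡ true → y₁ ≡ t₁ × y₂ ≡ t₂) → a ≡ y₁ → b ≡ y₂ →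
          1 * (ind (a ∧ not t₁) + ind (b ∧ not t₂)) + ind (y₁ xor y₂) ≤ 1 * (ind (a ∧ t₁) + ind (b ∧ t₂))
        on-q a b true  true  t₁ t₂ refl h refl refl = bools≤ 1 (λ t → 1 * (ind (not t) + ind (not (not t))) + 0) (λ t → 1 * (ind t + ind (not t))) t₁
        on-q a b false false t₁ t₂ refl h refl refl = z≤n
        on-q a b true  false t₁ t₂ r    h refl refl with h refl
        ... | refl , refl = s≤s z≤n
        on-q a b false true  t₁ t₂ r    h refl refl with h refl
        ... | refl , refl = s≤s z≤n
        q≢p : q ≢ p
        q≢p refl = case trans (sym Yp) Yq of λ ()
        seed-Y : ∀ {v} → rep v ≡ rep (c q) → seeds v ≡ Y v
        seed-Y {v} g = cong₂ (λ a b → a ∧ b ∧ Y v) (trans (cong (_== rep (c q)) g) (==-refl (rep (c q))))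
          (trans (side SX q (λ k → q≢p (c-injective k)) v g) Xq)
        out : ∀ {v} → rep v ≢ rep (c q) → seeds v ≡ false
        out {v} g = cong (_∧ H v) (==-≢ g)
        bool? : ∀ b → b ≡ true ⊎ b ≡ false
        bool? true  = inj₁ refl
        bool? false = inj₂ refl
        no-N : ∀ e → N e ≡ false → ∀ u → signed N seeds u e ≡ 0
        no-N e Ne u = cong (λ b → ind b * (ind (seeds (end₁ e) ∧ u (end₁ e)) + ind (seeds (end₂ e) ∧ u (end₂ e)))) Ne
        unless-N : ∀ e → N e ≡ false → f e ∧ cross Y e ≡ false
        unless-N e Ne with f e in fe | cross Y e in cy
        ... | false | _     = refl
        ... | true  | false = refl
        ... | true  | true  = case trans (sym (BadCut.F⊆N bY fe cy)) Ne of λ ()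
        vanish : ∀ e → f e ≡ true → rep (end₁ e) ≢ rep (c q) → ∀ u → signed N seeds u e ≡ 0
        vanish e fe h u = trans (cong₂ (λ a b → ind (N e) * (ind (a ∧ u (end₁ e)) + ind (b ∧ u (end₂ e)))) (out h) (out (λ g → h (trans (rep-edge fe) g)))) (ℕₚ.*-zeroʳ (ind (N e)))
        cases : ∀ e → Dec (rep (end₁ e) ≡ rep (c q)) → N e ≡ true ⊎ N e ≡ false →
          signed N seeds (neg t) e + ind (f e ∧ cross Y e) ≤ signed N seeds t e
        cases e _ (inj₂ Ne) = subst₂ _≤_ (sym (cong₂ _+_ (no-N e Ne (neg t)) (cong ind (unless-N e Ne)))) (sym (no-N e Ne t)) z≤n
        cases e (no h) (inj₁ Ne) = subst₂ _≤_ (sym (cong₂ _+_ (vanish e (N⊆F e Ne) h (neg t))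
            (cong ind (trans (cong (_∧ cross Y e) (N⊆F e Ne)) (uncrossed-edge SY (N⊆F e Ne) h))))) (sym (vanish e (N⊆F e Ne) h t)) z≤n
        cases e (yes h) (inj₁ Ne) = subst₂ (λ n x → ind n * (ind (seeds (end₁ e) ∧ neg t (end₁ e)) + ind (seeds (end₂ e) ∧ neg t (end₂ e))) + ind (x ∧ cross Y e)
              ≤ ind n * (ind (seeds (end₁ e) ∧ t (end₁ e)) + ind (seeds (end₂ e) ∧ t (end₂ e)))) (sym Ne) (sym (N⊆F e Ne))
            (on-q _ _ (Y (end₁ e)) (Y (end₂ e)) (t (end₁ e)) (t (end₂ e)) (proj₂ col e Ne) (BadCut.tight bY Ne)
                (seed-Y h) (seed-Y (trans (sym (rep-edge (N⊆F e Ne))) h)))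
        pointwise : ∀ e → signed N seeds (neg t) e + ind (f e ∧ cross Y e) ≤ signed N seeds t e
        pointwise e = cases e (rep (end₁ e) ≟ rep (c q)) (bool? (N e))

    connection′ : Connection
    connection′ with any? (λ x → any? λ v → ((comp (rep (c q)) x ∧ comp (rep (c p)) v) ∧ (L.rep x == L.rep v)) ∧ (t v xor t x) ≟ᵇ true)
    ... | yes (x , v , h) = let h₁ , h₂ = ∧-true h ; h₃ , h₄ = ∧-true h₁ ; h₅ , h₆ = ∧-true h₃ in
          x , v , ==-true h₅ , ==-true h₆ , ==-true h₄ , opposite h₂
      where
      opposite : ∀ {a b} → a xor b ≡ true → a ≡ not b
      opposite {true}  {false} _ = refl
      opposite {false} {true}  _ = refl
    -- On circuit q all positive seeds lie in B, on circuit p all of B is positive by `none`, and no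
    -- other odd circuit meets the hub. So the surplus 2 of the seeds passes to B, while the count
    -- along M allows 1.
    ... | no none = ⊥-elim (ℕₚ.<-irrefl refl (linear
        ( size (λ v → B v ∧ t v) ∷ size (λ v → B v ∧ neg t v) ∷ cut M B ∷ size (λ v → Bₑ v ∧ t v) ∷ size (λ v → Bₑ v ∧ neg t v)
        ∷ size (λ v → Bₒ v ∧ t v) ∷ size (λ v → Bₒ v ∧ neg t v) ∷ size (λ v → seeds v ∧ t v) ∷ size (λ v → seeds v ∧ neg t v) ∷ [])
        ( (x₀ ≼ x₁ ⊕ x₂) ∷ (x₂ ≼ ‵ 1) ∷ (x₄ ≼ x₃) ∷ (x₈ ⊕ ‵ 2 ≼ x₇) ∷ (x₇ ⊕ x₆ ≼ x₅ ⊕ x₈) ∷ (x₃ ⊕ x₅ ≼ x₀) ∷ (x₁ ≼ x₄ ⊕ x₆) ∷ [])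
        (‵ 1 ≼ ‵ 0) 0 (1 ∷ 1 ∷ 1 ∷ 1 ∷ 1 ∷ 1 ∷ 1 ∷ [])
        ( excess≤ {M} {t} B (λ v _ → M-degree v) (proj₁ col)
        ∷ ≤-trans B-M H-M ∷ even-balance ∷ seed-excess
        ∷ subst₂ _≤_ (sum-+ _ _) (sum-+ _ _) (sum-mono odd-pointwise)
        ∷ ≤-reflexive (split t) ∷ ≤-reflexive (sym (split (neg t))) ∷ [])))
      where
      split : ∀ u → size (λ v → Bₑ v ∧ u v) + size (λ v → Bₒ v ∧ u v) ≡ size (λ v → B v ∧ u v)
      split u = trans (sym (sum-+ _ _)) (sum-cong-≗ λ v → pointwise (B v) (on-odd v) (u v))
        where
        pointwise : ∀ a b x → ind ((a ∧ not b) ∧ x) + ind ((a ∧ b) ∧ x) ≡ ind (a ∧ x)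
        pointwise true  true  x = refl
        pointwise true  false x = ℕₚ.+-identityʳ _
        pointwise false b     x = refl
      seed-in-B : ∀ {v} → seeds v ≡ true → t v ≡ true → Bₒ v ≡ true
      seed-in-B {v} h tv = cong₂ _∧_ (cong₂ _∧_ (proj₂ (∧-true {comp (rep (c q)) v} h))
          (dec-true (any? λ x → (seeds x ∧ t x) ∧ (L.rep x == L.rep v) ≟ᵇ true) (v , cong₂ _∧_ (cong₂ _∧_ h tv) (==-refl (L.rep v)))))
        (on-odd-c q (sym (==-true (proj₁ (∧-true {comp (rep (c q)) v} h)))))
      p-positive : ∀ {v} → B v ≡ true → rep v ≡ rep (c p) → t v ≡ true
      p-positive {v} h pv with does-true (any? λ x → (seeds x ∧ t x) ∧ (L.rep x == L.rep v) ≟ᵇ true) (proj₂ (∧-true {H v} h)) | t v in tv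
      ... | _ | true = refl
      ... | x , k | false = let k₁ , k₂ = ∧-true {seeds x ∧ t x} k ; k₃ , k₄ = ∧-true {seeds x} k₁ in
        ⊥-elim (none (x , v , cong₂ _∧_ (cong₂ _∧_ (cong₂ _∧_ (proj₁ (∧-true {comp (rep (c q)) x} k₃)) (trans (cong (_== rep (c p)) pv) (==-refl (rep (c p))))) k₂)
          (cong₂ _xor_ tv k₄)))
      other-positive : ∀ {v} → Bₒ v ≡ true → seeds v ≡ false → t v ≡ true
      other-positive {v} h not-seed with does-true (any? λ i → rep (c i) ≟ rep v) (proj₂ (∧-true {B v} h))
      ... | i , iv with i ≟ q | i ≟ p
      ...   | yes refl | _ = case trans (sym (cong₂ _∧_ (trans (cong (_== rep (c i)) (sym iv)) (==-refl (rep (c i)))) (B⊆H (proj₁ (∧-true {B v} h))))) not-seed of λ ()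
      ...   | no _ | yes refl = p-positive (proj₁ (∧-true {B v} h)) (sym iv)
      ...   | no i≢q | no i≢p = ⊥-elim (i≢p (proj₁ indep i p
              (trans (sym (side SX i (λ k → i≢p (c-injective k)) v (sym iv))) (trans (proj₁ (∧-true {X v} Hv)) (sym Xp)))
              (trans (sym (side SY i (λ k → i≢q (c-injective k)) v (sym iv))) (trans (proj₂ (∧-true {X v} Hv)) (sym Yp)))))
        where
        Hv : H v ≡ true
        Hv = B⊆H (proj₁ (∧-true {B v} h))
      odd-pointwise : ∀ v → ind (seeds v ∧ t v) + ind (Bₒ v ∧ neg t v) ≤ ind (Bₒ v ∧ t v) + ind (seeds v ∧ neg t v)
      odd-pointwise v = table (seeds v) (t v) (Bₒ v) seed-in-B other-positive
        where
        table : ∀ a u b → (a ≡ true → u ≡ true → b ≡ true) → (b ≡ true → a ≡ false → u ≡ true) →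
          ind (a ∧ u) + ind (b ∧ not u) ≤ ind (b ∧ u) + ind (a ∧ not u)
        table true  true  b     g h rewrite g refl refl = s≤s z≤n
        table true  false true  g h = s≤s z≤n
        table true  false false g h = z≤n
        table false true  b     g h = subst (_≤ ind (b ∧ true) + 0) (cong ind (bools≡ 1 (λ a → false) (λ a → a ∧ false) b)) z≤n
        table false false true  g h = case h refl refl of λ ()
        table false false false g h = z≤n

    abstract
      connection : Connection
      connection = connection′

-- Pairings of the four odd circuits

four-indices : ∀ {n} → n ≡ 4 → Σ[ a ∈ Fin n ] Σ[ b ∈ Fin n ] Σ[ c ∈ Fin n ] Σ[ d ∈ Fin n ]
  (a ≢ b × a ≢ c × a ≢ d × b ≢ c × b ≢ d × c ≢ d) × (∀ i → (i ≡ a ⊎ i ≡ b) ⊎ (i ≡ c ⊎ i ≡ d))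
four-indices refl = zero , suc zero , suc (suc zero) , suc (suc (suc zero)) ,
  ((λ ()) , (λ ()) , (λ ()) , (λ ()) , (λ ()) , (λ ())) , λ where
    zero                         → inj₁ (inj₁ refl)
    (suc zero)                   → inj₁ (inj₂ refl)
    (suc (suc zero))             → inj₂ (inj₁ refl)
    (suc (suc (suc zero)))       → inj₂ (inj₂ refl)

module Pairing {n : ℕ} {a b c d : Fin n} (a≢b : a ≢ b) (a≢c : a ≢ c) (a≢d : a ≢ d) (b≢c : b ≢ c) (b≢d : b ≢ d) (c≢d : c ≢ d) where

  pair : Fin n → Fin n
  pair = (((((λ i → i) [ a ≔ b ]) [ b ≔ a ]) [ c ≔ d ]) [ d ≔ c ])

  pair-a : pair a ≡ b
  pair-a = trans (update-there _ _ (a≢d ∘ sym)) (trans (update-there _ _ (a≢c ∘ sym)) (trans (update-there _ _ (a≢b ∘ sym)) (update-here _ a b)))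
  pair-b : pair b ≡ a
  pair-b = trans (update-there _ _ (b≢d ∘ sym)) (trans (update-there _ _ (b≢c ∘ sym)) (update-here _ b a))
  pair-c : pair c ≡ d
  pair-c = trans (update-there _ _ (c≢d ∘ sym)) (update-here _ c d)
  pair-d : pair d ≡ c
  pair-d = update-here _ d c

  pair-involutive : Involutive pair
  pair-involutive i with a ≟ i | b ≟ i | c ≟ i | d ≟ i
  ... | yes refl | _ | _ | _ = trans (cong pair pair-a) pair-b
  ... | no _ | yes refl | _ | _ = trans (cong pair pair-b) pair-a
  ... | no _ | no _ | yes refl | _ = trans (cong pair pair-c) pair-d
  ... | no _ | no _ | no _ | yes refl = trans (cong pair pair-d) pair-c
  ... | no p | no q | no r | no s = trans (cong pair fixed) fixed
    where
    fixed : pair i ≡ i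
    fixed = trans (update-there _ _ s) (trans (update-there _ _ r) (trans (update-there _ _ q) (update-there _ _ p)))

-- Two choices of transversal and the elimination of all positions

module Assembly (𝒮 : Setting) where
  open Setting 𝒮
  open Joins 𝒮
  open Signings 𝒮
  open BadCuts 𝒮
  open SixCuts 𝒮
  open Hubs 𝒮
  open Matched 𝒮

  Flow : Set
  Flow = NowhereZeroFlow G 5

  -- A signing in which z a , z b and z c , z d have opposite signs.
  opposed : ∀ {z} (tr : Transversal z) (P : NearPerfect z) {a b c d} →
    a ≢ b → a ≢ c → a ≢ d → b ≢ c → b ≢ d → c ≢ d →
    Flow ⊎ (∃[ s ] ∃[ X ] BadCut tr P s X × Coloured tr P s × s (z b) ≡ not (s (z a)) × s (z d) ≡ not (s (z c)))
  opposed {z} tr P {a} {b} {c} {d} a≢b a≢c a≢d b≢c b≢d c≢d with signing tr P pair pair-involutive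
    where open Pairing a≢b a≢c a≢d b≢c b≢d c≢d
  ... | s , sM , sN , sz with flow-or-bad-cut tr P {s} (sM , sN)
  ...   | inj₁ flow    = inj₁ flow
  ...   | inj₂ (X , b) = inj₂ (s , X , b , (sM , sN)
          , trans (cong (s ∘ z) (sym pair-a)) (sz _ λ p → a≢b (trans (sym p) pair-a))
          , trans (cong (s ∘ z) (sym pair-c)) (sz _ λ p → c≢d (trans (sym p) pair-c)))
    where open Pairing a≢b a≢c a≢d b≢c b≢d c≢d

  Independent-resp : ∀ {σ τ σ′ τ′} → (∀ i → σ i ≡ σ′ i) → (∀ i → τ i ≡ τ′ i) → Independent σ τ → Independent σ′ τ′
  Independent-resp p q (inj , sur) =
      (λ i j a b → inj i j (trans (p i) (trans a (sym (p j)))) (trans (q i) (trans b (sym (q j)))))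
    , λ x y → let i , a , b = sur x y in i , trans (sym (p i)) a , trans (sym (q i)) b

  Independent-notˡ : ∀ {σ τ} → Independent σ τ → Independent (λ i → not (σ i)) τ
  Independent-notˡ {σ} {τ} i = Independent-sym {τ} (Independent-not {τ} {σ} (Independent-sym {σ} {τ} i))

  Independent-flip : ∀ b b′ {σ τ} → Independent σ τ → Independent (flip b σ) (flip b′ τ)
  Independent-flip true  true  {σ} {τ} i = Independent-notˡ {σ} (Independent-not {σ} {τ} i)
  Independent-flip true  false {σ} {τ} i = Independent-notˡ {σ} {τ} i
  Independent-flip false true  {σ} {τ} i = Independent-not {σ} {τ} i
  Independent-flip false false i = i

  xor-cancel : ∀ a b x → a xor x ≡ b xor x → a ≡ b
  xor-cancel true  true  x     _ = refl
  xor-cancel false false x     _ = refl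
  xor-cancel true  false true  ()
  xor-cancel true  false false ()
  xor-cancel false true  true  ()
  xor-cancel false true  false ()

  Independent-xor : ∀ {σ τ} → Independent σ τ → Independent (λ i → σ i xor τ i) τ
  Independent-xor {σ} {τ} (inj , sur) =
      (λ i j p q → inj i j (xor-cancel (σ i) (σ j) (τ i) (trans p (cong (σ j xor_) (sym q)))) q)
    , λ x y → let i , a , b = sur (x xor y) y in i , trans (cong₂ _xor_ a b) (bools≡ 2 (λ x y → (x xor y) xor y) (λ x y → x) x y) , b

  -- Two splits of four indices into pairs.
  independent-splits : ∀ {σ τ : Fin ω → Bool} {a b c d} → (∀ i → (i ≡ a ⊎ i ≡ b) ⊎ (i ≡ c ⊎ i ≡ d)) →
    σ b ≡ σ a → σ d ≡ σ c → σ c ≡ not (σ a) → τ b ≡ not (τ a) → τ d ≡ not (τ c) → Independent σ τ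
  independent-splits {σ} {τ} {a} {b} {c} {d} cover σb σd σc τb τd = (λ i j p q → inj p q (cover i) (cover j)) , sur
    where
    a≁c : ∀ {x y} → x ≡ σ a → y ≡ σ c → x ≡ y → ⊥
    a≁c refl refl p = not-¬ refl (trans p σc)
    class-a : ∀ {i} → i ≡ a ⊎ i ≡ b → σ i ≡ σ a
    class-a (inj₁ refl) = refl
    class-a (inj₂ refl) = σb
    class-c : ∀ {i} → i ≡ c ⊎ i ≡ d → σ i ≡ σ c
    class-c (inj₁ refl) = refl
    class-c (inj₂ refl) = σd
    inj : ∀ {i j} → σ i ≡ σ j → τ i ≡ τ j → (i ≡ a ⊎ i ≡ b) ⊎ (i ≡ c ⊎ i ≡ d) → (j ≡ a ⊎ j ≡ b) ⊎ (j ≡ c ⊎ j ≡ d) → i ≡ j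
    inj p q (inj₁ (inj₁ refl)) (inj₁ (inj₁ refl)) = refl
    inj p q (inj₁ (inj₁ refl)) (inj₁ (inj₂ refl)) = ⊥-elim (not-¬ refl (trans q τb))
    inj p q (inj₁ (inj₂ refl)) (inj₁ (inj₁ refl)) = ⊥-elim (not-¬ refl (trans (sym q) τb))
    inj p q (inj₁ (inj₂ refl)) (inj₁ (inj₂ refl)) = refl
    inj p q (inj₂ (inj₁ refl)) (inj₂ (inj₁ refl)) = refl
    inj p q (inj₂ (inj₁ refl)) (inj₂ (inj₂ refl)) = ⊥-elim (not-¬ refl (trans q τd))
    inj p q (inj₂ (inj₂ refl)) (inj₂ (inj₁ refl)) = ⊥-elim (not-¬ refl (trans (sym q) τd))
    inj p q (inj₂ (inj₂ refl)) (inj₂ (inj₂ refl)) = refl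
    inj p q (inj₁ i) (inj₂ j) = ⊥-elim (a≁c (class-a i) (class-c j) p)
    inj p q (inj₂ i) (inj₁ j) = ⊥-elim (a≁c (class-a j) (class-c i) (sym p))
    either-of : ∀ {u v} (x y : Bool) → σ u ≡ x → σ v ≡ x → τ v ≡ not (τ u) → ∃[ i ] σ i ≡ x × τ i ≡ y
    either-of {u} {v} x y p q r with τ u ≟ᵇ y
    ... | yes h = u , p , h
    ... | no h  = v , q , trans r (sym (not-≢ h))
    sur : ∀ x y → ∃[ i ] σ i ≡ x × τ i ≡ y
    sur x y with σ a ≟ᵇ x
    ... | yes h = either-of x y h (trans σb h) τb
    ... | no h  = either-of x y (trans σc (sym (not-≢ h))) (trans σd (trans σc (sym (not-≢ h)))) τd

  -- Cuts crossing distinct circuits are compatible whatever their transversals, so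
  -- `crossed-circuits` also applies to cuts from different rounds.
  differ : ∀ {σ X p τ Y q} → Six σ X (rep (c p)) → Six τ Y (rep (c q)) → p ≢ q → Independent σ τ →
    (σ p xor τ p) ≢ (σ q xor τ q)
  differ {σ} {τ = τ} S S′ p≢q i h with crossed-circuits S S′ (compatible S S′ (p≢q ∘ c-injective)) i
  ... | p′ , q′ , a , b , d = d (trans (cong (λ j → σ j xor τ j) (c-injective a)) (trans h (cong (λ j → σ j xor τ j) (sym (c-injective b)))))

  -- The second choice of transversal, through a link in the hub of the first.
  module Second {z : Fin ω → Fin #V} (tr : Transversal z) (P : NearPerfect z) {s X t Y : Fin #V → Bool} {p q : Fin ω}
    (col : Coloured tr P t) (bX : BadCut tr P s X) (bY : BadCut tr P t Y)
    (SX : Six (λ i → X (z i)) X (rep (c p))) (SY : Six (λ i → Y (z i)) Y (rep (c q)))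
    (indep : Independent (λ i → X (z i)) (λ i → Y (z i)))
    (Xp : X (z p) ≡ true) (Xq : X (z q) ≡ true) (Yp : Y (z p) ≡ true) (Yq : Y (z q) ≡ false) where
    open NearPerfect P

    σ τ : Fin ω → Bool
    σ i = X (z i)
    τ i = Y (z i)

    private
      con = connection tr P col bX bY SX SY indep Xp Xq Yp Yq

    x y : Fin #V
    x = proj₁ con
    y = proj₁ (proj₂ con)

    module _ where
      open Link N

      x-on-q : rep x ≡ rep (c q)
      x-on-q = proj₁ (proj₂ (proj₂ con))
      y-on-p : rep y ≡ rep (c p)
      y-on-p = proj₁ (proj₂ (proj₂ (proj₂ con)))
      xy-linked : L.rep x ≡ L.rep y
      xy-linked = proj₁ (proj₂ (proj₂ (proj₂ (proj₂ con))))
      xy-opposite : t y ≡ not (t x)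
      xy-opposite = proj₂ (proj₂ (proj₂ (proj₂ (proj₂ con))))

    p≢q′ : p ≢ q
    p≢q′ refl = case trans (sym Yp) Yq of λ ()

    -- Only circuits p and q need special positions, the ends of the link; on the others the base
    -- point serves.
    z′ : Fin ω → Fin #V
    z′ = (c [ p ≔ y ]) [ q ≔ x ]

    z′-p : z′ p ≡ y
    z′-p = trans (update-there _ _ (p≢q′ ∘ sym)) (update-here c p y)
    z′-q : z′ q ≡ x
    z′-q = update-here _ q x

    tr′ : Transversal z′
    tr′ i with p ≟ i | q ≟ i
    ... | yes refl | _ = trans (cong rep z′-p) y-on-p
    ... | no _ | yes refl = trans (cong rep z′-q) x-on-q
    ... | no a | no b = cong rep (trans (update-there _ _ b) (update-there c _ a))

    P₀ : NearPerfect z′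
    P₀ = near-perfect tr′
    N₀ : Fin #E → Bool
    N₀ = NearPerfect.N P₀

    -- Keeping N on even circuits makes every colouring for `N′` alternate along the old links.
    N′ : Fin #E → Bool
    N′ e = if on-odd (end₁ e) then N₀ e else N e

    P′ : NearPerfect z′
    P′ = record { N = N′ ; N⊆F = N′⊆F ; N-degree = degree′ }
      where
      N′⊆F : ∀ e → N′ e ≡ true → f e ≡ true
      N′⊆F e with on-odd (end₁ e)
      ... | true  = NearPerfect.N⊆F P₀ e
      ... | false = N⊆F e
      local : ∀ v → deg N′ v ≡ deg (λ e → if on-odd v then N₀ e else N e) v
      local v = sum-cong-≗ λ e → pointwise e (end₁ e ≟ v) (end₂ e ≟ v)
        where
        value : ∀ e → Bool → ℕ
        value e b = ind (if b then N₀ e else N e)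
        same-value : ∀ e → f e ≡ true ⊎ f e ≡ false → rep (end₁ e) ≡ rep v ⊎ rep (end₂ e) ≡ rep v → value e (on-odd (end₁ e)) ≡ value e (on-odd v)
        same-value e _ (inj₁ h) = cong (value e) (on-odd-rep h)
        same-value e (inj₁ fe) (inj₂ h) = cong (value e) (on-odd-rep (trans (rep-edge fe) h))
        same-value e (inj₂ fe) (inj₂ h) = trans (zero-value (on-odd (end₁ e))) (sym (zero-value (on-odd v)))
          where
          off : ∀ {S : Fin #E → Bool} → (S e ≡ true → f e ≡ true) → ind (S e) ≡ 0
          off {S} h with S e
          ... | false = refl
          ... | true  = case trans (sym (h refl)) fe of λ ()
          zero-value : ∀ b → value e b ≡ 0
          zero-value true  = off {N₀} (NearPerfect.N⊆F P₀ e)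
          zero-value false = off {N} (N⊆F e)
        bool? : ∀ b → b ≡ true ⊎ b ≡ false
        bool? true  = inj₁ refl
        bool? false = inj₂ refl
        pointwise : ∀ e → Dec (end₁ e ≡ v) → Dec (end₂ e ≡ v) → value e (on-odd (end₁ e)) * (ind (end₁ e == v) + ind (end₂ e == v))
          ≡ value e (on-odd v) * (ind (end₁ e == v) + ind (end₂ e == v))
        pointwise e (yes h) _       = cong (_* _) (same-value e (bool? (f e)) (inj₁ (cong rep h)))
        pointwise e (no _) (yes h)  = cong (_* _) (same-value e (bool? (f e)) (inj₂ (cong rep h)))
        pointwise e (no g) (no h)   = trans (zero-incidence (value e (on-odd (end₁ e)))) (sym (zero-incidence (value e (on-odd v))))
          where
          zero-incidence : ∀ k → k * (ind (end₁ e == v) + ind (end₂ e == v)) ≡ 0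
          zero-incidence k = trans (cong (k *_) (cong₂ (λ a b → ind a + ind b) (==-≢ g) (==-≢ h))) (ℕₚ.*-zeroʳ k)
      even-unmarked : ∀ {v} → on-odd v ≡ false → ∀ {w} → Transversal w → mark w v ≡ 0
      even-unmarked {v} h {w} trw = mark-other trw λ where i refl → case trans (sym h) (on-odd-c i (sym (trw i))) of λ ()
      degree′ : ∀ v → deg N′ v + mark z′ v ≡ 1
      degree′ v = trans (cong (_+ mark z′ v) (local v)) (by (on-odd v) refl)
        where
        by : ∀ b → on-odd v ≡ b → deg (λ e → if b then N₀ e else N e) v + mark z′ v ≡ 1
        by true  _ = NearPerfect.N-degree P₀ v
        by false h = trans (cong (deg N v +_) (trans (even-unmarked h tr′) (sym (even-unmarked h tr)))) (N-degree v)

    -- Both `u` and `t` change sign along each edge of a link, so their sum is constant on it, and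
    -- `t` differs at the two ends.
    separates-pq : ∀ {u} → Coloured tr′ P′ u → u (z′ q) ≡ not (u (z′ p))
    separates-pq {u} (uM , uN) = trans (cong u z′-q) (trans (conclude (u x) (u y) (t x) (t y) agree-xy xy-opposite) (cong (λ v → not (u v)) (sym z′-p)))
      where
      constant-on : ∀ e {a b a′ b′ : Bool} → a ≡ not b → a′ ≡ not b′ → b xor b′ ≡ a xor a′
      constant-on e {_} {b} {_} {b′} refl refl = bools≡ 2 _xor_ (λ b b′ → not b xor not b′) b b′
      agree-xy : (u x xor t x) ≡ (u y xor t y)
      agree-xy = Link.linked N (λ v → u v xor t v) (λ e Me → constant-on e (uM e Me) (proj₁ col e Me))
        (λ e Ne oe → constant-on e (uN e (trans (cong (λ b → if b then N₀ e else N e) oe) Ne)) (proj₂ col e Ne)) xy-linked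
      conclude : ∀ a b a′ b′ → (a xor a′) ≡ (b xor b′) → b′ ≡ not a′ → a ≡ not b
      conclude true  true  true  .false () refl
      conclude true  true  false .true  () refl
      conclude true  false _     _ _ _ = refl
      conclude false true  _     _ _ _ = refl
      conclude false false true  .false () refl
      conclude false false false .true  () refl

    result : Flow
    -- A bar marks the opposite quadrant: (σ, τ) is (true, true) at p, (true, false) at q, (false,
    -- false) at p̄ and (false, true) at q̄.
    result with proj₂ indep false false | proj₂ indep false true
    ... | p̄ , σp̄ , τp̄ | q̄ , σq̄ , τq̄ = main
      where
      distinct-σ : ∀ {i j} → σ i ≡ true → σ j ≡ false → i ≢ j
      distinct-σ a b refl = case trans (sym a) b of λ ()
      distinct-τ : ∀ {i j} → τ i ≡ true → τ j ≡ false → i ≢ j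
      distinct-τ a b refl = case trans (sym a) b of λ ()
      p≢q : p ≢ q
      p≢q = distinct-τ Yp Yq
      p≢p̄ : p ≢ p̄
      p≢p̄ = distinct-σ Xp σp̄
      p≢q̄ : p ≢ q̄
      p≢q̄ = distinct-σ Xp σq̄
      q≢p̄ : q ≢ p̄
      q≢p̄ = distinct-σ Xq σp̄
      q≢q̄ : q ≢ q̄
      q≢q̄ = distinct-σ Xq σq̄
      q̄≢p̄ : q̄ ≢ p̄
      q̄≢p̄ = distinct-τ τq̄ τp̄

      data Is (i : Fin ω) : Set where
        isp : i ≡ p → Is i
        isq : i ≡ q → Is i
        isp̄ : i ≡ p̄ → Is i
        isq̄ : i ≡ q̄ → Is i

      is : ∀ i → Is i
      is i with σ i in σi | τ i in τi
      ... | true  | true  = isp (proj₁ indep i p (trans σi (sym Xp)) (trans τi (sym Yp)))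
      ... | true  | false = isq (proj₁ indep i q (trans σi (sym Xq)) (trans τi (sym Yq)))
      ... | false | false = isp̄ (proj₁ indep i p̄ (trans σi (sym σp̄)) (trans τi (sym τp̄)))
      ... | false | true  = isq̄ (proj₁ indep i q̄ (trans σi (sym σq̄)) (trans τi (sym τq̄)))

      -- The third split, which puts opposite quadrants together.
      α : Fin ω → Bool
      α i = σ i xor τ i

      by-cases : ∀ {g h : Fin ω → Bool} → g p ≡ h p → g q ≡ h q → g p̄ ≡ h p̄ → g q̄ ≡ h q̄ → ∀ i → g i ≡ h i
      by-cases a b d e i with is i
      ... | isp refl = a
      ... | isq refl = b
      ... | isp̄ refl = d
      ... | isq̄ refl = e

      αp : α p ≡ false
      αp = cong₂ _xor_ Xp Yp
      αq : α q ≡ true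
      αq = cong₂ _xor_ Xq Yq
      αp̄ : α p̄ ≡ false
      αp̄ = cong₂ _xor_ σp̄ τp̄
      αq̄ : α q̄ ≡ true
      αq̄ = cong₂ _xor_ σq̄ τq̄

      Iατ : Independent α τ
      Iατ = Independent-xor {σ} {τ} indep
      Iασ : Independent α σ
      Iασ = Independent-resp (λ i → xor-comm (τ i) (σ i)) (λ i → refl)
        (Independent-xor {τ} {σ} (Independent-sym {σ} {τ} indep))

      -- If `A` crosses p, then `A` and Y cross circuits on the same diagonal, against `differ`;
      -- likewise `A` and X if `A` crosses q̄. If `A` crosses p̄, the complements of `A` and Y close
      -- a ring with X. If `A` crosses q, the circuit of Y, then `B` takes the place of Y: the same
      -- arguments leave only q̄ for it, and `A`, `B` and X form a ring.
      no-A : ∀ {A B u w} → Six α A (rep (c u)) → Six τ B (rep (c w)) → (α u xor τ u) ≢ (α w xor τ w) → Is u → Is w → ⊥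
      no-A SA SB u≁w (isp refl) w = differ SA SY p≢q Iατ (trans (cong₂ _xor_ αp Yp) (sym (cong₂ _xor_ αq Yq)))
      no-A SA SB u≁w (isq̄ refl) w = differ SA SX (p≢q̄ ∘ sym) Iασ (trans (cong₂ _xor_ αq̄ σq̄) (sym (cong₂ _xor_ αp Xp)))
      no-A SA SB u≁w (isp̄ refl) w = no-ring (Six-not SA) SX (Six-not SY)
        (Independent-notˡ {α} {σ} Iασ) (Independent-not {σ} {τ} indep)
        (Independent-notˡ {τ} (Independent-not {τ} {α} (Independent-sym {α} {τ} Iατ))) q̄
        (cong not αp̄) (cong not αp) (cong not αq) (cong not αq̄) σp̄ Xp Xq σq̄ (cong not τp̄) (cong not Yp) (cong not Yq) (cong not τq̄)
      no-A SA SB u≁w (isq refl) (isp refl) = u≁w (trans (cong₂ _xor_ αq Yq) (sym (cong₂ _xor_ αp Yp)))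
      no-A SA SB u≁w (isq refl) (isq refl) = u≁w refl
      no-A SA SB u≁w (isq refl) (isp̄ refl) = differ SB SX (p≢p̄ ∘ sym) (Independent-sym {σ} {τ} indep)
        (trans (cong₂ _xor_ τp̄ σp̄) (sym (cong₂ _xor_ Yp Xp)))
      no-A SA SB u≁w (isq refl) (isq̄ refl) = no-ring SA SB SX Iατ (Independent-sym {σ} {τ} indep) (Independent-sym {α} {σ} Iασ) p̄
        αq αq̄ αp αp̄ Yq τq̄ Yp τp̄ Xq σq̄ Xp σp̄

      normal : ∀ {u A} → BadCut tr′ P′ u A → ∀ b → BadCut tr′ P′ (flip b u) (flip b A)
      normal h b = BadCut-flip tr′ P′ b h

      main : Flow
      -- Every colouring now separates p from q, so opposing p to q̄ leaves only the split `α`, and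
      -- opposing p to p̄ leaves only `τ`.
      main with opposed tr′ P′ p≢q̄ p≢q p≢p̄ (q≢q̄ ∘ sym) q̄≢p̄ q≢p̄ | opposed tr′ P′ p≢p̄ p≢q p≢q̄ (q≢p̄ ∘ sym) (q̄≢p̄ ∘ sym) q≢q̄
      ... | inj₁ flow | _ = flow
      ... | inj₂ _ | inj₁ flow = flow
      ... | inj₂ (u , A , bA , colA , up̄q , uq̄p) | inj₂ (w , B , bB , colB , wp , wq) = ⊥-elim (clash (bad⇒six tr′ P′ bA′) (bad⇒six tr′ P′ bB′))
        where
        bA′ = normal bA (u (z′ p))
        bB′ = normal bB (not (w (z′ p)))
        A′ B′ : Fin #V → Bool
        A′ = flip (u (z′ p)) A
        B′ = flip (not (w (z′ p))) B
        A′≡α : ∀ i → A′ (z′ i) ≡ α i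
        A′≡α = by-cases
          (trans (cong (u (z′ p) xor_) (BadCut.sides bA p)) (trans (xor-same (u (z′ p))) (sym αp)))
          (trans (cong (u (z′ p) xor_) (trans (BadCut.sides bA q) (separates-pq {u} colA))) (trans (bools≡ 1 (λ a → a xor not a) (λ a → true) (u (z′ p))) (sym αq)))
          (trans (cong (u (z′ p) xor_) (trans (BadCut.sides bA p̄) (trans uq̄p (cong not (separates-pq {u} colA))))) (trans (bools≡ 1 (λ a → a xor not (not a)) (λ a → false) (u (z′ p))) (sym αp̄)))
          (trans (cong (u (z′ p) xor_) (trans (BadCut.sides bA q̄) up̄q)) (trans (bools≡ 1 (λ a → a xor not a) (λ a → true) (u (z′ p))) (sym αq̄)))
        B′≡τ : ∀ i → B′ (z′ i) ≡ τ i
        B′≡τ = by-cases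
          (trans (cong (not (w (z′ p)) xor_) (BadCut.sides bB p)) (trans (xor-inverseˡ (w (z′ p))) (sym Yp)))
          (trans (cong (not (w (z′ p)) xor_) (trans (BadCut.sides bB q) (separates-pq {w} colB))) (trans (bools≡ 1 (λ a → not a xor not a) (λ a → false) (w (z′ p))) (sym Yq)))
          (trans (cong (not (w (z′ p)) xor_) (trans (BadCut.sides bB p̄) wp)) (trans (bools≡ 1 (λ a → not a xor not a) (λ a → false) (w (z′ p))) (sym τp̄)))
          (trans (cong (not (w (z′ p)) xor_) (trans (BadCut.sides bB q̄) (trans wq (cong not (separates-pq {w} colB))))) (trans (bools≡ 1 (λ a → not a xor not (not a)) (λ a → true) (w (z′ p))) (sym τq̄)))
        clash : ∃[ r ] Six (λ i → A′ (z′ i)) A′ r → ∃[ r ] Six (λ i → B′ (z′ i)) B′ r → ⊥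
        clash (r , SA) (r′ , SB) with crossed-circuits SA SB (bad-compatible tr′ P′ bA′ bB′)
            (Independent-resp (λ i → sym (A′≡α i)) (λ i → sym (B′≡τ i)) Iατ)
        ... | i , j , refl , refl , i≁j = no-A (Six-resp A′≡α SA) (Six-resp B′≡τ SB)
              (subst₂ _≢_ (cong₂ _xor_ (A′≡α i) (B′≡τ i)) (cong₂ _xor_ (A′≡α j) (B′≡τ j)) i≁j) (is i) (is j)

  module First where

    tr : Transversal c
    tr i = refl
    P : NearPerfect c
    P = near-perfect tr

    agreeing : ∀ {s X t Y p q} → Coloured tr P t → BadCut tr P s X → BadCut tr P t Y →
      Six (λ i → X (c i)) X (rep (c p)) → Six (λ i → Y (c i)) Y (rep (c q)) → Independent (λ i → X (c i)) (λ i → Y (c i)) →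
      X (c p) ≡ X (c q) → Y (c p) ≢ Y (c q) → Flow
    agreeing {s} {X} {t} {Y} {p} {q} col bX bY SX SY ind-XY Xpq Ypq = Second.result tr P
      (Coloured-flip tr P b′ {t} col) (BadCut-flip tr P b bX) (BadCut-flip tr P b′ bY)
      (Six-flip b {λ i → X (c i)} {X} SX) (Six-flip b′ {λ i → Y (c i)} {Y} SY) (Independent-flip b b′ {λ i → X (c i)} {λ i → Y (c i)} ind-XY)
      (self (X (c p))) (trans (cong (b xor_) (sym Xpq)) (self (X (c p)))) (self (Y (c p)))
      (trans (cong (b′ xor_) (not-≢ Ypq)) (bools≡ 1 (λ a → not a xor not a) (λ a → false) (Y (c p))))
      where
      b b′ : Bool
      b  = not (X (c p))
      b′ = not (Y (c p))
      self : ∀ a → not a xor a ≡ true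
      self = xor-inverseˡ

    -- Exactly one of the cuts separates the two crossed circuits; X and Y exchange roles if
    -- necessary so that it is the second one.
    independent-cuts : ∀ {s X t Y} → Coloured tr P s → Coloured tr P t → BadCut tr P s X → BadCut tr P t Y →
      Independent (λ i → X (c i)) (λ i → Y (c i)) → Flow
    independent-cuts {X = X} {Y = Y} cs ct bX bY ind-XY with bad⇒six tr P bX | bad⇒six tr P bY
    ... | r , SX | r′ , SY with crossed-circuits SX SY (bad-compatible tr P bX bY) ind-XY
    ...   | p , q , refl , refl , p≁q with X (c p) ≟ᵇ X (c q)
    ...     | yes Xpq = agreeing ct bX bY SX SY ind-XY Xpq (λ Ypq → p≁q (cong₂ _xor_ Xpq Ypq))
    ...     | no Xpq  = agreeing cs bY bX SY SX (Independent-sym {λ i → X (c i)} {λ i → Y (c i)} ind-XY)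
                          (same-Y (X (c p)) (X (c q)) (Y (c p)) (Y (c q)) Xpq p≁q) (λ h → Xpq (sym h))
      where
      same-Y : ∀ a b x y → a ≢ b → (a xor x) ≢ (b xor y) → y ≡ x
      same-Y true  true  x     y     g h = ⊥-elim (g refl)
      same-Y false false x     y     g h = ⊥-elim (g refl)
      same-Y true  false true  true  g h = refl
      same-Y true  false false false g h = refl
      same-Y true  false true  false g h = ⊥-elim (h refl)
      same-Y true  false false true  g h = ⊥-elim (h refl)
      same-Y false true  true  true  g h = refl
      same-Y false true  false false g h = refl
      same-Y false true  true  false g h = ⊥-elim (h refl)
      same-Y false true  false true  g h = ⊥-elim (h refl)

    flow : Flow
    -- This first signing is arbitrary: its violated cut only serves to show that there are four odd
    -- circuits.
    flow with signing tr P (λ i → i) (λ i → refl)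
    ... | s₀ , sM , sN , _ with flow-or-bad-cut tr P {s₀} (sM , sN)
    ...   | inj₁ flow    = flow
    ...   | inj₂ (_ , b₀) with four-indices (BadCut.four b₀)
    ...     | i₀ , i₁ , i₂ , i₃ , (d₀₁ , d₀₂ , d₀₃ , d₁₂ , d₁₃ , d₂₃) , cover with opposed tr P d₀₁ d₀₂ d₀₃ d₁₂ d₁₃ d₂₃
    ...       | inj₁ flow = flow
    ...       | inj₂ (s , X , bX , cs , s₁ , s₃) with s (c i₂) ≟ᵇ s (c i₀)
    -- The first cut realises one of two possible splits. Opposing the members of each pair of that
    -- split makes the next cut realise a different one.
    ...         | yes s₂ with opposed tr P d₀₂ d₀₁ d₀₃ (d₁₂ ∘ sym) d₂₃ d₁₃
    ...           | inj₁ flow = flow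
    ...           | inj₂ (t , Y , bY , ct , t₂ , t₃) = independent-cuts cs ct bX bY
      (Independent-resp (λ i → sym (BadCut.sides bX i)) (λ i → sym (BadCut.sides bY i))
        (independent-splits {λ i → s (c i)} {λ i → t (c i)} {i₀} {i₂} {i₁} {i₃} (regroup ∘ cover) s₂ (trans s₃ (trans (cong not s₂) (sym s₁))) s₁ t₂ t₃))
      where
      regroup : ∀ {i} → (i ≡ i₀ ⊎ i ≡ i₁) ⊎ (i ≡ i₂ ⊎ i ≡ i₃) → (i ≡ i₀ ⊎ i ≡ i₂) ⊎ (i ≡ i₁ ⊎ i ≡ i₃)
      regroup (inj₁ (inj₁ p)) = inj₁ (inj₁ p)
      regroup (inj₁ (inj₂ p)) = inj₂ (inj₁ p)
      regroup (inj₂ (inj₁ p)) = inj₁ (inj₂ p)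
      regroup (inj₂ (inj₂ p)) = inj₂ (inj₂ p)
    flow | s₀ , sM , sN , _ | inj₂ (_ , b₀) | i₀ , i₁ , i₂ , i₃ , (d₀₁ , d₀₂ , d₀₃ , d₁₂ , d₁₃ , d₂₃) , cover
      | inj₂ (s , X , bX , cs , s₁ , s₃) | no s₂ with opposed tr P d₀₃ d₀₁ d₀₂ (d₁₃ ∘ sym) (d₂₃ ∘ sym) d₁₂
    ...           | inj₁ flow = flow
    ...           | inj₂ (t , Y , bY , ct , t₃ , t₂) = independent-cuts cs ct bX bY
      (Independent-resp (λ i → sym (BadCut.sides bX i)) (λ i → sym (BadCut.sides bY i))
        (independent-splits {λ i → s (c i)} {λ i → t (c i)} {i₀} {i₃} {i₁} {i₂} (regroup ∘ cover)
          (trans s₃ (trans (cong not s₂′) (not-involutive (s (c i₀))))) (trans s₂′ (sym s₁)) s₁ t₃ t₂))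
      where
      s₂′ : s (c i₂) ≡ not (s (c i₀))
      s₂′ = not-≢ (λ h → s₂ (sym h))
      regroup : ∀ {i} → (i ≡ i₀ ⊎ i ≡ i₁) ⊎ (i ≡ i₂ ⊎ i ≡ i₃) → (i ≡ i₀ ⊎ i ≡ i₃) ⊎ (i ≡ i₁ ⊎ i ≡ i₂)
      regroup (inj₁ (inj₁ p)) = inj₁ (inj₁ p)
      regroup (inj₁ (inj₂ p)) = inj₂ (inj₁ p)
      regroup (inj₂ (inj₁ p)) = inj₂ (inj₂ p)
      regroup (inj₂ (inj₂ p)) = inj₁ (inj₂ p)

-- Subsets, lists and parities of the given definitions

odd⇒%2 : ∀ n → odd n ≡ true → n % 2 ≡ 1
odd⇒%2 1             _ = refl
odd⇒%2 (suc (suc n)) p = odd⇒%2 n (trans (sym (not-involutive (odd n))) p)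

%2⇒odd : ∀ n → n % 2 ≡ 1 → odd n ≡ true
%2⇒odd 1             _ = refl
%2⇒odd (suc (suc n)) p = trans (not-involutive (odd n)) (%2⇒odd n p)

lookup-full─ : ∀ {n} (D : Subset n) e → lookup (full ─ D) e ≡ not (lookup D e)
lookup-full─ (true ∷ D)  zero    = refl
lookup-full─ (false ∷ D) zero    = refl
lookup-full─ (true ∷ D)  (suc e) = lookup-full─ D e
lookup-full─ (false ∷ D) (suc e) = lookup-full─ D e

lookup-full : ∀ {n} (e : Fin n) → lookup full e ≡ true
lookup-full e = lookup-replicate e true

subset-ext : ∀ {n} {S T : Subset n} → (∀ e → lookup S e ≡ lookup T e) → S ≡ T
subset-ext {S = []}    {[]}    h = refl
subset-ext {S = x ∷ S} {y ∷ T} h = cong₂ _∷_ (h zero) (subset-ext (h ∘ suc))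

unique-lookup : ∀ {A : Set} {xs : List A} → Uniq xs → ∀ i j → List.lookup xs i ≡ List.lookup xs j → i ≡ j
unique-lookup (p ∷ u) zero    zero    h = refl
unique-lookup (p ∷ u) zero    (suc j) h = ⊥-elim (All.lookup p (∈-lookup j) h)
unique-lookup (p ∷ u) (suc i) zero    h = ⊥-elim (All.lookup p (∈-lookup i) (sym h))
unique-lookup (p ∷ u) (suc i) (suc j) h = cong suc (unique-lookup u i j h)

unique-map : ∀ {A B : Set} {P : A → Set} (g : A → B) → (∀ {x y} → P x → P y → g x ≡ g y → x ≡ y) →
  ∀ {xs} → All P xs → Uniq xs → Uniq (List.map g xs)
unique-map g inj []       []      = []
unique-map {P = P} g inj (p ∷ ps) (h ∷ u) = differ ps h ∷ unique-map g inj ps u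
  where
  differ : ∀ {ys} → All P ys → All (λ y → _ ≢ y) ys → All (λ b → g _ ≢ b) (List.map g ys)
  differ []       []       = []
  differ (q ∷ qs) (d ∷ ds) = (λ e → d (inj p q e)) ∷ differ qs ds

length-filter : ∀ {n m} (p : Fin n → Bool) (g : Fin m → Fin n) →
  length (List.filter (λ i → p i ≟ᵇ true) (List.tabulate g)) ≡ sum (λ i → ind (p (g i)))
length-filter p g = trans (go g) (sym (sum-is-sum _))
  where
  go : ∀ {m} (g : Fin m → Fin _) → length (List.filter (λ i → p i ≟ᵇ true) (List.tabulate g)) ≡ Σ.sum (λ i → ind (p (g i)))
  go {zero}  g = refl
  go {suc m} g with p (g zero)
  ... | true  = cong suc (go (g ∘ suc))
  ... | false = go (g ∘ suc)

-- The odd circuits of a 2-factor are its odd components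

module OddCircuits (G : Graph) (F : Subset (Graph.#E G)) (two : IsTwoFactor G F) where
  open Graph G
  open Cuts G
  open Components G F

  f : Fin #E → Bool
  f = lookup F

  two-factor : ∀ v → deg f v ≡ 2
  two-factor v = trans (sym (degree-deg F v)) (two v)

  component : Fin #V → Fin #V → Bool
  component r v = rep v == r

  circuit : Fin #V → Subset #E
  circuit r = tabulate λ e → f e ∧ component r (end₁ e)

  circuit-lookup : ∀ r e → lookup (circuit r) e ≡ f e ∧ component r (end₁ e)
  circuit-lookup r e = lookup∘tabulate _ e

  circuit-edge : ∀ {r e} → lookup (circuit r) e ≡ true → f e ≡ true × rep (end₁ e) ≡ r
  circuit-edge {r} {e} h = let p , q = ∧-true (trans (sym (circuit-lookup r e)) h) in p , ==-true q

  edge-circuit : ∀ {r e} → f e ≡ true → rep (end₁ e) ≡ r → lookup (circuit r) e ≡ true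
  edge-circuit {r} {e} p refl = trans (circuit-lookup r e) (cong₂ _∧_ p (==-refl r))

  some-edge : ∀ v → ∃[ e ] f e ≡ true × (end₁ e ≡ v ⊎ end₂ e ≡ v)
  some-edge v with sum-positive (λ e → ind (f e) * (ind (end₁ e == v) + ind (end₂ e == v))) (subst (0 <_) (sym (two-factor v)) (s≤s z≤n))
  ... | e , p = e , incident (f e) (end₁ e ≟ v) (end₂ e ≟ v) p
    where
    incident : ∀ b (d : Dec (end₁ e ≡ v)) (d′ : Dec (end₂ e ≡ v)) → 0 < ind b * (ind (does d) + ind (does d′)) → b ≡ true × (end₁ e ≡ v ⊎ end₂ e ≡ v)
    incident true (yes p) _       _ = refl , inj₁ p
    incident true (no _)  (yes p) _ = refl , inj₂ p
    incident true (no _)  (no _)  ()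
    incident false _      _       ()

  circuit-nonempty : ∀ v → ∃[ e ] lookup (circuit (rep v)) e ≡ true
  circuit-nonempty v with some-edge v
  ... | e , fe , inj₁ p = e , edge-circuit fe (cong rep p)
  ... | e , fe , inj₂ p = e , edge-circuit fe (trans (rep-edge fe) (cong rep p))

  circuit-injective : ∀ {u v} → circuit (rep u) ≡ circuit (rep v) → rep u ≡ rep v
  circuit-injective {u} {v} p with circuit-nonempty u
  ... | e , h = trans (sym (proj₂ (circuit-edge {rep u} h))) (proj₂ (circuit-edge {rep v} (subst (λ C → lookup C e ≡ true) p h)))

  within-circuit : ∀ {r u v} → Connected G F u v → rep u ≡ r → Connected G (circuit r) u v
  within-circuit Star.ε h = Star.ε
  within-circuit {r} (SC.fwd (e , e∈ , refl , refl) Star.◅ p) h =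
    SC.fwd (e , lookup⇒[]= e _ (edge-circuit ([]=⇒lookup e∈) h) , refl , refl) Star.◅ within-circuit p (trans (sym (rep-edge ([]=⇒lookup e∈))) h)
  within-circuit {r} (SC.bwd (e , e∈ , refl , refl) Star.◅ p) h =
    SC.bwd (e , lookup⇒[]= e _ (edge-circuit ([]=⇒lookup e∈) (trans (rep-edge ([]=⇒lookup e∈)) h)) , refl , refl) Star.◅ within-circuit p (trans (rep-edge ([]=⇒lookup e∈)) h)

  -- Edge ends on the circuit are counted twice: two for each edge, and two at each vertex by
  -- 2-regularity.
  circuit-size : ∀ r → ∣ circuit r ∣ ≡ size (component r)
  circuit-size r = ℕₚ.*-cancelˡ-≡ _ _ 2 (begin
    2 * ∣ circuit r ∣                                 ≡⟨ cong (2 *_) (trans (card-sum (circuit r)) (sum-cong-≗ λ e → cong ind (circuit-lookup r e))) ⟩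
    2 * sum (λ e → ind (f e ∧ component r (end₁ e)))  ≡⟨ sum-*ˡ 2 _ ⟨
    sum (λ e → 2 * ind (f e ∧ component r (end₁ e)))  ≡⟨ sum-cong-≗ pointwise ⟩
    sum (λ e → ind (f e) * (ind (component r (end₁ e)) + ind (component r (end₂ e)))) ≡⟨ handshake f (λ v → ind (component r v)) ⟨
    sum (λ v → ind (component r v) * deg f v)         ≡⟨ sum-cong-≗ (λ v → trans (cong (ind (component r v) *_) (two-factor v)) (ℕₚ.*-comm (ind (component r v)) 2)) ⟩
    sum (λ v → 2 * ind (component r v))               ≡⟨ sum-*ˡ 2 _ ⟩
    2 * size (component r) ∎)
    where
    pointwise : ∀ e → 2 * ind (f e ∧ component r (end₁ e)) ≡ ind (f e) * (ind (component r (end₁ e)) + ind (component r (end₂ e)))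
    pointwise e with f e in fe
    ... | false = refl
    ... | true rewrite sym (rep-edge fe) = pair (component r (end₁ e))
      where
      pair : ∀ b → 2 * ind b ≡ ind b + ind b + 0
      pair true  = refl
      pair false = refl

  circuit-degree : ∀ r v → degree G (circuit r) v ≡ 0 ⊎ degree G (circuit r) v ≡ 2
  circuit-degree r v = by (rep v ≟ r)
    where
    value : ∀ e b → (f e ≡ true → component r (end₁ e) ≡ b) → ind (lookup (circuit r) e) ≡ ind (f e ∧ b)
    value e b h = trans (cong ind (circuit-lookup r e)) (go (f e) h)
      where
      go : ∀ x → (x ≡ true → component r (end₁ e) ≡ b) → ind (x ∧ component r (end₁ e)) ≡ ind (x ∧ b)
      go true  h = cong ind (h refl)
      go false h = refl
    local : ∀ b → component r v ≡ b → deg (lookup (circuit r)) v ≡ deg (λ e → f e ∧ b) v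
    local b h = sum-cong-≗ λ e → pointwise e (end₁ e ≟ v) (end₂ e ≟ v)
      where
      pointwise : ∀ e → Dec (end₁ e ≡ v) → Dec (end₂ e ≡ v) →
        ind (lookup (circuit r) e) * (ind (end₁ e == v) + ind (end₂ e == v)) ≡ ind (f e ∧ b) * (ind (end₁ e == v) + ind (end₂ e == v))
      pointwise e (yes p) _      = cong (_* _) (value e b λ _ → trans (cong (component r) p) h)
      pointwise e (no _) (yes p) = cong (_* _) (value e b λ fe → trans (cong (_== r) (trans (rep-edge fe) (cong rep p))) h)
      pointwise e (no p) (no q)  = trans (vanish (ind (lookup (circuit r) e))) (sym (vanish (ind (f e ∧ b))))
        where
        vanish : ∀ k → k * (ind (end₁ e == v) + ind (end₂ e == v)) ≡ 0
        vanish k = trans (cong (k *_) (cong₂ (λ a b → ind a + ind b) (==-≢ p) (==-≢ q))) (ℕₚ.*-zeroʳ k)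
    by : Dec (rep v ≡ r) → degree G (circuit r) v ≡ 0 ⊎ degree G (circuit r) v ≡ 2
    by (yes h) = inj₂ (trans (degree-deg (circuit r) v) (trans (local true (trans (cong (_== r) h) (==-refl r)))
      (trans (sum-cong-≗ λ e → cong (λ b → ind b * (ind (end₁ e == v) + ind (end₂ e == v))) (∧-identityʳ (f e))) (two-factor v))))
    by (no h) = inj₁ (trans (degree-deg (circuit r) v) (trans (local false (==-≢ h))
      (sum-zero λ e → cong (λ b → ind b * (ind (end₁ e == v) + ind (end₂ e == v))) (∧-zeroʳ (f e)))))

  circuit-odd : ∀ a → odd (size (component (rep a))) ≡ true → IsOddCircuitOf G F (circuit (rep a))
  circuit-odd a p =
      (λ {e} e∈ → lookup⇒[]= e F (proj₁ (circuit-edge {rep a} ([]=⇒lookup e∈))))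
    , ( (let e , h = circuit-nonempty a in e , lookup⇒[]= e _ h)
      , circuit-degree (rep a)
      , λ {e} {g} e∈ g∈ → let _ , h = circuit-edge {rep a} ([]=⇒lookup e∈) ; _ , k = circuit-edge {rep a} ([]=⇒lookup g∈) in
          within-circuit (rep⇒connected (trans h (sym k))) h)
    , odd⇒%2 ∣ circuit (rep a) ∣ (trans (cong odd (circuit-size (rep a))) p)

  -- A vertex touched by C already has degree 2 in C, so both of its F-edges belong to C. Hence C
  -- spreads along F to the whole component.
  odd-circuit : ∀ {C} → IsOddCircuitOf G F C → ∃[ a ] C ≡ circuit (rep a) × odd (size (component (rep a))) ≡ true
  odd-circuit {C} (C⊆F , ((e₀ , e₀∈) , degs , conn) , odd-C) = a , C≡ , trans (cong odd (trans (sym (circuit-size (rep a))) (cong ∣_∣ (sym C≡)))) (%2⇒odd ∣ C ∣ odd-C)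
    where
    a : Fin #V
    a = end₁ e₀
    touched : Fin #V → Set
    touched v = deg (lookup C) v ≡ 2
    C≤F : ∀ e → lookup C e ≡ true → f e ≡ true
    C≤F e h = []=⇒lookup (C⊆F (lookup⇒[]= e C h))
    inc : Fin #V → Fin #E → ℕ
    inc v e = ind (end₁ e == v) + ind (end₂ e == v)
    all-edges : ∀ {v} → touched v → ∀ e → f e ≡ true → 0 < inc v e → lookup C e ≡ true
    all-edges {v} t e fe pos = conclude (lookup C e) (sum-tight {f = λ e → ind (lookup C e) * inc v e} {λ e → ind (f e) * inc v e}
        (λ e → ℕₚ.*-monoˡ-≤ (inc v e) (below (lookup C e) (f e) (C≤F e)))
        (≤-reflexive (trans (two-factor v) (sym t))) e)
      where
      below : ∀ a b → (a ≡ true → b ≡ true) → ind a ≤ ind b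
      below true  b h rewrite h refl = s≤s z≤n
      below false b h = z≤n
      conclude : ∀ b → ind b * inc v e ≡ ind (f e) * inc v e → b ≡ true
      conclude true  _ = refl
      conclude false h = ⊥-elim (ℕₚ.<-irrefl (trans h (trans (cong (λ x → ind x * inc v e) fe) (ℕₚ.+-identityʳ _))) pos)
    inc₁ : ∀ e → 0 < inc (end₁ e) e
    inc₁ e = subst (λ b → 0 < ind b + ind (end₂ e == end₁ e)) (sym (==-refl (end₁ e))) (s≤s z≤n)
    inc₂ : ∀ e → 0 < inc (end₂ e) e
    inc₂ e = subst (λ b → 0 < ind (end₁ e == end₂ e) + ind b) (sym (==-refl (end₂ e))) (subst (0 <_) (ℕₚ.+-comm 1 (ind (end₁ e == end₂ e))) (s≤s z≤n))
    touch : ∀ {v e} → lookup C e ≡ true → 0 < inc v e → touched v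
    touch {v} {e} Ce pos with degs v
    ... | inj₂ d = trans (sym (degree-deg C v)) d
    ... | inj₁ d = ⊥-elim (ℕₚ.<-irrefl (sym (sum≡0 (λ e → ind (lookup C e) * inc v e) (trans (sym (degree-deg C v)) d) e))
            (subst (λ b → 0 < ind b * inc v e) (sym Ce) (subst (0 <_) (sym (ℕₚ.+-identityʳ (inc v e))) pos)))
    spread : ∀ {u v} → Connected G F u v → touched u → touched v
    spread Star.ε t = t
    spread (SC.fwd (e , e∈ , refl , refl) Star.◅ p) t = spread p (touch (all-edges t e ([]=⇒lookup e∈) (inc₁ e)) (inc₂ e))
    spread (SC.bwd (e , e∈ , refl , refl) Star.◅ p) t = spread p (touch (all-edges t e ([]=⇒lookup e∈) (inc₂ e)) (inc₁ e))
    forth : ∀ e → lookup C e ≡ true → lookup (circuit (rep a)) e ≡ true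
    forth e h = edge-circuit (C≤F e h) (connected⇒rep (Eq.map (λ where (g , g∈ , p , q) → g , C⊆F g∈ , p , q) (conn (lookup⇒[]= e C h) e₀∈)))
    back : ∀ e → lookup (circuit (rep a)) e ≡ true → lookup C e ≡ true
    back e h = let p , q = circuit-edge {rep a} h in
      all-edges (spread (rep⇒connected (sym q)) (touch ([]=⇒lookup e₀∈) (inc₁ e₀))) e p (inc₁ e)
    C≡ : C ≡ circuit (rep a)
    C≡ = subset-ext λ e → agree (lookup C e) (lookup (circuit (rep a)) e) (forth e) (back e)
      where
      agree : ∀ x y → (x ≡ true → y ≡ true) → (y ≡ true → x ≡ true) → x ≡ y
      agree true  y     h k = sym (h refl)
      agree false true  h k = k refl
      agree false false h k = refl

  -- The test for being its own representative makes each component count once.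
  odd-component? : Fin #V → Bool
  odd-component? r = (rep r == r) ∧ odd (size (component r))

  odd-reps : List (Fin #V)
  odd-reps = List.filter (λ r → odd-component? r ≟ᵇ true) (allFin #V)

  odd-reps-odd : ∀ {r} → r ∈ odd-reps → odd-component? r ≡ true
  odd-reps-odd r∈ = proj₂ (∈-filter⁻ (λ r → odd-component? r ≟ᵇ true) {xs = allFin #V} r∈)

  number-of-odd-circuits : HasSize (IsOddCircuitOf G F) (sum λ r → ind (odd-component? r))
  number-of-odd-circuits = List.map circuit odd-reps
    , unique-map circuit injective (All.tabulate λ r∈ → ==-true (proj₁ (∧-true (odd-reps-odd r∈)))) (Unique.filter⁺ (λ r → odd-component? r ≟ᵇ true) (Unique.tabulate⁺ λ p → p))
    , trans (length-map circuit odd-reps) (length-filter odd-component? (λ i → i))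
    , λ C → mk⇔ to from
    where
    injective : ∀ {x y} → rep x ≡ x → rep y ≡ y → circuit x ≡ circuit y → x ≡ y
    injective {x} {y} p q h = trans (sym p) (trans (circuit-injective (trans (cong circuit p) (trans h (cong circuit (sym q))))) q)
    to : ∀ {C} → C ∈ List.map circuit odd-reps → IsOddCircuitOf G F C
    to C∈ with ∈-map⁻ circuit C∈
    ... | r , r∈ , refl = let p , q = ∧-true {rep r == r} (odd-reps-odd r∈) in
      subst (λ x → IsOddCircuitOf G F (circuit x)) (==-true p) (circuit-odd r (trans (cong (λ x → odd (size (component x))) (==-true p)) q))
    from : ∀ {C} → IsOddCircuitOf G F C → C ∈ List.map circuit odd-reps
    from h with odd-circuit h
    ... | a , refl , p = ∈-map⁺ circuit (∈-filter⁺ (λ r → odd-component? r ≟ᵇ true) (∈-allFin (rep a))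
        (cong₂ _∧_ (trans (cong (_== rep a) (rep-rep a)) (==-refl (rep a))) p))

-- Every odd circuit of the complement of M₁ contains an end of an edge of M₁ ∩ M₂.

module FewOddCircuits (G : Graph) (cubic : Cubic G) (M₁ M₂ : Subset (Graph.#E G)) (m₁ : IsOneFactor G M₁) (m₂ : IsOneFactor G M₂) where
  open Graph G
  open Cuts G

  F : Subset #E
  F = tabulate λ e → not (lookup M₁ e)

  cubic-deg : ∀ v → deg every v ≡ 3
  cubic-deg v = trans (sum-cong-≗ λ e → cong (λ b → ind b * (ind (end₁ e == v) + ind (end₂ e == v))) (sym (lookup-full e))) (trans (sym (degree-deg full v)) (cubic v))

  F-lookup : ∀ e → lookup F e ≡ not (lookup M₁ e)
  F-lookup e = lookup∘tabulate _ e

  two : IsTwoFactor G F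
  two v = trans (degree-deg F v) (ℕₚ.+-cancelˡ-≡ 1 _ _ (begin
    1 + deg (lookup F) v                    ≡⟨ cong (_+ deg (lookup F) v) (trans (sym (m₁ v)) (degree-deg M₁ v)) ⟩
    deg (lookup M₁) v + deg (lookup F) v    ≡⟨ sum-+ _ _ ⟨
    _                                       ≡⟨ sum-cong-≗ (λ e → pointwise (lookup M₁ e) (lookup F e) _ (F-lookup e)) ⟩
    deg every v                             ≡⟨ cubic-deg v ⟩
    3 ∎))
    where
    pointwise : ∀ a b k → b ≡ not a → ind a * k + ind b * k ≡ 1 * k
    pointwise true  .false k refl = ℕₚ.+-identityʳ _
    pointwise false .true  k refl = refl

  open OddCircuits G F two
  open Components G F using (rep; rep-edge)

  D : Fin #E → Bool
  D e = lookup M₁ e ∧ lookup M₂ e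
  rest : Fin #E → Bool
  rest e = not (lookup M₁ e) ∧ lookup M₂ e

  D-rest : ∀ v → deg D v + deg rest v ≡ 1
  D-rest v = trans (sym (sum-+ _ _)) (trans (sum-cong-≗ λ e → pointwise (lookup M₁ e) (lookup M₂ e) _) (trans (sym (degree-deg M₂ v)) (m₂ v)))
    where
    pointwise : ∀ a b k → ind (a ∧ b) * k + ind (not a ∧ b) * k ≡ ind b * k
    pointwise true  b k = ℕₚ.+-identityʳ _
    pointwise false b k = refl

  rest-even : ∀ r → odd (sum λ v → ind (component r v) * deg rest v) ≡ false
  rest-even r = trans (cong odd (handshake rest (λ v → ind (component r v)))) (trans (odd-sum pointwise) (cong odd (sum-zero {#E} {λ _ → 0} λ _ → refl)))
    where
    pointwise : ∀ e → odd (ind (rest e) * (ind (component r (end₁ e)) + ind (component r (end₂ e)))) ≡ false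
    pointwise e with rest e in h
    ... | false = refl
    ... | true rewrite rep-edge {e} (trans (F-lookup e) (proj₁ (∧-true h))) =
      trans (cong odd (ℕₚ.+-identityʳ (ind (component r (end₂ e)) + ind (component r (end₂ e))))) (odd-double (ind (component r (end₂ e))))

  -- If no common edge had an end in the component, M₂ would match its vertices along edges of F,
  -- hence among themselves, and their number would be even.
  witness : ∀ r → ind (odd-component? r) ≤ sum (λ v → ind (component r v) * deg D v)
  witness r with odd-component? r in h
  ... | false = z≤n
  ... | true  = ℕₚ.n≢0⇒n>0 λ zero-sum → case trans (sym (proj₂ (∧-true {rep r == r} h))) (trans (cong odd (sum-cong-≗ λ v →
        pointwise (component r v) (deg D v) (deg rest v) (D-rest v) (sum≡0 _ zero-sum v))) (rest-even r)) of λ ()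
    where
    pointwise : ∀ b d k → d + k ≡ 1 → ind b * d ≡ 0 → ind b ≡ ind b * k
    pointwise false d k p q = refl
    pointwise true  zero k p q = trans (sym p) (sym (ℕₚ.+-identityʳ k))

  -- Each end of a common edge lies in one component, so the odd components number at most twice the
  -- common edges.
  few : ∀ {μ} → ∣ M₁ ∩ M₂ ∣ ≡ μ → μ ≤ 2 → sum (λ r → ind (odd-component? r)) ≤ 4
  few {μ} refl μ≤2 = ≤-trans (sum-mono witness) (≤-trans (≤-reflexive (begin
    sum (λ r → sum (λ v → ind (component r v) * deg D v)) ≡⟨ ∑-comm _ ⟩
    sum (λ v → sum (λ r → ind (component r v) * deg D v)) ≡⟨ sum-cong-≗ (λ v → sum-δ (λ _ → deg D v) (rep v)) ⟩
    sum (λ v → deg D v)                                   ≡⟨ sum-cong-≗ (λ v → ℕₚ.+-identityʳ (deg D v)) ⟨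
    sum (λ v → 1 * deg D v)                               ≡⟨ handshake D (λ _ → 1) ⟩
    sum (λ e → ind (D e) * 2)                             ≡⟨ sum-cong-≗ (λ e → ℕₚ.*-comm (ind (D e)) 2) ⟩
    sum (λ e → 2 * ind (D e))                             ≡⟨ sum-*ˡ 2 _ ⟩
    2 * sum (λ e → ind (D e))                             ≡⟨ cong (2 *_) (trans (card-sum (M₁ ∩ M₂)) (sum-cong-≗ λ e → cong ind (lookup-zipWith _∧_ e M₁ M₂))) ⟨
    2 * ∣ M₁ ∩ M₂ ∣ ∎)) (ℕₚ.*-monoʳ-≤ 2 μ≤2))

-- The setting obtained from a minimum 2-factor, and the theorem

module _ (G : Graph) (cubic : ∀ v → Cuts.deg G (Cuts.every G) v ≡ 3) (F : Subset (Graph.#E G)) (two : IsTwoFactor G F)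
         {ω k : ℕ} (ω≤4 : ω ≤ 4) (6≤k : 6 ≤ k) (circuits : HasSize (IsOddCircuitOf G F) ω)
         (inseparable : ω ≡ 0 ⊎ ¬ (∃[ D ] IsEdgeCut G D × ∣ D ∣ < k × SeparatesOddCircuits G F D)) where
  open Graph G
  open Cuts G
  open Components G F
  open OddCircuits G F two

  private
    xs : List (Subset #E)
    xs = proj₁ circuits
    at : Fin ω → Fin (length xs)
    at = subst Fin (sym (proj₁ (proj₂ (proj₂ circuits))))
    at-injective : ∀ {i j} → at i ≡ at j → i ≡ j
    at-injective = subst-injective (sym (proj₁ (proj₂ (proj₂ circuits))))
    at-surjective : ∀ j → ∃[ i ] at i ≡ j
    at-surjective j = subst Fin (proj₁ (proj₂ (proj₂ circuits))) j , subst-sym-subst (proj₁ (proj₂ (proj₂ circuits)))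
    odd-at : ∀ i → ∃[ a ] List.lookup xs (at i) ≡ circuit (rep a) × odd (size (component (rep a))) ≡ true
    odd-at i = odd-circuit (Equivalence.to (proj₂ (proj₂ (proj₂ circuits)) _) (∈-lookup (at i)))
    c : Fin ω → Fin #V
    c i = proj₁ (odd-at i)
    c-injective : ∀ {i j} → rep (c i) ≡ rep (c j) → i ≡ j
    c-injective {i} {j} p = at-injective (unique-lookup (proj₁ (proj₂ circuits)) (at i) (at j)
      (trans (proj₁ (proj₂ (odd-at i))) (trans (cong circuit p) (sym (proj₁ (proj₂ (odd-at j)))))))
    c-all : ∀ r → odd (size (component r)) ≡ true → ∃[ i ] rep (c i) ≡ r
    c-all r p with sum-positive (λ v → ind (component r v)) (positive _ p)
      where
      positive : ∀ n → odd n ≡ true → 0 < n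
      positive (suc n) _ = s≤s z≤n
    ... | v , q with rep v ≟ r
    ...   | yes refl = let v∈ = Equivalence.from (proj₂ (proj₂ (proj₂ circuits)) _) (circuit-odd v p) ; i , ai = at-surjective (Any.index v∈) in
            i , circuit-injective (trans (sym (proj₁ (proj₂ (odd-at i)))) (trans (cong (List.lookup xs) ai) (sym (lookup-index v∈))))

    -- Q is constant on the components left by its boundary, so the components around the two
    -- circuits differ; each circuit survives because Q is constant on it.
    separation : ∀ Q i j → cut every Q ≤ 5 → (∀ v → rep v ≡ rep (c i) → Q v ≡ true) → (∀ v → rep v ≡ rep (c j) → Q v ≡ false) → ⊥
    separation Q i j Q≤5 inQ outQ = contradict inseparable
      where
      D : Subset #E
      D = ∂ G (tabulate Q)
      D-lookup : ∀ e → lookup D e ≡ cross Q e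
      D-lookup e = trans (lookup∘tabulate _ e) (cong₂ _xor_ (lookup∘tabulate Q (end₁ e)) (lookup∘tabulate Q (end₂ e)))
      open module R = Components G (full ─ D) using () renaming (rep to rest)
      kept : ∀ {e} → Q (end₁ e) ≡ Q (end₂ e) → e Sub.∈ full ─ D
      kept {e} p = lookup⇒[]= e _ (trans (lookup-full─ D e) (cong not (trans (D-lookup e)
        (trans (cong (_xor Q (end₂ e)) p) (xor-same (Q (end₂ e)))))))
      from-not : ∀ {b} → not b ≡ true → b ≡ false
      from-not {false} _ = refl
      equal : ∀ a b → a xor b ≡ false → a ≡ b
      equal true  true  _ = refl
      equal false false _ = refl
      same-side : ∀ {u v} → Connected G (full ─ D) u v → Q u ≡ Q v
      same-side = Eq.gfold isEquivalence Q λ where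
        (e , e∈ , refl , refl) → equal (Q (end₁ e)) (Q (end₂ e)) (trans (sym (D-lookup e)) (from-not (trans (sym (lookup-full─ D e)) ([]=⇒lookup e∈))))
      side-of : Fin #V → Subset #V
      side-of a = tabulate λ v → rest v == rest a
      in-side : ∀ {a v} → rest v ≡ rest a → v Sub.∈ side-of a
      in-side {a} {v} p = lookup⇒[]= v _ (trans (lookup∘tabulate _ v) (trans (cong (_== rest a) p) (==-refl (rest a))))
      from-side : ∀ {a v} → v Sub.∈ side-of a → rest v ≡ rest a
      from-side {a} {v} v∈ = ==-true (trans (sym (lookup∘tabulate _ v)) ([]=⇒lookup v∈))
      is-component : ∀ a → IsComponent G (full ─ D) (side-of a)
      is-component a = (a , in-side refl) , λ {u} u∈ v → mk⇔
        (λ v∈ → R.rep⇒connected (trans (from-side u∈) (sym (from-side v∈))))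
        (λ p → in-side (trans (sym (R.connected⇒rep p)) (from-side u∈)))
      contains : ∀ i x → (∀ v → rep v ≡ rep (c i) → Q v ≡ x) → ContainsOddCircuit G F (full ─ D) (side-of (c i))
      contains i x onQ = circuit (rep (c i)) , circuit-odd (c i) (proj₂ (proj₂ (odd-at i))) , sub , λ {e} e∈ →
          let fe , p = circuit-edge {rep (c i)} ([]=⇒lookup e∈) in reach p , reach (trans (sym (rep-edge fe)) p)
        where
        sub : circuit (rep (c i)) Sub.⊆ full ─ D
        sub {e} e∈ = let fe , p = circuit-edge {rep (c i)} ([]=⇒lookup e∈) in
          kept (trans (onQ _ p) (sym (onQ _ (trans (sym (rep-edge fe)) p))))
        reach : ∀ {v} → rep v ≡ rep (c i) → v Sub.∈ side-of (c i)
        reach {v} p = in-side (R.connected⇒rep (Eq.map (λ where (g , g∈ , a , b) → g , sub g∈ , a , b) (within-circuit (rep⇒connected p) p)))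
      contradict : ω ≡ 0 ⊎ ¬ (∃[ D ] IsEdgeCut G D × ∣ D ∣ < k × SeparatesOddCircuits G F D) → ⊥
      contradict (inj₁ ω≡0) = case subst Fin ω≡0 i of λ ()
      contradict (inj₂ h) = h (D
        , (tabulate Q , (c i , lookup⇒[]= (c i) _ (trans (lookup∘tabulate Q (c i)) (inQ _ refl)))
                      , (c j , λ cj∈ → case trans (sym ([]=⇒lookup cj∈)) (trans (lookup∘tabulate Q (c j)) (outQ _ refl)) of λ ()) , refl)
        , ≤-trans (s≤s (≤-trans (≤-reflexive (trans (card-sum D) (sum-cong-≗ λ e → cong ind (D-lookup e)))) Q≤5)) 6≤k
        , side-of (c i) , side-of (c j) , distinct
        , is-component (c i) , contains i true inQ , is-component (c j) , contains j false outQ)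
        where
        distinct : side-of (c i) ≢ side-of (c j)
        distinct p = case trans (sym (inQ _ refl)) (trans (same-side (R.rep⇒connected (from-side (subst (c i Sub.∈_) p (in-side refl))))) (outQ _ refl)) of λ ()

  setting : Setting
  setting = record
    { G = G ; cubic = cubic ; F = F ; two-factor = two-factor ; ω = ω ; ω≤4 = ω≤4 ; c = c ; c-injective = c-injective
    ; c-odd = λ i → proj₂ (proj₂ (odd-at i)) ; c-all = c-all ; separation = separation }

theorem2p6 : (G : Graph) → Cubic G → Bridgeless G →
    (m* : ℕ ⁺) → Ism* G m* → [ 6 ] ≤⁺ m* →
    (μ₂ : ℕ) → Isμ₂ G μ₂ → μ₂ ≤ 2 →
    NowhereZeroFlow G 5
-- With oddness 0 there is no pair of odd circuits to separate, and 6 itself serves as the bound.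
theorem2p6 G cubic _ _ (oddness-zero ((F , two , circuits) , _)) _ μ₂ ((M₁ , M₂ , m₁ , m₂ , _) , _) μ₂≤2 =
  Assembly.First.flow (setting G cubic-deg F two z≤n ≤-refl circuits (inj₁ refl))
  where open FewOddCircuits G cubic M₁ M₂ m₁ m₂ using (cubic-deg)
theorem2p6 G cubic _ _ (oddness-positive _ _ ((F , (two , ω , (_ , minimal) , circuits) , inseparable , _) , _)) (NonStrict.[_] 6≤k)
  μ₂ ((M₁ , M₂ , m₁ , m₂ , size≡) , _) μ₂≤2 =
  -- Two 2-factors meet here: F attains m*, while the complement of M₁ bounds ω by minimality.
  Assembly.First.flow (setting G cubic-deg F two (≤-trans (minimal _ (Few.F , Few.two , OddCircuits.number-of-odd-circuits G Few.F Few.two)) (Few.few size≡ μ₂≤2))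
    6≤k circuits (inj₂ inseparable))
  where
  module Few = FewOddCircuits G cubic M₁ M₂ m₁ m₂
  open Few using (cubic-deg)
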